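{- Let $i\geq 3$ and $j\geq 2i+1$ be integers. Then for every $n$, every $n$-vertex simple graph $G$ that is $(i,j)$-critical (in the DP sense defined in the context) satisfies $$|E(G)|\geq \frac{(2i+1)n+j-i+1}{i+1};$$ equivalently, $g_{DP}(i,j,n)\geq \frac{(2i+1)n+j-i+1}{i+1}$. Moreover, this bound is sharp: for each such pair $(i,j)$ there are infinitely many $n$ for which there exists an $n$-vertex $(i,j)$-critical simple graph with exactly $\frac{(2i+1)n+j-i+1}{i+1}$ edges.
   Context: Let $G$ be a simple graph. A 2-fold cover of $G$ is a pair $\mathcal{H}=(L,H)$ where $H$ is a graph and $L:V(G)\to 2^{V(H)}$ is such that: the sets $L(u)$, $u\in V(G)$, partition $V(H)$; $|L(u)|=2$ and $H[L(u)]$ is complete for every $u$; if there is an edge of $H$ between $L(u)$ and $L(v)$ with $u\neq v$ then $uv\in E(G)$; and for each edge $uv\in E(G)$ the edges of $H$ between $L(u)$ and $L(v)$ form a matching. For each $u$, the two vertices of $L(u)$ are designated as $p(u)$ (poor) and $r(u)$ (rich). An $\mathcal{H}$-map is a function $\phi:V(G)\to V(H)$ with $\phi(v)\in L(v)$ for all $v$; $H_\phi$ denotes the subgraph of $H$ induced by $\phi(V(G))$. For integers $0\le i\le j$, an $\mathcal{H}$-map $\phi$ is an $(i,j)$-defective $\mathcal{H}$-coloring if every poor vertex in $H_\phi$ has degree at most $i$ in $H_\phi$ and every rich vertex in $H_\phi$ has degree at most $j$ in $H_\phi$. $G$ is $(i,j)$-colorable if it has such a coloring for every 2-fold cover $\mathcal{H}$,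 and $(i,j)$-critical if it is not $(i,j)$-colorable but every proper subgraph is. $g_{DP}(i,j,n)$ denotes the minimum number of edges of an $n$-vertex $(i,j)$-critical simple graph. -}

module Defs where

open import Data.Nat using (ℕ; zero; suc; _+_; _*_; _∸_; _≤_; _<ᵇ_)
open import Data.Bool using (Bool; true; false; if_then_else_; _∧_)
open import Data.Fin using (Fin; toℕ)
open import Data.List using (List; map; allFin)
open import Data.Nat.ListAction using (sum)
open import Data.Product using (Σ; ∃; _×_; _,_)
open import Relation.Nullary using (¬_)
open import Relation.Binary.PropositionalEquality using (_≡_; _≢_)

count : {n : ℕ} → (Fin n → Bool) → ℕ
count {n} P = sum (map (λ x → if P x then 1 else 0) (allFin n))

sumF : {n : ℕ} → (Fin n → ℕ) → ℕ
sumF {n} f = sum (map f (allFin n))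

record Graph (n : ℕ) : Set where
  field
    adj   : Fin n → Fin n → Bool
    sym   : ∀ u v → adj u v ≡ adj v u
    irrefl : ∀ u → adj u u ≡ false
open Graph public

edgeCount : {n : ℕ} → Graph n → ℕ
edgeCount {n} G = sumF (λ u → count (λ v → adj G u v ∧ (toℕ u <ᵇ toℕ v)))

-- A 2-fold cover of G.  V(H) = Fin n × Bool, L(u) = {(u,false),(u,true)},
-- p(u) = (u,false) (poor), r(u) = (u,true) (rich).
record Cover {n : ℕ} (G : Graph n) : Set where
  field
    hadj     : Fin n × Bool → Fin n × Bool → Bool
    hsym     : ∀ x y → hadj x y ≡ hadj y x
    hirrefl  : ∀ x → hadj x x ≡ false
    hcomplete : ∀ u → hadj (u , false) (u , true) ≡ true
    hedge    : ∀ u v a b → u ≢ v → hadj (u , a) (v , b) ≡ true → adj G u v ≡ true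
    hmatch₁  : ∀ u v a b b' → u ≢ v → hadj (u , a) (v , b) ≡ true →
               hadj (u , a) (v , b') ≡ true → b ≡ b'
    hmatch₂  : ∀ u v a a' b → u ≢ v → hadj (u , a) (v , b) ≡ true →
               hadj (u , a') (v , b) ≡ true → a ≡ a'
open Cover public

-- An H-map: φ v = false means φ(v) = p(v), φ v = true means φ(v) = r(v)
HMap : ℕ → Set
HMap n = Fin n → Bool

degφ : {n : ℕ} {G : Graph n} → Cover G → HMap n → Fin n → ℕ
degφ C φ v = count (λ u → hadj C (u , φ u) (v , φ v))

capacity : ℕ → ℕ → Bool → ℕ
capacity i j false = i
capacity i j true  = j

IsDefectiveColoring : {n : ℕ} {G : Graph n} → ℕ → ℕ → Cover G → HMap n → Set
IsDefectiveColoring i j C φ = ∀ v → degφ C φ v ≤ capacity i j (φ v)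

Colorable : ℕ → ℕ → {n : ℕ} → Graph n → Set
Colorable i j {n} G = (C : Cover G) → ∃ λ (φ : HMap n) → IsDefectiveColoring i j C φ

IsSubgraphVia : {m n : ℕ} → Graph m → Graph n → (Fin m → Fin n) → Set
IsSubgraphVia G' G f =
  (∀ x y → f x ≡ f y → x ≡ y) ×
  (∀ u v → adj G' u v ≡ true → adj G (f u) (f v) ≡ true)

IsWholeVia : {m n : ℕ} → Graph m → Graph n → (Fin m → Fin n) → Set
IsWholeVia G' G f =
  (∀ y → ∃ λ x → f x ≡ y) ×
  (∀ u v → adj G (f u) (f v) ≡ true → adj G' u v ≡ true)

Critical : ℕ → ℕ → {n : ℕ} → Graph n → Set
Critical i j {n} G =
  ¬ Colorable i j G ×
  (∀ (m : ℕ) (G' : Graph m) (f : Fin m → Fin n) →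
     IsSubgraphVia G' G f → ¬ IsWholeVia G' G f → Colorable i j G')

{-# OPTIONS --safe #-}
module Submission where

-- Write k = i + 1 and m = j − i + 1, and give every vertex v poor and rich tolerances p(v) ≤ k and
-- r(v) ≤ j + 1, the numbers of conflicts it does not survive. The slack of a vertex set Y is
-- Σ_{v ∈ Y} (p(v) + r(v) − m) + m − k |E(Y)|. The key fact is that a graph all of whose vertex sets have
-- slack at least 1 is colourable. In a minimal counterexample, colour a set X of small slack and extend
-- the colouring outside by cutting to zero the budget of every colour that X conflicts with: each edge
-- pays for at most one cut, and the remaining sparse problem is solved by deleting edges. This rules
-- out proper sets of slack 1, and an analysis of the sets of slack 2 leaves a vertex all of whose
-- neighbours have degree two; it is fixed to one colour and its neighbours are deleted one at a time.
-- In a critical graph a largest set of slack at most 0 must be everything, as otherwise its colouring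
-- extends; this is the bound. For sharpness, gadgets of total slack −1 are hung on one hub vertex until
-- neither colour of the hub is possible; one gadget is a chain of arbitrary length.

open import Defs renaming (sym to adj-sym)
open import Data.Nat using (ℕ; zero; suc; pred; _+_; _*_; _∸_; _≤_; _<_; _<ᵇ_; z≤n; s≤s; _≤?_; _<?_; _≡ᵇ_)
open import Data.Nat.Properties
open import Data.Nat.Tactic.RingSolver using (solve-∀)
open import Data.Bool using (Bool; true; false; if_then_else_; _∧_; _∨_; not; _xor_)
open import Data.Bool.Properties using (∧-comm; ∨-comm; ∧-zeroʳ; ∧-identityʳ; ¬-not) renaming (_≟_ to _≟B_)
open import Data.Fin using (Fin; zero; suc; toℕ; punchIn; punchOut)
open import Data.Fin.Properties using (toℕ-injective; punchInᵢ≢i; punchIn-injective; punchIn-punchOut; all?; any?) renaming (_≟_ to _≟F_)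
open import Data.List.Properties using (map-tabulate)
open import Data.Nat.ListAction using (sum)
open import Data.Vec.Functional using (insertAt)
open import Data.Vec.Functional.Properties using (insertAt-punchIn)
open import Data.Fin.Subset.Properties using (anySubset?)
open import Data.Vec using (lookup; tabulate)
open import Data.Vec.Properties using (lookup∘tabulate)
open import Data.Product using (∃; _×_; _,_; proj₁; proj₂)
open import Data.Sum using (_⊎_; inj₁; inj₂)
open import Data.Unit using (tt)
open import Data.Empty using (⊥; ⊥-elim)
open import Function using (_∘_; id; case_of_)
open import Relation.Nullary using (¬_; Dec; yes; no; does; map′)
open import Relation.Nullary.Decidable using (_×-dec_; _→-dec_; toWitness; decidable-stable; ¬?; dec-true; dec-false)
open import Relation.Binary.PropositionalEquality
open import Relation.Binary using (tri<; tri≈; tri>)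

-- The obstacle is that deleting an edge relaxes only the sets containing both of its ends, by k,
-- while the tolerance given up at the ends is charged also to every set containing just one of
-- them. Such a set needs slack to spare, which is why proper sets of slack one and two must be
-- understood and why vertices whose removal leaves slack two are exceptional. Tolerances vary
-- between vertices because every reduction lowers some of them. The two colours are reconciled by
-- splitting a rich tolerance r into a fixed part μ = m - 1 = j - i and a budget r - μ ≤ k. The
-- hypothesis j ≥ 2i + 1 says k ≤ μ, so a poor tolerance p ≤ k fits into the fixed part: p + (r - μ)
-- ≤ r, and a unit of poor budget also pays for a conflict in the rich colour. At full tolerances p
-- + r - m = 2k - 1. A new vertex with one edge thus raises the slack by k - 1 and one with two
-- edges lowers it by one; the gadgets are assembled from these two moves.

infixr 4.5 _▸_
_▸_ : Bool → ℕ → ℕ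
b ▸ x = if b then x else 0

infix 4 _==_
_==_ : ∀ {n} → Fin n → Fin n → Bool
u == v = does (u ≟F v)

==-refl : ∀ {n} (u : Fin n) → (u == u) ≡ true
==-refl u = dec-true (u ≟F u) refl

==-≡ : ∀ {n} (u v : Fin n) → (u == v) ≡ true → u ≡ v
==-≡ u v p with u ≟F v
... | yes q = q

==-≢ : ∀ {n} {u v : Fin n} → u ≢ v → (u == v) ≡ false
==-≢ {u = u} {v} = dec-false (u ≟F v)

true≢false : ∀ {b} {A : Set} → b ≡ true → b ≡ false → A
true≢false refl ()

∧-intro : ∀ {a b} → a ≡ true → b ≡ true → a ∧ b ≡ true
∧-intro refl refl = refl

∧-elimˡ : ∀ {a b} → a ∧ b ≡ true → a ≡ true
∧-elimˡ {true} p = refl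

∧-elimʳ : ∀ {a b} → a ∧ b ≡ true → b ≡ true
∧-elimʳ {true} p = p

∨-elim : ∀ {a b} → a ∨ b ≡ true → (a ≡ true) ⊎ (b ≡ true)
∨-elim {true} p = inj₁ refl
∨-elim {false} p = inj₂ p

∨-introˡ : ∀ {a b} → a ≡ true → a ∨ b ≡ true
∨-introˡ refl = refl

∨-introʳ : ∀ {a b} → b ≡ true → a ∨ b ≡ true
∨-introʳ {true} refl = refl
∨-introʳ {false} refl = refl

not-true : ∀ {b} → not b ≡ true → b ≡ false
not-true {false} p = refl

allB? : {P : Bool → Set} → (∀ b → Dec (P b)) → Dec (∀ b → P b)
allB? P? = map′ (λ { (t , f) true → t ; (t , f) false → f }) (λ h → h true , h false)
  (P? true ×-dec P? false)

-- Finite sums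

sumF-suc : ∀ {n} (f : Fin (suc n) → ℕ) → sumF f ≡ f zero + sumF (f ∘ suc)
sumF-suc {n} f = cong (λ l → f zero + sum l)
  (trans (map-tabulate suc f) (sym (map-tabulate id (f ∘ suc))))

sumF-cong : ∀ {n} {f g : Fin n → ℕ} → (∀ v → f v ≡ g v) → sumF f ≡ sumF g
sumF-cong {zero} h = refl
sumF-cong {suc n} {f} {g} h = trans (sumF-suc f)
  (trans (cong₂ _+_ (h zero) (sumF-cong (h ∘ suc))) (sym (sumF-suc g)))

sumF-mono : ∀ {n} {f g : Fin n → ℕ} → (∀ v → f v ≤ g v) → sumF f ≤ sumF g
sumF-mono {zero} h = z≤n
sumF-mono {suc n} {f} {g} h = subst₂ _≤_ (sym (sumF-suc f)) (sym (sumF-suc g))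
  (+-mono-≤ (h zero) (sumF-mono (h ∘ suc)))

+-interchange : ∀ a b c d → (a + b) + (c + d) ≡ (a + c) + (b + d)
+-interchange = solve-∀

sumF-+ : ∀ {n} (f g : Fin n → ℕ) → sumF (λ v → f v + g v) ≡ sumF f + sumF g
sumF-+ {zero} f g = refl
sumF-+ {suc n} f g = begin
  sumF (λ v → f v + g v)                                   ≡⟨ sumF-suc (λ v → f v + g v) ⟩
  (f zero + g zero) + sumF (λ v → f (suc v) + g (suc v))   ≡⟨ cong (f zero + g zero +_) (sumF-+ (f ∘ suc) (g ∘ suc)) ⟩
  (f zero + g zero) + (sumF (f ∘ suc) + sumF (g ∘ suc))    ≡⟨ +-interchange (f zero) (g zero) _ _ ⟩
  (f zero + sumF (f ∘ suc)) + (g zero + sumF (g ∘ suc))    ≡⟨ cong₂ _+_ (sumF-suc f) (sumF-suc g) ⟨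
  sumF f + sumF g ∎
  where open ≡-Reasoning

sumF-0 : ∀ n → sumF {n} (λ _ → 0) ≡ 0
sumF-0 zero = refl
sumF-0 (suc n) = trans (sumF-suc {n} (λ _ → 0)) (sumF-0 n)

sumF-zero : ∀ {n} {f : Fin n → ℕ} → (∀ v → f v ≡ 0) → sumF f ≡ 0
sumF-zero {n} h = trans (sumF-cong h) (sumF-0 n)

sumF-* : ∀ {n} c (f : Fin n → ℕ) → sumF (λ v → c * f v) ≡ c * sumF f
sumF-* {zero} c f = sym (*-zeroʳ c)
sumF-* {suc n} c f = begin
  sumF (λ v → c * f v)                           ≡⟨ sumF-suc (λ v → c * f v) ⟩
  c * f zero + sumF (λ v → c * f (suc v))        ≡⟨ cong (c * f zero +_) (sumF-* c (f ∘ suc)) ⟩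
  c * f zero + c * sumF (f ∘ suc)                ≡⟨ *-distribˡ-+ c (f zero) _ ⟨
  c * (f zero + sumF (f ∘ suc))                  ≡⟨ cong (c *_) (sumF-suc f) ⟨
  c * sumF f ∎
  where open ≡-Reasoning

sumF-swap : ∀ {m n} (f : Fin m → Fin n → ℕ) →
  sumF (λ u → sumF (f u)) ≡ sumF (λ v → sumF (λ u → f u v))
sumF-swap {zero} {n} f = sym (sumF-0 n)
sumF-swap {suc m} {n} f = begin
  sumF (λ u → sumF (f u))                                   ≡⟨ sumF-suc (λ u → sumF (f u)) ⟩
  sumF (f zero) + sumF (λ u → sumF (f (suc u)))             ≡⟨ cong (sumF (f zero) +_) (sumF-swap (f ∘ suc)) ⟩
  sumF (f zero) + sumF (λ v → sumF (λ u → f (suc u) v))     ≡⟨ sumF-+ (f zero) _ ⟨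
  sumF (λ v → f zero v + sumF (λ u → f (suc u) v))          ≡⟨ sumF-cong (λ v → sumF-suc (λ u → f u v)) ⟨
  sumF (λ v → sumF (λ u → f u v)) ∎
  where open ≡-Reasoning

sumF-split : ∀ {n} (f : Fin n → ℕ) a → sumF f ≡ f a + sumF (λ v → if v == a then 0 else f v)
sumF-split {suc n} f zero = begin
  sumF f                         ≡⟨ sumF-suc f ⟩
  f zero + sumF (f ∘ suc)        ≡⟨ cong (f zero +_) (sumF-suc (λ v → if v == zero then 0 else f v)) ⟨
  f zero + sumF (λ v → if v == zero then 0 else f v) ∎
  where open ≡-Reasoning
sumF-split {suc n} f (suc a) = begin
  sumF f                                                  ≡⟨ sumF-suc f ⟩
  f zero + sumF (f ∘ suc)                                 ≡⟨ cong (f zero +_) (sumF-split (f ∘ suc) a) ⟩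
  f zero + (f (suc a) + rest)                             ≡⟨ +-comm-middle (f zero) (f (suc a)) rest ⟩
  f (suc a) + (f zero + rest)                             ≡⟨ cong (f (suc a) +_) (sumF-suc (λ v → if v == suc a then 0 else f v)) ⟨
  f (suc a) + sumF (λ v → if v == suc a then 0 else f v) ∎
  where
  open ≡-Reasoning
  rest = sumF (λ v → if v == a then 0 else f (suc v))
  +-comm-middle : ∀ a b c → a + (b + c) ≡ b + (a + c)
  +-comm-middle = solve-∀

term≤sumF : ∀ {n} (f : Fin n → ℕ) a → f a ≤ sumF f
term≤sumF f a = subst (f a ≤_) (sym (sumF-split f a)) (m≤m+n (f a) _)

two-terms≤sumF : ∀ {n} (f : Fin n → ℕ) {a b} → a ≢ b → f a + f b ≤ sumF f
two-terms≤sumF f {a} {b} a≢b = subst (f a + f b ≤_) (sym (sumF-split f a))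
  (+-monoʳ-≤ (f a) (≤-trans (≤-reflexive (sym eq)) (term≤sumF g b)))
  where
  g = λ v → if v == a then 0 else f v
  eq : g b ≡ f b
  eq rewrite ==-≢ (a≢b ∘ sym) = refl

three-terms≤sumF : ∀ {n} (f : Fin n → ℕ) {a b c} → a ≢ b → a ≢ c → b ≢ c → f a + (f b + f c) ≤ sumF f
three-terms≤sumF f {a} {b} {c} a≢b a≢c b≢c = subst (_ ≤_) (sym (sumF-split f a))
  (+-monoʳ-≤ (f a) (≤-trans (≤-reflexive (sym (cong₂ _+_ (eq a≢b) (eq a≢c)))) (two-terms≤sumF g b≢c)))
  where
  g = λ v → if v == a then 0 else f v
  eq : ∀ {d} → a ≢ d → g d ≡ f d
  eq a≢d rewrite ==-≢ (a≢d ∘ sym) = refl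

sumF-single : ∀ {n} (f : Fin n → ℕ) a → (∀ v → v ≢ a → f v ≡ 0) → sumF f ≡ f a
sumF-single f a h = trans (sumF-split f a) (trans (cong (f a +_) (sumF-zero eq)) (+-identityʳ _))
  where
  eq : ∀ v → (if v == a then 0 else f v) ≡ 0
  eq v with v ≟F a
  ... | yes _ = refl
  ... | no v≢a = h v v≢a

sumF-bump : ∀ {n} (f g : Fin n → ℕ) a c → (∀ v → v ≢ a → f v ≤ g v) → f a ≤ g a + c → sumF f ≤ sumF g + c
sumF-bump f g a c h ha = begin
  sumF f                                                        ≤⟨ sumF-mono pointwise ⟩
  sumF (λ v → g v + ((v == a) ▸ c))                             ≡⟨ sumF-+ g _ ⟩
  sumF g + sumF (λ v → (v == a) ▸ c)                            ≡⟨ cong (sumF g +_) (sumF-single _ a (λ v v≢a → cong (_▸ c) (==-≢ v≢a))) ⟩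
  sumF g + ((a == a) ▸ c)                                       ≡⟨ cong (λ b → sumF g + (b ▸ c)) (==-refl a) ⟩
  sumF g + c ∎
  where
  open ≤-Reasoning
  pointwise : ∀ v → f v ≤ g v + ((v == a) ▸ c)
  pointwise v with v ≟F a
  ... | yes refl = ha
  ... | no v≢a = ≤-trans (h v v≢a) (m≤m+n _ _)

-- Vertex sets

VSet : ℕ → Set
VSet n = Fin n → Bool

Edges : ℕ → Set
Edges n = Fin n → Fin n → Bool

module _ {n : ℕ} where

  infix 4 _⊆_ _≐_
  _⊆_ _≐_ : VSet n → VSet n → Set
  X ⊆ Y = ∀ v → X v ≡ true → Y v ≡ true
  X ≐ Y = ∀ v → X v ≡ Y v

  Disjoint : VSet n → VSet n → Set
  Disjoint X Y = ∀ v → X v ≡ true → Y v ≡ false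

  infixl 6 _∪_ _∩_ _∖_
  _∪_ _∩_ _∖_ : VSet n → VSet n → VSet n
  (X ∪ Y) v = X v ∨ Y v
  (X ∩ Y) v = X v ∧ Y v
  (X ∖ Y) v = X v ∧ not (Y v)

  ｛_｝ : Fin n → VSet n
  ｛ z ｝ v = v == z

  wsum : (Fin n → ℕ) → VSet n → ℕ
  wsum f Y = sumF (λ v → Y v ▸ f v)

  size : VSet n → ℕ
  size = wsum (λ _ → 1)

  edges : Edges n → VSet n → ℕ
  edges E Y = sumF (λ u → count (λ v → (Y u ∧ Y v) ∧ (E u v ∧ (toℕ u <ᵇ toℕ v))))

  deg : Edges n → VSet n → Fin n → ℕ
  deg E Y u = count (λ v → Y v ∧ E u v)

  record IsGraph (E : Edges n) : Set where
    field
      Esym : ∀ u v → E u v ≡ E v u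
      Eirr : ∀ u → E u u ≡ false
  open IsGraph public

  E⇒≢ : ∀ {E} → IsGraph E → ∀ {u v} → E u v ≡ true → u ≢ v
  E⇒≢ g p refl = true≢false p (Eirr g _)

  wsum-≐ : ∀ f {X Y} → X ≐ Y → wsum f X ≡ wsum f Y
  wsum-≐ f h = sumF-cong (λ v → cong (_▸ f v) (h v))

  edges-≐ : ∀ E {X Y} → X ≐ Y → edges E X ≡ edges E Y
  edges-≐ E h = sumF-cong λ u → sumF-cong λ v → cong₂ (λ a b → (a ∧ b) ∧ (E u v ∧ (toℕ u <ᵇ toℕ v)) ▸ 1) (h u) (h v)

  wsum-modular : ∀ f X Y → wsum f X + wsum f Y ≡ wsum f (X ∪ Y) + wsum f (X ∩ Y)
  wsum-modular f X Y = trans (sym (sumF-+ (λ v → X v ▸ f v) (λ v → Y v ▸ f v)))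
    (trans (sumF-cong (λ v → pw (X v) (Y v) (f v)))
      (sumF-+ (λ v → X v ∨ Y v ▸ f v) (λ v → X v ∧ Y v ▸ f v)))
    where
    pw : ∀ x y a → (x ▸ a) + (y ▸ a) ≡ (x ∨ y ▸ a) + (x ∧ y ▸ a)
    pw true true a = refl
    pw true false a = refl
    pw false true a = +-comm 0 a
    pw false false a = refl

  wsum-∪ : ∀ f {X Y} → Disjoint X Y → wsum f (X ∪ Y) ≡ wsum f X + wsum f Y
  wsum-∪ f {X} {Y} d = trans (sumF-cong (λ v → pw (X v) (Y v) (f v) (d v)))
    (sumF-+ (λ v → X v ▸ f v) (λ v → Y v ▸ f v))
    where
    pw : ∀ x y a → (x ≡ true → y ≡ false) → (x ∨ y ▸ a) ≡ (x ▸ a) + (y ▸ a)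
    pw true true a d = true≢false refl (d refl)
    pw true false a d = +-comm 0 a
    pw false y a d = refl

  wsum-mono : ∀ {f g} Y → (∀ v → Y v ≡ true → f v ≤ g v) → wsum f Y ≤ wsum g Y
  wsum-mono {f} {g} Y h = sumF-mono λ v → pw (Y v) (h v)
    where
    pw : ∀ y {a b} → (y ≡ true → a ≤ b) → (y ▸ a) ≤ (y ▸ b)
    pw true h = h refl
    pw false h = z≤n

  wsum-+ : ∀ f g Y → wsum (λ v → f v + g v) Y ≡ wsum f Y + wsum g Y
  wsum-+ f g Y = trans (sumF-cong (λ v → pw (Y v) (f v) (g v)))
    (sumF-+ (λ v → Y v ▸ f v) (λ v → Y v ▸ g v))
    where
    pw : ∀ y a b → (y ▸ (a + b)) ≡ (y ▸ a) + (y ▸ b)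
    pw true a b = refl
    pw false a b = refl

  wsum-* : ∀ c f Y → wsum (λ v → c * f v) Y ≡ c * wsum f Y
  wsum-* c f Y = trans (sumF-cong (λ v → pw (Y v) (f v))) (sumF-* c (λ v → Y v ▸ f v))
    where
    pw : ∀ y a → (y ▸ (c * a)) ≡ c * (y ▸ a)
    pw true a = refl
    pw false a = sym (*-zeroʳ c)

  wsum-const : ∀ c Y → wsum (λ _ → c) Y ≡ c * size Y
  wsum-const c Y = trans (sumF-cong λ v → cong (Y v ▸_) (sym (*-identityʳ c))) (wsum-* c (λ _ → 1) Y)

  wsum-｛｝ : ∀ f z → wsum f ｛ z ｝ ≡ f z
  wsum-｛｝ f z = trans (sumF-single (λ v → (v == z) ▸ f v) z (λ v v≢z → cong (_▸ f v) (==-≢ v≢z))) (cong (_▸ f z) (==-refl z))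

  wsum-point : ∀ (x : Fin n) Y → wsum (λ v → (v == x) ▸ 1) Y ≡ (Y x ▸ 1)
  wsum-point x Y = trans (sumF-cong λ v → swap (Y v) (v == x)) (wsum-｛｝ (λ v → Y v ▸ 1) x)
    where
    swap : ∀ a b → (a ▸ (b ▸ 1)) ≡ (b ▸ (a ▸ 1))
    swap true true = refl
    swap true false = refl
    swap false true = refl
    swap false false = refl

  size-mono : ∀ {X Y} → X ⊆ Y → size X ≤ size Y
  size-mono {X} {Y} h = sumF-mono λ v → pw (X v) (Y v) (h v)
    where
    pw : ∀ x y → (x ≡ true → y ≡ true) → (x ▸ 1) ≤ (y ▸ 1)
    pw true true h = ≤-refl
    pw true false h = true≢false (h refl) refl
    pw false y h = z≤n

  size-strict : ∀ {X Y} a → X ⊆ Y → X a ≡ false → Y a ≡ true → suc (size X) ≤ size Y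
  size-strict {X} {Y} a h xa ya = begin
    suc (size X)            ≡⟨ +-comm 1 (size X) ⟩
    size X + 1              ≡⟨ cong (size X +_) (wsum-｛｝ (λ _ → 1) a) ⟨
    size X + size ｛ a ｝    ≡⟨ wsum-∪ (λ _ → 1) (λ v xv → ==-≢ {u = v} {a} λ { refl → true≢false xv xa }) ⟨
    size (X ∪ ｛ a ｝)       ≤⟨ size-mono sub ⟩
    size Y ∎
    where
    open ≤-Reasoning
    sub : X ∪ ｛ a ｝ ⊆ Y
    sub v p with ∨-elim {X v} p
    ... | inj₁ q = h v q
    ... | inj₂ q rewrite ==-≡ v a q = ya

  sumF²-+ : (f g : Fin n → Fin n → ℕ) →
    sumF (λ u → sumF (λ v → f u v + g u v)) ≡ sumF (λ u → sumF (f u)) + sumF (λ u → sumF (g u))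
  sumF²-+ f g = trans (sumF-cong λ u → sumF-+ (f u) (g u)) (sumF-+ (λ u → sumF (f u)) (λ u → sumF (g u)))

  -- The comparison holds pair by pair; only edges between the two differences are gained. Together
  -- with `wsum-modular` it makes slack submodular.
  edges-supermodular : ∀ E X Y → edges E X + edges E Y ≤ edges E (X ∪ Y) + edges E (X ∩ Y)
  edges-supermodular E X Y = subst₂ _≤_ (sumF²-+ (both X) (both Y)) (sumF²-+ (both (X ∪ Y)) (both (X ∩ Y)))
    (sumF-mono λ u → sumF-mono λ v → pw (X u) (X v) (Y u) (Y v) (E u v ∧ (toℕ u <ᵇ toℕ v)))
    where
    both : VSet n → Fin n → Fin n → ℕ
    both Z u v = ((Z u ∧ Z v) ∧ (E u v ∧ (toℕ u <ᵇ toℕ v))) ▸ 1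
    pw : ∀ xu xv yu yv c → (((xu ∧ xv) ∧ c) ▸ 1) + (((yu ∧ yv) ∧ c) ▸ 1)
      ≤ ((((xu ∨ yu) ∧ (xv ∨ yv)) ∧ c) ▸ 1) + ((((xu ∧ yu) ∧ (xv ∧ yv)) ∧ c) ▸ 1)
    pw = toWitness {a? = allB? λ xu → allB? λ xv → allB? λ yu → allB? λ yv → allB? λ c → _ ≤? _} tt

  ordered : Edges n → VSet n → VSet n → ℕ
  ordered E A B = sumF (λ u → count (λ v → (A u ∧ B v) ∧ (E u v ∧ (toℕ u <ᵇ toℕ v))))

  -- `edges` counts an edge from its end of smaller index. Adding the two directions removes this
  -- orientation; `A = B` is the handshake identity.
  ordered-both : ∀ {E} → IsGraph E → ∀ A B → ordered E A B + ordered E B A ≡ wsum (deg E B) A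
  ordered-both {E} g A B = begin
    ordered E A B + ordered E B A                               ≡⟨ cong (ordered E A B +_) (sumF-swap ba) ⟩
    ordered E A B + sumF (λ u → sumF (λ v → ba v u))            ≡⟨ sumF²-+ ab (λ u v → ba v u) ⟨
    sumF (λ u → sumF (λ v → ab u v + ba v u))                   ≡⟨ sumF-cong (λ u → trans (sumF-cong (cross u)) (row (A u) u)) ⟩
    wsum (deg E B) A ∎
    where
    open ≡-Reasoning
    ab ba : Fin n → Fin n → ℕ
    ab u v = ((A u ∧ B v) ∧ (E u v ∧ (toℕ u <ᵇ toℕ v))) ▸ 1
    ba u v = ((B u ∧ A v) ∧ (E u v ∧ (toℕ u <ᵇ toℕ v))) ▸ 1
    <ᵇ-asym : ∀ a b → a ≢ b → ((a <ᵇ b) ▸ 1) + ((b <ᵇ a) ▸ 1) ≡ 1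
    <ᵇ-asym zero zero h = ⊥-elim (h refl)
    <ᵇ-asym zero (suc b) h = refl
    <ᵇ-asym (suc a) zero h = refl
    <ᵇ-asym (suc a) (suc b) h = <ᵇ-asym a b (h ∘ cong suc)
    cross : ∀ u v → ab u v + ba v u ≡ (A u ∧ (B v ∧ E u v)) ▸ 1
    cross u v rewrite Esym g v u with A u | B v | E u v in eq
    ... | true | true | true = <ᵇ-asym (toℕ u) (toℕ v) (E⇒≢ g eq ∘ toℕ-injective)
    ... | true | true | false = refl
    ... | true | false | true = refl
    ... | true | false | false = refl
    ... | false | true | true = refl
    ... | false | true | false = refl
    ... | false | false | true = refl
    ... | false | false | false = refl
    row : ∀ y u → sumF (λ v → (y ∧ (B v ∧ E u v)) ▸ 1) ≡ y ▸ deg E B u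
    row true u = refl
    row false u = sumF-0 n

  edges-∪ : ∀ {E} → IsGraph E → ∀ {Y T} → Disjoint Y T →
    edges E (Y ∪ T) ≡ (edges E Y + edges E T) + wsum (deg E T) Y
  edges-∪ {E} g {Y} {T} d = begin
    edges E (Y ∪ T)
      ≡⟨ sumF-cong (λ u → sumF-cong λ v → pw (Y u) (Y v) (T u) (T v) (E u v ∧ (toℕ u <ᵇ toℕ v)) (d u) (d v)) ⟩
    sumF (λ u → sumF (λ v → (part Y Y u v + part T T u v) + (part Y T u v + part T Y u v)))
      ≡⟨ sumF²-+ (λ u v → part Y Y u v + part T T u v) (λ u v → part Y T u v + part T Y u v) ⟩
    sumF (λ u → sumF (λ v → part Y Y u v + part T T u v)) + sumF (λ u → sumF (λ v → part Y T u v + part T Y u v))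
      ≡⟨ cong₂ _+_ (sumF²-+ (part Y Y) (part T T)) (sumF²-+ (part Y T) (part T Y)) ⟩
    (edges E Y + edges E T) + (ordered E Y T + ordered E T Y)
      ≡⟨ cong ((edges E Y + edges E T) +_) (ordered-both g Y T) ⟩
    (edges E Y + edges E T) + wsum (deg E T) Y ∎
    where
    open ≡-Reasoning
    part : VSet n → VSet n → Fin n → Fin n → ℕ
    part A B u v = ((A u ∧ B v) ∧ (E u v ∧ (toℕ u <ᵇ toℕ v))) ▸ 1
    pw : ∀ yu yv tu tv c → (yu ≡ true → tu ≡ false) → (yv ≡ true → tv ≡ false) →
      (((yu ∨ tu) ∧ (yv ∨ tv)) ∧ c ▸ 1)
      ≡ (((yu ∧ yv) ∧ c ▸ 1) + ((tu ∧ tv) ∧ c ▸ 1)) + (((yu ∧ tv) ∧ c ▸ 1) + ((tu ∧ yv) ∧ c ▸ 1))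
    pw true yv true tv c d₁ d₂ = true≢false refl (d₁ refl)
    pw true true false true c d₁ d₂ = true≢false refl (d₂ refl)
    pw false true tu true c d₁ d₂ = true≢false refl (d₂ refl)
    pw true true false false false d₁ d₂ = refl
    pw true true false false true d₁ d₂ = refl
    pw true false false tv c d₁ d₂ = sym (+-identityʳ _)
    pw false true false false c d₁ d₂ = refl
    pw false true true false c d₁ d₂ = refl
    pw false false true true c d₁ d₂ = sym (+-identityʳ _)
    pw false false true false c d₁ d₂ = refl
    pw false false false tv c d₁ d₂ = refl

  handshake : ∀ {E} → IsGraph E → ∀ Y → edges E Y + edges E Y ≡ wsum (deg E Y) Y
  handshake g Y = ordered-both g Y Y

  edges-｛｝ : ∀ {E} → IsGraph E → ∀ z → edges E ｛ z ｝ ≡ 0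
  edges-｛｝ {E} g z = sumF-zero λ u → sumF-zero λ v → pw u v
    where
    pw : ∀ u v → (((u == z) ∧ (v == z)) ∧ (E u v ∧ (toℕ u <ᵇ toℕ v))) ▸ 1 ≡ 0
    pw u v with u ≟F z | v ≟F z
    ... | yes refl | yes refl rewrite Eirr g u = refl
    ... | yes _ | no _ = refl
    ... | no _ | _ = refl

  remove : Edges n → Fin n → Fin n → Edges n
  remove E a b u v = E u v ∧ not (((u == a) ∧ (v == b)) ∨ ((u == b) ∧ (v == a)))

  remove-isGraph : ∀ {E} → IsGraph E → ∀ a b → IsGraph (remove E a b)
  remove-isGraph g a b .Esym u v = cong₂ _∧_ (Esym g u v) (cong not (pw (u == a) (v == b) (u == b) (v == a)))
    where
    pw : ∀ p q r s → (p ∧ q) ∨ (r ∧ s) ≡ (s ∧ r) ∨ (q ∧ p)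
    pw = toWitness {a? = allB? λ p → allB? λ q → allB? λ r → allB? λ s → _ ≟B _} tt
  remove-isGraph g a b .Eirr u rewrite Eirr g u = refl

  private
    edges-remove-< : ∀ F {a b} → F a b ≡ true → toℕ a < toℕ b → ∀ Y →
      edges (remove F a b) Y + (Y a ∧ Y b ▸ 1) ≤ edges F Y
    edges-remove-< F {a} {b} ab q Y = begin
      edges (remove F a b) Y + (Y a ∧ Y b ▸ 1)
        ≡⟨ cong (edges (remove F a b) Y +_) (sym (trans (sumF-single _ a offrow) (trans (sumF-single _ b offcol) diag))) ⟩
      edges (remove F a b) Y + sumF (λ u → sumF (λ v → δ u v))
        ≡⟨ sumF²-+ _ δ ⟨
      sumF (λ u → sumF (λ v → (((Y u ∧ Y v) ∧ (remove F a b u v ∧ (toℕ u <ᵇ toℕ v))) ▸ 1) + δ u v))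
        ≤⟨ sumF-mono (λ u → sumF-mono (pw u)) ⟩
      edges F Y ∎
      where
      open ≤-Reasoning
      δ : Fin n → Fin n → ℕ
      δ u v = ((u == a) ∧ (v == b)) ∧ (Y u ∧ Y v) ▸ 1
      offrow : ∀ u → u ≢ a → sumF (δ u) ≡ 0
      offrow u h rewrite ==-≢ h = sumF-0 n
      offcol : ∀ v → v ≢ b → δ a v ≡ 0
      offcol v h rewrite ==-≢ h | ∧-zeroʳ (a == a) = refl
      diag : δ a b ≡ (Y a ∧ Y b ▸ 1)
      diag rewrite ==-refl a | ==-refl b = refl
      lt⇒ : ∀ {x y} → x < y → (x <ᵇ y) ≡ true
      lt⇒ {zero} (s≤s _) = refl
      lt⇒ {suc x} {suc (suc y)} (s≤s p) = lt⇒ p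
      mono : ∀ x y f r l → (((x ∧ y) ∧ ((f ∧ not r) ∧ l)) ▸ 1) + 0 ≤ ((x ∧ y) ∧ (f ∧ l)) ▸ 1
      mono = toWitness {a? = allB? λ x → allB? λ y → allB? λ f → allB? λ r → allB? λ l → _ ≤? _} tt
      pw : ∀ u v → (((Y u ∧ Y v) ∧ (remove F a b u v ∧ (toℕ u <ᵇ toℕ v))) ▸ 1) + δ u v
        ≤ ((Y u ∧ Y v) ∧ (F u v ∧ (toℕ u <ᵇ toℕ v))) ▸ 1
      pw u v with u ≟F a | v ≟F b
      ... | yes refl | yes refl rewrite ab | lt⇒ q with Y u | Y v
      ...   | true | true = ≤-refl
      ...   | true | false = ≤-refl
      ...   | false | _ = ≤-refl
      pw u v | yes refl | no _ = mono (Y u) (Y v) (F u v) _ _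
      pw u v | no _ | _ = mono (Y u) (Y v) (F u v) _ _

  edges-remove : ∀ {E} → IsGraph E → ∀ {a b} → E a b ≡ true → ∀ Y →
    edges (remove E a b) Y + (Y a ∧ Y b ▸ 1) ≤ edges E Y
  edges-remove {E} g {a} {b} ab Y with <-cmp (toℕ a) (toℕ b)
  ... | tri≈ _ q _ = ⊥-elim (E⇒≢ g ab (toℕ-injective q))
  ... | tri< q _ _ = edges-remove-< E ab q Y
  ... | tri> _ _ q = subst₂ (λ s y → s + (y ▸ 1) ≤ edges E Y) swapped (∧-comm (Y b) (Y a))
    (edges-remove-< E (trans (Esym g b a) ab) q Y)
    where
    swapped : edges (remove E b a) Y ≡ edges (remove E a b) Y
    swapped = sumF-cong λ u → sumF-cong λ v →
      cong (λ r → (Y u ∧ Y v) ∧ ((E u v ∧ not r) ∧ (toℕ u <ᵇ toℕ v)) ▸ 1) (∨-comm ((u == b) ∧ (v == a)) _)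

¬true⇒false : ∀ {b} → (b ≡ true → ⊥) → b ≡ false
¬true⇒false = ¬-not

¬false⇒true : ∀ {b} → (b ≡ false → ⊥) → b ≡ true
¬false⇒true = ¬-not

count-mono : ∀ {n} {p q : Fin n → Bool} → (∀ u → p u ≡ true → q u ≡ true) → count p ≤ count q
count-mono = size-mono

count-pos : ∀ {n} {p : Fin n → Bool} u → p u ≡ true → 0 < count p
count-pos {p = p} u pu = ≤-trans (≤-reflexive (cong (_▸ 1) (sym pu))) (term≤sumF (λ v → p v ▸ 1) u)

count≡0 : ∀ {n} {p : Fin n → Bool} → count p ≡ 0 → ∀ u → p u ≡ false
count≡0 {p = p} c u with p u in eq
... | false = refl
... | true = ⊥-elim (<⇒≢ (count-pos u eq) (sym c))

count-none : ∀ {n} {p : Fin n → Bool} → (∀ u → p u ≡ false) → count p ≡ 0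
count-none h = sumF-zero λ u → cong (_▸ 1) (h u)

full : ∀ {n} → VSet n
full _ = true

-- The slack s turns a linear inequality into a semiring identity for the solver.
≤-cert : ∀ {p q} x y s → p ≤ q → x + q + s ≡ y + p → x ≤ y
≤-cert {p} {q} x y s p≤q eq = +-cancelʳ-≤ q x y (begin
  x + q       ≤⟨ m≤m+n (x + q) s ⟩
  x + q + s   ≡⟨ eq ⟩
  y + p       ≤⟨ +-monoʳ-≤ y p≤q ⟩
  y + q ∎)
  where open ≤-Reasoning

≰-cert : ∀ {p q} s → p ≤ q → p ≡ q + suc s → ⊥
≰-cert {p} {q} s p≤q eq = <-irrefl refl (≤-trans (≤-reflexive (sym (+-suc q 0)))
  (≤-trans (+-monoʳ-≤ q (s≤s z≤n)) (≤-trans (≤-reflexive (sym eq)) (≤-trans p≤q (≤-reflexive (sym (+-identityʳ q)))))))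

-- Vertex sets are functions, and the existence of a set with given slack is not decided. Such case
-- splits are made on the way to a contradiction, and the colouring is recovered because
-- colourability itself is decidable.
¬¬-em : {A : Set} → (A ⊎ ¬ A → ⊥) → ⊥
¬¬-em f = f (inj₂ (f ∘ inj₁))

pair-sum : ∀ {n} (a b : Fin n) Y → wsum (λ v → (v == a) ∨ (v == b) ▸ 1) Y ≤ (Y a ▸ 1) + (Y b ▸ 1)
pair-sum {n} a b Y = begin
  wsum (λ v → (v == a) ∨ (v == b) ▸ 1) Y
    ≤⟨ sumF-mono pw ⟩
  sumF (λ v → ((v == a) ▸ (Y v ▸ 1)) + ((v == b) ▸ (Y v ▸ 1)))
    ≡⟨ sumF-+ (λ v → (v == a) ▸ (Y v ▸ 1)) (λ v → (v == b) ▸ (Y v ▸ 1)) ⟩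
  wsum (λ v → Y v ▸ 1) ｛ a ｝ + wsum (λ v → Y v ▸ 1) ｛ b ｝
    ≡⟨ cong₂ _+_ (wsum-｛｝ _ a) (wsum-｛｝ _ b) ⟩
  (Y a ▸ 1) + (Y b ▸ 1) ∎
  where
  open ≤-Reasoning
  pw′ : ∀ y p q → (y ▸ (p ∨ q ▸ 1)) ≤ (p ▸ (y ▸ 1)) + (q ▸ (y ▸ 1))
  pw′ = toWitness {a? = allB? λ y → allB? λ p → allB? λ q → _ ≤? _} tt
  pw : ∀ v → (Y v ▸ ((v == a) ∨ (v == b) ▸ 1)) ≤ ((v == a) ▸ (Y v ▸ 1)) + ((v == b) ▸ (Y v ▸ 1))
  pw v = pw′ (Y v) (v == a) (v == b)

-- Cutting and lowering budgets

-- One conflict already closes the budget, so that no conflict at all will cross from the coloured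
-- set. As budgets are at most k, a charge of k per conflict covers the loss.
gate : ℕ → ℕ → ℕ
gate zero p = p
gate (suc _) p = 0

gate-≤ : ∀ h p → gate h p ≤ p
gate-≤ zero p = ≤-refl
gate-≤ (suc h) p = z≤n

gate-cost : ∀ {k} h p → p ≤ k → p ≤ gate h p + k * h
gate-cost zero p p≤k = m≤m+n p _
gate-cost {k} (suc h) p p≤k = ≤-trans p≤k (≤-trans (m≤m+n k (k * h)) (≤-reflexive (sym (*-suc k h))))

gate-pos : ∀ h p → 0 < gate h p → h ≡ 0
gate-pos zero p _ = refl

-- The rich tolerance includes the poor budget, so one unit of the latter pays for a conflict in either
-- colour. A zero budget d forbids the rich colour.
richTol : ℕ → ℕ → ℕ
richTol p zero = 0
richTol p (suc d) = p + suc d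

richTol-mono : ∀ {p p′ d d′} → p ≤ p′ → d ≤ d′ → richTol p d ≤ richTol p′ d′
richTol-mono {d = zero} a b = z≤n
richTol-mono {d = suc d} {suc d′} a b = +-mono-≤ a b

richTol-pos : ∀ p d → 0 < richTol p d → 0 < d
richTol-pos p (suc d) _ = s≤s z≤n

-- With `pred` on the poor budget, this takes one unit from `p + d`: from p if possible, otherwise
-- from d. Either way each colour still permitted has room for one more conflict in the original
-- tolerances, since at `p = 0` the poor colour was forbidden anyway.
lowRich : ℕ → ℕ → ℕ
lowRich zero d = pred d
lowRich (suc p) d = d

lower-cost : ∀ p d → p + d ≤ (pred p + lowRich p d) + 1
lower-cost zero zero = z≤n
lower-cost zero (suc d) = ≤-reflexive (+-comm 1 d)
lower-cost (suc p) d = ≤-reflexive (+-comm 1 (p + d))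

lower-rich : ∀ p d {h} → h < richTol (pred p) (lowRich p d) → suc h < richTol p d
lower-rich zero (suc (suc d)) q = s≤s q
lower-rich (suc p) (suc d) q = s≤s q

lower-poor : ∀ p {h} → h < pred p → suc h < p
lower-poor (suc p) q = s≤s q

lowRich-≤ : ∀ p d → lowRich p d ≤ d
lowRich-≤ zero d = pred[n]≤n
lowRich-≤ (suc p) d = ≤-refl

-- Colourings with tolerances

module Colouring {n : ℕ} (K : Fin n → Bool → Fin n → Bool → Bool)
  (Ksym : ∀ u a v b → K u a v b ≡ K v b u a)
  (Kmatch : ∀ u a v b b′ → K u a v b ≡ true → K u a v b′ ≡ true → b ≡ b′) where

  Tol : Set
  Tol = Fin n → Bool → ℕ

  hit : Edges n → VSet n → (Fin n → Bool) → Fin n → Bool → ℕ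
  hit E V φ v c = count (λ u → (V u ∧ E u v) ∧ K u (φ u) v c)

  -- The inequality is strict, so tolerance zero forbids a colour. Committing a vertex to one colour
  -- is therefore only a change of tolerances.
  Col : Edges n → VSet n → Tol → (Fin n → Bool) → Set
  Col E V tol φ = ∀ v → V v ≡ true → hit E V φ v (φ v) < tol v (φ v)

  Colourable : Edges n → VSet n → Tol → Set
  Colourable E V tol = ∃ (Col E V tol)

  Col-weaken : ∀ {E V tol tol′ φ} → (∀ v c → V v ≡ true → tol v c ≤ tol′ v c) → Col E V tol φ → Col E V tol′ φ
  Col-weaken h col v Vv = ≤-trans (col v Vv) (h v _ Vv)

  hit-cong : ∀ {E V φ ψ} v {c c′} → (∀ u → φ u ≡ ψ u) → c ≡ c′ → hit E V φ v c ≡ hit E V ψ v c′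
  hit-cong {E} {V} v {c} h refl = sumF-cong λ u → cong (λ a → ((V u ∧ E u v) ∧ K u a v c) ▸ 1) (h u)

  Col-cong : ∀ {E V tol φ ψ} → (∀ u → φ u ≡ ψ u) → Col E V tol φ → Col E V tol ψ
  Col-cong {E} {V} {tol} h col v Vv = subst₂ _<_ (hit-cong {E} {V} v h (h v)) (cong (tol v) (h v)) (col v Vv)

  colourable? : ∀ E V tol → Dec (Colourable E V tol)
  colourable? E V tol = map′ (λ { (S , col) → lookup S , col })
    (λ { (φ , col) → tabulate φ , Col-cong {tol = tol} (λ u → sym (lookup∘tabulate φ u)) col })
    (anySubset? λ S → all? λ v → (V v ≟B true) →-dec (hit E V (lookup S) v (lookup S v) <? tol v (lookup S v)))

  colourable-stable : ∀ {E V tol} → ¬ ¬ Colourable E V tol → Colourable E V tol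
  colourable-stable {E} {V} {tol} = decidable-stable (colourable? E V tol)

  glueTol : VSet n → Tol → Tol → Tol
  glueTol X tol₁ tol₂ v c = if X v then tol₁ v c else tol₂ v c

  glue : ∀ {E V X tol₁ tol₂ φ ψ} → Col E X tol₁ φ → Col E (V ∖ X) tol₂ ψ →
    (∀ t w → X t ≡ true → (V ∖ X) w ≡ true → E t w ≡ true → K t (φ t) w (ψ w) ≡ false) →
    IsGraph E → Col E V (glueTol X tol₁ tol₂) (λ v → if X v then φ v else ψ v)
  glue {E} {V} {X} {φ = φ} {ψ} colX colW nocross g v Vv with X v in Xv
  ... | true = ≤-<-trans (count-mono imp) (colX v Xv)
    where
    imp : ∀ u → (V u ∧ E u v) ∧ K u (if X u then φ u else ψ u) v (φ v) ≡ true → (X u ∧ E u v) ∧ K u (φ u) v (φ v) ≡ true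
    imp u p with X u in Xu
    ... | true = ∧-intro (∧-elimʳ {V u} (∧-elimˡ p)) (∧-elimʳ {V u ∧ E u v} p)
    ... | false = true≢false (∧-elimʳ {V u ∧ E u v} p) (trans (Ksym u (ψ u) v (φ v))
        (nocross v u Xv (∧-intro (∧-elimˡ {V u} (∧-elimˡ p)) (cong not Xu)) (trans (Esym g v u) (∧-elimʳ {V u} (∧-elimˡ p)))))
  ... | false = ≤-<-trans (count-mono imp) (colW v (∧-intro Vv (cong not Xv)))
    where
    imp : ∀ u → (V u ∧ E u v) ∧ K u (if X u then φ u else ψ u) v (ψ v) ≡ true → ((V u ∧ not (X u)) ∧ E u v) ∧ K u (ψ u) v (ψ v) ≡ true
    imp u p with X u in Xu
    ... | false = ∧-intro (∧-intro (∧-intro (∧-elimˡ {V u} (∧-elimˡ p)) refl) (∧-elimʳ {V u} (∧-elimˡ p))) (∧-elimʳ {V u ∧ E u v} p)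
    ... | true = true≢false (∧-elimʳ {V u ∧ E u v} p)
        (nocross u v Xu (∧-intro Vv (cong not Xv)) (∧-elimʳ {V u} (∧-elimˡ p)))

  hit-restore : ∀ E V φ {a b} → a ≢ b → ∀ v c →
    hit E V φ v c ≤ hit (remove E a b) V φ v c + ((v == a) ∨ (v == b) ▸ 1)
  hit-restore E V φ {a} {b} a≢b v c = begin
    hit E V φ v c
      ≤⟨ sumF-mono (λ u → pw (V u) (E u v) (K u (φ u) v c) (u == a) (v == b) (u == b) (v == a)) ⟩
    sumF (λ u → (((V u ∧ remove E a b u v) ∧ K u (φ u) v c) ▸ 1) + (((u == a) ▸ ((v == b) ▸ 1)) + ((u == b) ▸ ((v == a) ▸ 1))))
      ≡⟨ sumF-+ _ (λ u → ((u == a) ▸ ((v == b) ▸ 1)) + ((u == b) ▸ ((v == a) ▸ 1))) ⟩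
    h + sumF (λ u → ((u == a) ▸ ((v == b) ▸ 1)) + ((u == b) ▸ ((v == a) ▸ 1)))
      ≡⟨ cong (h +_) (sumF-+ (λ u → (u == a) ▸ ((v == b) ▸ 1)) (λ u → (u == b) ▸ ((v == a) ▸ 1))) ⟩
    h + (wsum (λ _ → (v == b) ▸ 1) ｛ a ｝ + wsum (λ _ → (v == a) ▸ 1) ｛ b ｝)
      ≡⟨ cong (h +_) (cong₂ _+_ (wsum-｛｝ _ a) (wsum-｛｝ _ b)) ⟩
    h + (((v == b) ▸ 1) + ((v == a) ▸ 1))
      ≤⟨ +-monoʳ-≤ h once ⟩
    h + ((v == a) ∨ (v == b) ▸ 1) ∎
    where
    open ≤-Reasoning
    h = hit (remove E a b) V φ v c
    pw : ∀ x e k ua vb ub va → ((x ∧ e) ∧ k ▸ 1)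
      ≤ (((x ∧ (e ∧ not ((ua ∧ vb) ∨ (ub ∧ va)))) ∧ k) ▸ 1) + ((ua ▸ (vb ▸ 1)) + (ub ▸ (va ▸ 1)))
    pw true true true true true ub va = s≤s z≤n
    pw true true true true false true true = s≤s z≤n
    pw true true true true false true false = s≤s z≤n
    pw true true true true false false va = s≤s z≤n
    pw true true true false vb true true = s≤s z≤n
    pw true true true false vb true false = s≤s z≤n
    pw true true true false vb false va = s≤s z≤n
    pw true true false ua vb ub va = z≤n
    pw true false k ua vb ub va = z≤n
    pw false e k ua vb ub va = z≤n
    once : ((v == b) ▸ 1) + ((v == a) ▸ 1) ≤ ((v == a) ∨ (v == b) ▸ 1)
    once with v ≟F a | v ≟F b
    ... | yes p | yes q = ⊥-elim (a≢b (trans (sym p) q))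
    ... | yes _ | no _ = ≤-refl
    ... | no _ | yes _ = ≤-refl
    ... | no _ | no _ = ≤-refl

  restore : ∀ {E V a b tol tol′ φ} → a ≢ b → Col (remove E a b) V tol′ φ →
    (∀ v h → V v ≡ true → h < tol′ v (φ v) → h + ((v == a) ∨ (v == b) ▸ 1) < tol v (φ v)) → Col E V tol φ
  restore {E} {V} {φ = φ} a≢b col h v Vv = ≤-<-trans (hit-restore E V φ a≢b v (φ v)) (h v _ Vv (col v Vv))

  restore-harmless : ∀ {E V a b tol φ} → Col (remove E a b) V tol φ → K a (φ a) b (φ b) ≡ false → Col E V tol φ
  restore-harmless {E} {V} {a} {b} {φ = φ} col ok v Vv = ≤-<-trans (count-mono imp) (col v Vv)
    where
    kept : ∀ {x e k r} → (x ∧ e) ∧ k ≡ true → (r ≡ true → k ≡ false) → (x ∧ (e ∧ not r)) ∧ k ≡ true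
    kept {true} {true} {true} {true} p q = sym (q refl)
    kept {true} {true} {true} {false} p q = refl
    kept {true} {true} {false} () q
    kept {true} {false} () q
    imp : ∀ u → (V u ∧ E u v) ∧ K u (φ u) v (φ v) ≡ true → (V u ∧ remove E a b u v) ∧ K u (φ u) v (φ v) ≡ true
    imp u p = kept {V u} {E u v} p clash
      where
      clash : ((u == a) ∧ (v == b)) ∨ ((u == b) ∧ (v == a)) ≡ true → K u (φ u) v (φ v) ≡ false
      clash q with ∨-elim {(u == a) ∧ (v == b)} q
      ... | inj₁ r rewrite ==-≡ u a (∧-elimˡ r) | ==-≡ v b (∧-elimʳ {u == a} r) = ok
      ... | inj₂ r rewrite ==-≡ u b (∧-elimˡ r) | ==-≡ v a (∧-elimʳ {u == b} r) = trans (Ksym b (φ b) a (φ a)) ok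

  _[_↦_] : (Fin n → Bool) → Fin n → Bool → Fin n → Bool
  (φ [ z ↦ β ]) v = if v == z then β else φ v

  hit-extend : ∀ E V φ z β v c → hit E V (φ [ z ↦ β ]) v c ≤ hit E (V ∖ ｛ z ｝) φ v c + (E z v ∧ K z β v c ▸ 1)
  hit-extend E V φ z β v c = sumF-bump _ _ z _ off at
    where
    off : ∀ u → u ≢ z → ((V u ∧ E u v) ∧ K u ((φ [ z ↦ β ]) u) v c ▸ 1) ≤ (((V u ∧ not (u == z)) ∧ E u v) ∧ K u (φ u) v c ▸ 1)
    off u u≢z rewrite ==-≢ u≢z with V u
    ... | true = ≤-refl
    ... | false = z≤n
    at : ((V z ∧ E z v) ∧ K z ((φ [ z ↦ β ]) z) v c ▸ 1) ≤ (((V z ∧ not (z == z)) ∧ E z v) ∧ K z (φ z) v c ▸ 1) + (E z v ∧ K z β v c ▸ 1)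
    at rewrite ==-refl z with V z
    ... | true = ≤-refl
    ... | false = z≤n

  forb : Edges n → VSet n → (Fin n → Bool) → (Fin n → ℕ) → Bool → Fin n → ℕ
  forb E X φ P c w = gate (hit E X φ w c) (P w)

  -- By the matching condition a coloured neighbour conflicts with at most one of the two colours of
  -- w.
  hits≤deg : ∀ {E} → IsGraph E → ∀ X φ w → hit E X φ w false + hit E X φ w true ≤ deg E X w
  hits≤deg {E} g X φ w = ≤-trans (≤-reflexive (sym (sumF-+ (λ u → (X u ∧ E u w) ∧ K u (φ u) w false ▸ 1) (λ u → (X u ∧ E u w) ∧ K u (φ u) w true ▸ 1))))
    (sumF-mono pw)
    where
    pw : ∀ u → ((X u ∧ E u w) ∧ K u (φ u) w false ▸ 1) + ((X u ∧ E u w) ∧ K u (φ u) w true ▸ 1) ≤ (X u ∧ E w u ▸ 1)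
    pw u rewrite Esym g w u with X u ∧ E u w | K u (φ u) w false in p | K u (φ u) w true in q
    ... | true | true | true = case Kmatch u (φ u) w false true p q of λ ()
    ... | true | true | false = ≤-refl
    ... | true | false | true = ≤-refl
    ... | true | false | false = z≤n
    ... | false | _ | _ = z≤n

  budgetTol : (Fin n → ℕ) → (Fin n → ℕ) → Tol
  budgetTol P D v c = if c then richTol (P v) (D v) else P v

  -- The term `size Y` keeps one unit of budget at every vertex, so that some colour is still
  -- permitted once all edges are gone.
  Sparse : ℕ → Edges n → VSet n → (Fin n → ℕ) → (Fin n → ℕ) → Set
  Sparse k E V P D = ∀ Y → Y ⊆ V → size Y + k * edges E Y ≤ wsum (λ v → P v + D v) Y

  forb-cost : ∀ {E} → IsGraph E → ∀ {k} X φ {P D : Fin n → ℕ} → (∀ v → P v ≤ k) → (∀ v → D v ≤ k) → ∀ w →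
    P w + D w ≤ (forb E X φ P false w + forb E X φ D true w) + k * deg E X w
  forb-cost {E} g {k} X φ {P} {D} P≤k D≤k w = begin
    P w + D w
      ≤⟨ +-mono-≤ (gate-cost (hit E X φ w false) (P w) (P≤k w)) (gate-cost (hit E X φ w true) (D w) (D≤k w)) ⟩
    (forb E X φ P false w + k * hit E X φ w false) + (forb E X φ D true w + k * hit E X φ w true)
      ≡⟨ arrange (forb E X φ P false w) (forb E X φ D true w) k (hit E X φ w false) (hit E X φ w true) ⟩
    (forb E X φ P false w + forb E X φ D true w) + k * (hit E X φ w false + hit E X φ w true)
      ≤⟨ +-monoʳ-≤ (forb E X φ P false w + forb E X φ D true w) (*-monoʳ-≤ k (hits≤deg g X φ w)) ⟩
    (forb E X φ P false w + forb E X φ D true w) + k * deg E X w ∎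
    where
    open ≤-Reasoning
    arrange : ∀ p d k x y → (p + k * x) + (d + k * y) ≡ (p + d) + k * (x + y)
    arrange = solve-∀

  -- A colouring of X extends to V when the edges to X are paid for in the budgets
  -- outside: those budgets are cut to zero at every colour that X conflicts with.
  extend : ∀ {E} → IsGraph E → ∀ {k V X tol φ P D} → Col E X tol φ → (∀ v → P v ≤ k) → (∀ v → D v ≤ k) →
    (∀ Y → Y ⊆ V ∖ X → size Y + k * edges E Y + k * wsum (deg E X) Y ≤ wsum (λ v → P v + D v) Y) →
    (∀ P D → (∀ v → P v ≤ k) → (∀ v → D v ≤ k) → Sparse k E (V ∖ X) P D → Colourable E (V ∖ X) (budgetTol P D)) →
    ∃ λ ψ → Col E V (glueTol X tol (budgetTol P D)) ψ × (∀ v → X v ≡ true → ψ v ≡ φ v)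
  extend {E} g {k} {V} {X} {tol} {φ} {P} {D} col P≤k D≤k sparse rec =
    finish (rec P′ D′ (λ v → ≤-trans (gate-≤ (hit E X φ v false) (P v)) (P≤k v)) (λ v → ≤-trans (gate-≤ (hit E X φ v true) (D v)) (D≤k v)) sparse′)
    where
    P′ = forb E X φ P false
    D′ = forb E X φ D true
    sparse′ : Sparse k E (V ∖ X) P′ D′
    sparse′ Y Y⊆ = +-cancelʳ-≤ (k * wsum (deg E X) Y) _ _ (begin
      size Y + k * edges E Y + k * wsum (deg E X) Y
        ≤⟨ sparse Y Y⊆ ⟩
      wsum (λ v → P v + D v) Y
        ≤⟨ wsum-mono Y (λ v _ → forb-cost g X φ P≤k D≤k v) ⟩
      wsum (λ v → (P′ v + D′ v) + k * deg E X v) Y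
        ≡⟨ wsum-+ (λ v → P′ v + D′ v) (λ v → k * deg E X v) Y ⟩
      wsum (λ v → P′ v + D′ v) Y + wsum (λ v → k * deg E X v) Y
        ≡⟨ cong (wsum (λ v → P′ v + D′ v) Y +_) (wsum-* k (deg E X) Y) ⟩
      wsum (λ v → P′ v + D′ v) Y + k * wsum (deg E X) Y ∎)
      where open ≤-Reasoning
    weaker : ∀ v c → (V ∖ X) v ≡ true → budgetTol P′ D′ v c ≤ budgetTol P D v c
    weaker v false _ = gate-≤ _ _
    weaker v true _ = richTol-mono (gate-≤ (hit E X φ v false) (P v)) (gate-≤ (hit E X φ v true) (D v))
    unhit : ∀ w c → 0 < budgetTol P′ D′ w c → hit E X φ w c ≡ 0
    unhit w false q = gate-pos _ (P w) q
    unhit w true q = gate-pos _ (D w) (richTol-pos (P′ w) _ q)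
    finish : Colourable E (V ∖ X) (budgetTol P′ D′) →
      ∃ λ ψ → Col E V (glueTol X tol (budgetTol P D)) ψ × (∀ v → X v ≡ true → ψ v ≡ φ v)
    finish (ψ , colW) = (λ v → if X v then φ v else ψ v) ,
      glue {tol₁ = tol} {budgetTol P D} col (Col-weaken {tol = budgetTol P′ D′} {budgetTol P D} weaker colW) nocross g ,
      (λ v Xv → cong (λ b → if b then φ v else ψ v) Xv)
      where
      nocross : ∀ t w → X t ≡ true → (V ∖ X) w ≡ true → E t w ≡ true → K t (φ t) w (ψ w) ≡ false
      nocross t w Xt Ww Etw = ¬true⇒false λ eq → true≢false (∧-intro (∧-intro Xt Etw) eq)
        (count≡0 {p = λ u → (X u ∧ E u w) ∧ K u (φ u) w (ψ w)} (unhit w (ψ w) (≤-trans (s≤s z≤n) (colW w Ww))) t)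

  lowerP : VSet n → (Fin n → ℕ) → Fin n → ℕ
  lowerP L P v = if L v then pred (P v) else P v

  lowerD : VSet n → (Fin n → ℕ) → (Fin n → ℕ) → Fin n → ℕ
  lowerD L P D v = if L v then lowRich (P v) (D v) else D v

  lowerP-≤ : ∀ L P v → lowerP L P v ≤ P v
  lowerP-≤ L P v with L v
  ... | true = pred[n]≤n
  ... | false = ≤-refl

  lowerD-≤ : ∀ L P D v → lowerD L P D v ≤ D v
  lowerD-≤ L P D v with L v
  ... | true = lowRich-≤ (P v) (D v)
  ... | false = ≤-refl

  lower-total : ∀ L P D Y → wsum (λ v → P v + D v) Y ≤ wsum (λ v → lowerP L P v + lowerD L P D v) Y + wsum (λ v → L v ▸ 1) Y
  lower-total L P D Y = ≤-trans (wsum-mono Y pw) (≤-reflexive (wsum-+ (λ v → lowerP L P v + lowerD L P D v) (λ v → L v ▸ 1) Y))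
    where
    pw : ∀ v → Y v ≡ true → P v + D v ≤ (lowerP L P v + lowerD L P D v) + (L v ▸ 1)
    pw v _ with L v
    ... | true = lower-cost (P v) (D v)
    ... | false = m≤m+n _ 0

  lower-tol : ∀ L P D v c h → h < budgetTol (lowerP L P) (lowerD L P D) v c → h + (L v ▸ 1) < budgetTol P D v c
  lower-tol L P D v c h = go (L v) c
    where
    go : ∀ l c → h < (if c then richTol (if l then pred (P v) else P v) (if l then lowRich (P v) (D v) else D v) else (if l then pred (P v) else P v)) →
      h + (l ▸ 1) < budgetTol P D v c
    go true false q = subst (_< P v) (+-comm 1 h) (lower-poor (P v) q)
    go true true q = subst (_< richTol (P v) (D v)) (+-comm 1 h) (lower-rich (P v) (D v) q)
    go false false q = subst (_< P v) (sym (+-identityʳ h)) q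
    go false true q = subst (_< richTol (P v) (D v)) (sym (+-identityʳ h)) q

-- Sparse budgets

module Sparse-colourings {n : ℕ} (K : Fin n → Bool → Fin n → Bool → Bool)
  (Ksym : ∀ u a v b → K u a v b ≡ K v b u a)
  (Kmatch : ∀ u a v b b′ → K u a v b ≡ true → K u a v b′ ≡ true → b ≡ b′)
  (k : ℕ) (2≤k : 2 ≤ k) where

  open Colouring K Ksym Kmatch

  ∖-⊆ : ∀ (V X : VSet n) → V ∖ X ⊆ V
  ∖-⊆ V X v p = ∧-elimˡ p

  ∖-disjoint : ∀ {V X Y : VSet n} → Y ⊆ V ∖ X → Disjoint Y X
  ∖-disjoint {V} h v Yv = not-true (∧-elimʳ {V v} (h v Yv))

  ∪-⊆ : ∀ {V X Y : VSet n} → Y ⊆ V ∖ X → X ⊆ V → Y ∪ X ⊆ V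
  ∪-⊆ {V} {X} {Y} h₁ h₂ v p with ∨-elim {Y v} p
  ... | inj₁ q = ∧-elimˡ (h₁ v q)
  ... | inj₂ q = h₂ v q

  glueTol-idem : ∀ {E V X tol φ} → Col E V (glueTol X tol tol) φ → Col E V tol φ
  glueTol-idem {X = X} {tol} = Col-weaken {tol = glueTol X tol tol} {tol} λ v c _ → pw (X v) (tol v c)
    where
    pw : ∀ b x → (if b then x else x) ≤ x
    pw true x = ≤-refl
    pw false x = ≤-refl

  ends : Fin n → Fin n → VSet n
  ends a b v = (v == a) ∨ (v == b)

  both≤ends : ∀ (Y : VSet n) a b s → (Y a ≡ true → Y b ≡ false → 1 ≤ s) → (Y a ≡ false → Y b ≡ true → 1 ≤ s) →
    (Y a ▸ 1) + (Y b ▸ 1) ≤ k * (Y a ∧ Y b ▸ 1) + s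
  both≤ends Y a b s h₁ h₂ with Y a | Y b
  ... | true | true = ≤-trans 2≤k (≤-trans (≤-reflexive (sym (*-identityʳ k))) (m≤m+n (k * 1) s))
  ... | true | false = ≤-trans (h₁ refl refl) (m≤n+m s (k * 0))
  ... | false | true = ≤-trans (h₂ refl refl) (m≤n+m s (k * 0))
  ... | false | false = z≤n

  isolate : ∀ sY eY d wY sX eX wX → (sY + sX) + k * ((eY + eX) + d) ≤ wY + wX → wX ≤ sX + k * eX → sY + k * eY + k * d ≤ wY
  isolate sY eY d wY sX eX wX h₁ h₂ = ≤-cert _ wY 0 (+-mono-≤ h₁ h₂) (eq k sY eY d wY sX eX wX)
    where
    eq : ∀ k sY eY d wY sX eX wX → (sY + k * eY + k * d) + ((wY + wX) + (sX + k * eX)) + 0 ≡ wY + (((sY + sX) + k * ((eY + eX) + d)) + wX)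
    eq = solve-∀

  drop-edge : ∀ sY e e′ c l s w w′ → sY + k * e + s ≤ w → e′ + c ≤ e → w ≤ w′ + l → l ≤ k * c + s → sY + k * e′ ≤ w′
  drop-edge sY e e′ c l s w w′ h₁ h₂ h₃ h₄ =
    ≤-cert _ w′ 0 (+-mono-≤ (+-mono-≤ h₁ (*-monoʳ-≤ k h₂)) (+-mono-≤ h₃ h₄)) (eq k sY e e′ c l s w w′)
    where
    eq : ∀ k sY e e′ c l s w w′ → (sY + k * e′) + ((w + k * e) + ((w′ + l) + (k * c + s))) + 0 ≡ w′ + (((sY + k * e + s) + k * (e′ + c)) + (w + l))
    eq = solve-∀

  EdgeIn : Edges n → VSet n → Set
  EdgeIn E V = ∃ λ a → ∃ λ b → V a ≡ true × V b ≡ true × E a b ≡ true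

  no-edges⇒unhit : ∀ {E V} → ¬ EdgeIn E V → ∀ φ v c → V v ≡ true → hit E V φ v c ≡ 0
  no-edges⇒unhit {E} {V} none φ v c Vv = count-none λ u → ¬true⇒false λ p → none (u , v , ∧-elimˡ {V u} (∧-elimˡ p) , Vv , ∧-elimʳ {V u} (∧-elimˡ p))

  Tight : Edges n → VSet n → (Fin n → ℕ) → VSet n → Set
  Tight E V w X = X ⊆ V × (∃ λ x → X x ≡ true) × (∃ λ y → (V ∖ X) y ≡ true) × wsum w X ≤ size X + k * edges E X

  -- A tight proper set can spare nothing, so it is coloured on its own; by its tightness the
  -- outside can pay for all edges to it. Without tight sets every proper nonempty set has a unit to
  -- spare, just what a set with one end of a deleted edge loses. A set with both ends loses two
  -- units and regains `k ≥ 2`.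
  sparse-colourable : ∀ N {E} → IsGraph E → ∀ V P D → size V + edges E full < N →
    (∀ v → P v ≤ k) → (∀ v → D v ≤ k) → Sparse k E V P D → Colourable E V (budgetTol P D)
  sparse-colourable (suc N) {E} g V P D (s≤s small) P≤k D≤k sparse = colourable-stable {tol = budgetTol P D} λ none → ¬¬-em λ where
      (inj₁ tight) → none (split tight)
      (inj₂ loose) → ¬¬-em λ where
        (inj₁ edge) → none (delete loose edge)
        (inj₂ noEdge) → none (trivial noEdge)
    where
    w = λ v → P v + D v
    split : ∃ (Tight E V w) → Colourable E V (budgetTol P D)
    split (X , X⊆V , (x , Xx) , (y , Wy) , tight) =
      let φ , col = sparse-colourable N g X P D
            (≤-trans (+-monoˡ-≤ _ (size-strict y X⊆V (not-true (∧-elimʳ {V y} Wy)) (∧-elimˡ Wy))) small) P≤k D≤k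
            (λ Y Y⊆ → sparse Y (λ v p → X⊆V v (Y⊆ v p)))
          ψ , col′ , _ = extend g {tol = budgetTol P D} col P≤k D≤k outer
            (λ P′ D′ → sparse-colourable N g (V ∖ X) P′ D′
              (≤-trans (+-monoˡ-≤ _ (size-strict x (∖-⊆ V X) (trans (cong (V x ∧_) (cong not Xx)) (∧-zeroʳ (V x))) (X⊆V x Xx))) small))
      in ψ , glueTol-idem {X = X} {budgetTol P D} col′
      where
      outer : ∀ Y → Y ⊆ V ∖ X → size Y + k * edges E Y + k * wsum (deg E X) Y ≤ wsum w Y
      outer Y Y⊆ = isolate (size Y) (edges E Y) _ _ (size X) (edges E X) (wsum w X)
        (subst₂ _≤_ (cong₂ (λ s e → s + k * e) (wsum-∪ (λ _ → 1) dis) (edges-∪ g dis)) (wsum-∪ w dis)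
          (sparse (Y ∪ X) (∪-⊆ Y⊆ X⊆V))) tight
        where dis = ∖-disjoint {V} Y⊆
    delete : ¬ ∃ (Tight E V w) → EdgeIn E V → Colourable E V (budgetTol P D)
    delete loose (a , b , Va , Vb , ab) =
      let φ , col = sparse-colourable N (remove-isGraph g a b) V P′ D′
            (≤-trans (≤-reflexive (trans (sym (+-suc (size V) _)) (cong (size V +_) (+-comm 1 _)))) (≤-trans (+-monoʳ-≤ (size V) (edges-remove g ab full)) small))
            (λ v → ≤-trans (lowerP-≤ (ends a b) P v) (P≤k v)) (λ v → ≤-trans (lowerD-≤ (ends a b) P D v) (D≤k v)) sparse′
      in φ , restore {tol = budgetTol P D} {budgetTol P′ D′} (E⇒≢ g ab) col (λ v h _ → lower-tol (ends a b) P D v (φ v) h)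
      where
      P′ = lowerP (ends a b) P
      D′ = lowerD (ends a b) P D
      slack : ∀ Y → Y ⊆ V → ∀ {x y} → Y x ≡ true → Y y ≡ false → V y ≡ true → 1 + (size Y + k * edges E Y) ≤ wsum w Y
      slack Y Y⊆V {x} {y} Yx Yy Vy = ≰⇒> λ tight → loose (Y , Y⊆V , (x , Yx) , (y , ∧-intro Vy (cong not Yy)) , tight)
      sparse′ : Sparse k (remove E a b) V P′ D′
      sparse′ Y Y⊆V = from-slack (Y a) (Y b) refl refl
        where
        conclude : ∀ s → size Y + k * edges E Y + s ≤ wsum w Y →
          (Y a ≡ true → Y b ≡ false → 1 ≤ s) → (Y a ≡ false → Y b ≡ true → 1 ≤ s) →
          size Y + k * edges (remove E a b) Y ≤ wsum (λ v → P′ v + D′ v) Y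
        conclude s h h₁ h₂ = drop-edge (size Y) (edges E Y) (edges (remove E a b) Y) (Y a ∧ Y b ▸ 1) ((Y a ▸ 1) + (Y b ▸ 1)) s
          (wsum w Y) (wsum (λ v → P′ v + D′ v) Y) h
          (edges-remove g ab Y) (≤-trans (lower-total (ends a b) P D Y) (+-monoʳ-≤ (wsum (λ v → P′ v + D′ v) Y) (pair-sum a b Y)))
          (both≤ends Y a b s h₁ h₂)
        from-slack : ∀ x y → Y a ≡ x → Y b ≡ y → size Y + k * edges (remove E a b) Y ≤ wsum (λ v → P′ v + D′ v) Y
        from-slack true true p q = conclude 0 (≤-trans (≤-reflexive (+-identityʳ _)) (sparse Y Y⊆V)) (λ _ r → true≢false q r) (λ r _ → true≢false p r)
        from-slack true false p q = conclude 1 (≤-trans (≤-reflexive (+-comm _ 1)) (slack Y Y⊆V p q Vb)) (λ _ _ → ≤-refl) (λ _ _ → ≤-refl)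
        from-slack false true p q = conclude 1 (≤-trans (≤-reflexive (+-comm _ 1)) (slack Y Y⊆V q p Va)) (λ _ _ → ≤-refl) (λ _ _ → ≤-refl)
        from-slack false false p q = conclude 0 (≤-trans (≤-reflexive (+-identityʳ _)) (sparse Y Y⊆V)) (λ r _ → true≢false r p) (λ _ r → true≢false r q)
    trivial : ¬ EdgeIn E V → Colourable E V (budgetTol P D)
    trivial noEdge = φ , λ v Vv → subst (_< budgetTol P D v (φ v)) (sym (no-edges⇒unhit noEdge φ v (φ v) Vv)) (allowed (P v) (D v) (single v Vv))
      where
      φ : Fin n → Bool
      φ v = P v ≡ᵇ 0
      single : ∀ v → V v ≡ true → 1 ≤ P v + D v
      single v Vv = ≤-trans (m≤m+n 1 _)
        (subst₂ _≤_ (cong₂ (λ s e → s + k * e) (wsum-｛｝ (λ _ → 1) v) (edges-｛｝ g v)) (wsum-｛｝ w v)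
          (sparse ｛ v ｝ (λ u p → subst (λ z → V z ≡ true) (sym (==-≡ u v p)) Vv)))
      allowed : ∀ p d → 1 ≤ p + d → 0 < (if (p ≡ᵇ 0) then richTol p d else p)
      allowed zero (suc d) _ = s≤s z≤n
      allowed (suc p) d _ = s≤s z≤n

-- Slack

module Potential {n : ℕ} (K : Fin n → Bool → Fin n → Bool → Bool)
  (Ksym : ∀ u a v b → K u a v b ≡ K v b u a)
  (Kmatch : ∀ u a v b b′ → K u a v b ≡ true → K u a v b′ ≡ true → b ≡ b′)
  (k μ : ℕ) (4≤k : 4 ≤ k) (k≤μ : k ≤ μ) where

  2≤k : 2 ≤ k
  2≤k = ≤-trans (s≤s (s≤s z≤n)) 4≤k

  open Colouring K Ksym Kmatch public
  open Sparse-colourings K Ksym Kmatch k 2≤k public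

  m : ℕ
  m = suc μ

  cost : Edges n → VSet n → ℕ
  cost E Y = m * size Y + k * edges E Y

  -- `Slack` and `AtMost` bound the slack from below and from above, with the negative terms moved
  -- across to remain in the naturals. The empty set has slack `m`.
  Slack : Edges n → (Fin n → ℕ) → VSet n → ℕ → Set
  Slack E w Y q = cost E Y + q ≤ wsum w Y + m

  AtMost : Edges n → (Fin n → ℕ) → VSet n → ℕ → Set
  AtMost E w Y q = wsum w Y + m ≤ cost E Y + q

  wt : Tol → Fin n → ℕ
  wt tol v = tol v false + tol v true

  Bounded : Tol → Set
  Bounded tol = ∀ v → tol v false ≤ k × tol v true ≤ μ + k

  cost-≐ : ∀ E {X Y} → X ≐ Y → cost E X ≡ cost E Y
  cost-≐ E h = cong₂ (λ s e → m * s + k * e) (wsum-≐ (λ _ → 1) h) (edges-≐ E h)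

  Slack-≐ : ∀ {E w X Y q} → X ≐ Y → Slack E w X q → Slack E w Y q
  Slack-≐ {E} {w} {q = q} h = subst₂ _≤_ (cong (_+ q) (cost-≐ E h)) (cong (_+ m) (wsum-≐ w h))

  ¬Slack⇒AtMost : ∀ {E w Y q} → ¬ Slack E w Y (suc q) → AtMost E w Y q
  ¬Slack⇒AtMost {E} {w} {Y} {q} h = ≤-pred (≤-trans (≰⇒> h) (≤-reflexive (+-suc (cost E Y) q)))

  ¬AtMost⇒Slack : ∀ {E w Y q} → ¬ AtMost E w Y q → Slack E w Y (suc q)
  ¬AtMost⇒Slack {E} {w} {Y} {q} h = ≤-trans (≤-reflexive (+-suc (cost E Y) q)) (≰⇒> h)

  Slack-mono : ∀ {E w w′ Y q} → (∀ v → Y v ≡ true → w v ≤ w′ v) → Slack E w Y q → Slack E w′ Y q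
  Slack-mono {Y = Y} h s = ≤-trans s (+-monoˡ-≤ m (wsum-mono Y h))

  cost-∪ : ∀ {E} → IsGraph E → ∀ {Y X} → Disjoint Y X →
    cost E (Y ∪ X) ≡ cost E X + (m * size Y + k * edges E Y + k * wsum (deg E X) Y)
  cost-∪ {E} g {Y} {X} d = trans (cong₂ (λ s e → m * s + k * e) (wsum-∪ (λ _ → 1) d) (edges-∪ g d))
    (eq m k (size Y) (size X) (edges E Y) (edges E X) (wsum (deg E X) Y))
    where
    eq : ∀ m k sY sX eY eX d → m * (sY + sX) + k * ((eY + eX) + d) ≡ (m * sX + k * eX) + (m * sY + k * eY + k * d)
    eq = solve-∀

  cost-insert : ∀ {E} → IsGraph E → ∀ {X} z → X z ≡ false → cost E (｛ z ｝ ∪ X) ≡ cost E X + (m + k * deg E X z)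
  cost-insert {E} g {X} z Xz = trans (cost-∪ g {｛ z ｝} {X} (λ v p → trans (cong X (==-≡ v z p)) Xz))
    (cong (cost E X +_) (trans (cong₂ (λ s e → m * s + k * e + k * wsum (deg E X) ｛ z ｝) (wsum-｛｝ (λ _ → 1) z) (edges-｛｝ g z))
      (trans (cong (λ d → m * 1 + k * 0 + k * d) (wsum-｛｝ (deg E X) z)) (eq m k (deg E X z)))))
    where
    eq : ∀ m k d → m * 1 + k * 0 + k * d ≡ m + k * d
    eq = solve-∀

  wsum-insert : ∀ (w : Fin n → ℕ) {X} z → X z ≡ false → wsum w (｛ z ｝ ∪ X) ≡ w z + wsum w X
  wsum-insert w {X} z Xz = trans (wsum-∪ w {｛ z ｝} {X} (λ v p → trans (cong X (==-≡ v z p)) Xz)) (cong (_+ wsum w X) (wsum-｛｝ w z))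

  -- What the slack of X leaves for a set Y outside X, after paying for the edges between them.
  outer : ∀ {E w} → IsGraph E → ∀ {X Y p q} → Disjoint Y X → Slack E w (Y ∪ X) p → AtMost E w X q →
    (m * size Y + k * edges E Y + k * wsum (deg E X) Y) + p ≤ wsum w Y + q
  outer {E} {w} g {X} {Y} {p} {q} d s a = ≤-cert _ (wsum w Y + q) 0
    (+-mono-≤ (subst₂ _≤_ (cong (_+ p) (cost-∪ g d)) (cong (_+ m) (wsum-∪ w d)) s) a)
    (eq (m * size Y + k * edges E Y + k * wsum (deg E X) Y) (cost E X) p q (wsum w Y) (wsum w X) m)
    where
    eq : ∀ y x p q wY wX m → (y + p) + (((wY + wX) + m) + (x + q)) + 0 ≡ (wY + q) + (((x + y) + p) + (wX + m))
    eq = solve-∀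

  slack-insert : ∀ {E w} → IsGraph E → ∀ {X} z {p} → X z ≡ false → Slack E w (｛ z ｝ ∪ X) p →
    cost E X + (m + k * deg E X z) + p ≤ (w z + wsum w X) + m
  slack-insert {E} {w} g {X} z {p} Xz = subst₂ _≤_ (cong (_+ p) (cost-insert g {X} z Xz)) (cong (_+ m) (wsum-insert w {X} z Xz))

  slack-lower : ∀ {E w w′} x {Y q} → (∀ v → w v ≤ w′ v + ((v == x) ▸ 1)) →
    (Y x ≡ true → Slack E w Y (suc q)) → (Y x ≡ false → Slack E w Y q) → Slack E w′ Y q
  slack-lower {E} {w} {w′} x {Y} {q} h st sf = by (Y x) refl
    where
    total : wsum w Y ≤ wsum w′ Y + (Y x ▸ 1)
    total = begin
      wsum w Y                                       ≤⟨ wsum-mono Y (λ v _ → h v) ⟩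
      wsum (λ v → w′ v + ((v == x) ▸ 1)) Y           ≡⟨ wsum-+ w′ (λ v → (v == x) ▸ 1) Y ⟩
      wsum w′ Y + wsum (λ v → (v == x) ▸ 1) Y        ≡⟨ cong (wsum w′ Y +_) (wsum-point x Y) ⟩
      wsum w′ Y + (Y x ▸ 1) ∎
      where open ≤-Reasoning
    by : ∀ b → Y x ≡ b → Slack E w′ Y q
    by true Yx = ≤-pred (begin
      suc (cost E Y + q)          ≡⟨ +-suc (cost E Y) q ⟨
      cost E Y + suc q            ≤⟨ st Yx ⟩
      wsum w Y + m                ≤⟨ +-monoˡ-≤ m total ⟩
      wsum w′ Y + (Y x ▸ 1) + m   ≡⟨ cong (λ b → wsum w′ Y + (b ▸ 1) + m) Yx ⟩
      wsum w′ Y + 1 + m           ≡⟨ cong (_+ m) (+-comm (wsum w′ Y) 1) ⟩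
      suc (wsum w′ Y + m) ∎)
      where open ≤-Reasoning
    by false Yx = begin
      cost E Y + q                ≤⟨ sf Yx ⟩
      wsum w Y + m                ≤⟨ +-monoˡ-≤ m total ⟩
      wsum w′ Y + (Y x ▸ 1) + m   ≡⟨ cong (λ b → wsum w′ Y + (b ▸ 1) + m) Yx ⟩
      wsum w′ Y + 0 + m           ≡⟨ cong (_+ m) (+-identityʳ (wsum w′ Y)) ⟩
      wsum w′ Y + m ∎
      where open ≤-Reasoning

  -- The predicate β will select the colours of x that conflict with a fixed coloured neighbour. By
  -- the matching condition there is at most one, so a conflict with that neighbour is prepaid at
  -- the cost of a single unit of weight.
  lowerAt : Fin n → (Bool → Bool) → Tol → Tol
  lowerAt x β tol v c = if (v == x) ∧ β c then pred (tol v c) else tol v c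

  lowerAt-≤ : ∀ x β tol v c → lowerAt x β tol v c ≤ tol v c
  lowerAt-≤ x β tol v c with (v == x) ∧ β c
  ... | true = pred[n]≤n
  ... | false = ≤-refl

  lowerAt-bounded : ∀ x β {tol} → Bounded tol → Bounded (lowerAt x β tol)
  lowerAt-bounded x β {tol} h v = ≤-trans (lowerAt-≤ x β tol v false) (proj₁ (h v)) , ≤-trans (lowerAt-≤ x β tol v true) (proj₂ (h v))

  AtMostOne : (Bool → Bool) → Set
  AtMostOne β = β false ≡ true → β true ≡ true → ⊥

  lowerAt-wt : ∀ x {β} → AtMostOne β → ∀ tol v → wt tol v ≤ wt (lowerAt x β tol) v + ((v == x) ▸ 1)
  lowerAt-wt x {β} one tol v = pw (v == x) (β false) (β true) (tol v false) (tol v true) one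
    where
    pred+1 : ∀ a → a ≤ pred a + 1
    pred+1 zero = z≤n
    pred+1 (suc a) = ≤-reflexive (+-comm 1 a)
    pw : ∀ e p q a b → (p ≡ true → q ≡ true → ⊥) →
      a + b ≤ ((if e ∧ p then pred a else a) + (if e ∧ q then pred b else b)) + (e ▸ 1)
    pw false p q a b _ = m≤m+n (a + b) 0
    pw true true true a b h = ⊥-elim (h refl refl)
    pw true true false a b _ = ≤-trans (+-monoˡ-≤ b (pred+1 a)) (≤-reflexive (trans (+-assoc (pred a) 1 b) (trans (cong (pred a +_) (+-comm 1 b)) (sym (+-assoc (pred a) b 1)))))
    pw true false true a b _ = ≤-trans (+-monoʳ-≤ a (pred+1 b)) (≤-reflexive (sym (+-assoc a (pred b) 1)))
    pw true false false a b _ = m≤m+n (a + b) 1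

  lowerAt-hit : ∀ x β tol v c h → h < lowerAt x β tol v c → h + ((v == x) ∧ β c ▸ 1) < tol v c
  lowerAt-hit x β tol v c h q = pw ((v == x) ∧ β c) (tol v c) q
    where
    pw : ∀ b t → h < (if b then pred t else t) → h + (b ▸ 1) < t
    pw true (suc t) q = s≤s (≤-trans (≤-reflexive (+-comm h 1)) q)
    pw false t q = subst (_< t) (sym (+-identityʳ h)) q

  atMostOne : ∀ u v c → AtMostOne (λ a → K u a v c)
  atMostOne u v c p q = case Kmatch v c u false true (trans (Ksym v c u false) p) (trans (Ksym v c u true) q) of λ ()

  -- The truth value is itself the colour: if poor conflicts, the value is `true`, that is rich, and
  -- the two colours cannot both conflict.
  avoid : Fin n → Fin n → Bool → Bool
  avoid z v c = K z false v c

  avoids : ∀ z v c → K z (avoid z v c) v c ≡ false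
  avoids z v c with K z false v c in eq
  ... | true = ¬true⇒false (atMostOne z v c eq)
  ... | false = eq

  count≤1 : ∀ {p : Fin n → Bool} x → (∀ u → p u ≡ true → u ≡ x) → count p ≤ 1
  count≤1 {p} x h = ≤-trans (count-mono {p = p} {｛ x ｝} (λ u pu → trans (cong (_== x) (h u pu)) (==-refl x))) (≤-reflexive (wsum-｛｝ (λ _ → 1) x))

  add-vertex : ∀ {E V tol tol′ φ} z β → Col E (V ∖ ｛ z ｝) tol′ φ →
    (∀ y h → V y ≡ true → y ≢ z → h < tol′ y (φ y) → h + (E z y ∧ K z β y (φ y) ▸ 1) < tol y (φ y)) →
    hit E V (φ [ z ↦ β ]) z β < tol z β → Col E V tol (φ [ z ↦ β ])
  add-vertex {E} {V} {tol} {tol′} {φ} z β col old new v Vv with v ≟F z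
  ... | yes refl = new
  ... | no v≢z = ≤-<-trans (hit-extend E V φ z β v (φ v))
    (old v (hit E (V ∖ ｛ z ｝) φ v (φ v)) Vv v≢z (col v (∧-intro Vv (cong not (==-≢ v≢z)))))

  del-⊆ : ∀ {V : VSet n} z → V ∖ ｛ z ｝ ⊆ V
  del-⊆ {V} z = ∖-⊆ V ｛ z ｝

  ∉del : ∀ (V : VSet n) z → (V ∖ ｛ z ｝) z ≡ false
  ∉del V z rewrite ==-refl z = ∧-zeroʳ (V z)

  ∈del : ∀ {V : VSet n} {v z} → V v ≡ true → v ≢ z → (V ∖ ｛ z ｝) v ≡ true
  ∈del Vv v≢z = ∧-intro Vv (cong not (==-≢ v≢z))

  ∈del⇒≢ : ∀ {V : VSet n} {v z} → (V ∖ ｛ z ｝) v ≡ true → v ≢ z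
  ∈del⇒≢ {V} {v} p refl = true≢false p (∉del V v)

  del-insert : ∀ {V : VSet n} z → V z ≡ true → ｛ z ｝ ∪ (V ∖ ｛ z ｝) ≐ V
  del-insert {V} z Vz v with v ≟F z
  ... | yes refl = sym Vz
  ... | no _ with V v
  ...   | true = refl
  ...   | false = refl

  size-del : ∀ {V : VSet n} z → V z ≡ true → suc (size (V ∖ ｛ z ｝)) ≤ size V
  size-del {V} z Vz = size-strict z (del-⊆ {V} z) (∉del V z) Vz

  hubTol : Tol → Fin n → Bool → ℕ → Tol
  hubTol tol x c b v a = if v == x then (if does (a ≟B c) then suc b else 0) else tol v a

  -- The hub has tolerance `suc b` in its colour but is weighed as if the forbidden colour kept
  -- tolerance μ. Adding it to a set then raises the slack by b minus k per edge, where b is exactly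
  -- the number of conflicts that it survives.
  hubWt : Tol → Fin n → ℕ → Fin n → ℕ
  hubWt tol x b v = if v == x then m + b else wt tol v

  hubTol-x : ∀ tol x c b → hubTol tol x c b x c ≡ suc b
  hubTol-x tol x c b rewrite ==-refl x with c
  ... | true = refl
  ... | false = refl

  hubTol-≢ : ∀ tol {x v} c b a → v ≢ x → hubTol tol x c b v a ≡ tol v a
  hubTol-≢ tol c b a v≢x rewrite ==-≢ v≢x = refl

  hubTol-colour : ∀ {tol x c b h a} → h < hubTol tol x c b x a → a ≡ c
  hubTol-colour {x = x} {true} {a = true} p = refl
  hubTol-colour {x = x} {false} {a = false} p = refl
  hubTol-colour {x = x} {true} {a = false} p rewrite ==-refl x = case p of λ ()
  hubTol-colour {x = x} {false} {a = true} p rewrite ==-refl x = case p of λ ()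

  Colours-smaller : Edges n → ℕ → Set
  Colours-smaller E M = ∀ V tol → Bounded tol → size V < M →
    (∀ Y → Y ⊆ V → Slack E (wt tol) Y 1) → Colourable E V tol

  -- The vertex z is the middle of a path from the hub to `far`. By `far-off` the links do not
  -- interfere: neither deleting one of them nor lowering its `far` disturbs another.
  record Link (E : Edges n) (V : VSet n) (tol : Tol) (x z : Fin n) : Set where
    field
      tolerant : ∀ c → 2 ≤ tol z c
      far      : Fin n
      far∈     : V far ≡ true
      far-adj  : E z far ≡ true
      far≢     : far ≢ x
      far-off  : E x far ≡ false
      only     : ∀ y → V y ≡ true → E z y ≡ true → y ≡ x ⊎ y ≡ far

-- A hub whose neighbours have degree two

module Hub {n : ℕ} (K : Fin n → Bool → Fin n → Bool → Bool)
  (Ksym : ∀ u a v b → K u a v b ≡ K v b u a)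
  (Kmatch : ∀ u a v b b′ → K u a v b ≡ true → K u a v b′ ≡ true → b ≡ b′)
  (k μ : ℕ) (4≤k : 4 ≤ k) (k≤μ : k ≤ μ) where

  open Potential K Ksym Kmatch k μ 4≤k k≤μ public

  +-▸-false : ∀ h {t b} → b ≡ false → h < t → h + (b ▸ 1) < t
  +-▸-false h {t} refl q = subst (_< t) (sym (+-identityʳ h)) q

  +-▸-≤ : ∀ h b {t} → h < t → h + (b ▸ 1) < suc t
  +-▸-≤ h true q = ≤-trans (s≤s (≤-reflexive (+-comm h 1))) (s≤s q)
  +-▸-≤ h false q = ≤-trans (s≤s (≤-reflexive (+-identityʳ h))) (≤-trans q (n≤1+n _))

  2≤deg : ∀ {E} {Y : VSet n} {z u v} → u ≢ v → Y u ≡ true → Y v ≡ true → E z u ≡ true → E z v ≡ true → 2 ≤ deg E Y z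
  2≤deg {E} {Y} {z} {u} {v} u≢v Yu Yv zu zv = ≤-trans
    (≤-reflexive (sym (cong₂ (λ a b → (a ▸ 1) + (b ▸ 1)) (∧-intro Yu zu) (∧-intro Yv zv))))
    (two-terms≤sumF (λ v → Y v ∧ E z v ▸ 1) u≢v)

  hubWt-≢ : ∀ tol {x v} b → v ≢ x → hubWt tol x b v ≡ wt tol v
  hubWt-≢ tol b v≢x rewrite ==-≢ v≢x = refl

  hubWt-x : ∀ tol x b → hubWt tol x b x ≡ m + b
  hubWt-x tol x b rewrite ==-refl x = refl

  module _ {E : Edges n} (g : IsGraph E) (x : Fin n) (c : Bool) where

    isolated-hub : ∀ {V tol b} → Colourable E (V ∖ ｛ x ｝) tol → (∀ z → V z ≡ true → E x z ≡ false) →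
      Colourable E V (hubTol tol x c b)
    isolated-hub {V} {tol} {b} (φ , col) alone = φ [ x ↦ c ] , add-vertex {tol = hubTol tol x c b} {tol} x c col
      (λ y h Vy y≢x q → +-▸-false h (cong (_∧ K x c y (φ y)) (alone y Vy)) (subst (h <_) (sym (hubTol-≢ tol c b (φ y) y≢x)) q))
      (subst₂ _<_ (sym unhit) (sym (hubTol-x tol x c b)) (s≤s z≤n))
      where
      unhit : hit E V (φ [ x ↦ c ]) x c ≡ 0
      unhit = count-none λ u → ¬true⇒false λ p → true≢false (trans (Esym g x u) (∧-elimʳ {V u} (∧-elimˡ p))) (alone u (∧-elimˡ (∧-elimˡ {V u ∧ E u x} p)))

    -- Deleting a link z of the hub x costs one conflict, to be absorbed either by x or by the far neighbour of z.
    module Step {V : VSet n} {tol : Tol} {z : Fin n} (Vx : V x ≡ true) (Vz : V z ≡ true) (xz : E x z ≡ true) (link : Link E V tol x z) where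
      open Link link

      z≢x : z ≢ x
      z≢x = E⇒≢ g xz ∘ sym

      -- A link survives one conflict in either colour, so its colour need only avoid one of its two
      -- neighbours. `push` avoids the hub, whose colour is known beforehand, and `absorb` avoids
      -- `far`.
      extend-φ : ∀ {tol₁ tol₂ φ} β → Col E (V ∖ ｛ z ｝) tol₁ φ → (∀ y h → y ≢ z → y ≡ x ⊎ y ≡ far → h < tol₁ y (φ y) → h + (E z y ∧ K z β y (φ y) ▸ 1) < tol₂ y (φ y)) →
        (∀ y a → y ≢ x → tol₁ y a ≤ tol₂ y a) → (∀ a → 2 ≤ tol₂ z a) →
        K z β x (φ x) ≡ false ⊎ K z β far (φ far) ≡ false → Col E V tol₂ (φ [ z ↦ β ])
      extend-φ {tol₁} {tol₂} {φ} β col near weak two free = add-vertex {tol = tol₂} {tol₁} z β col old (≤-trans (s≤s (few free)) (two β))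
        where
        old : ∀ y h → V y ≡ true → y ≢ z → h < tol₁ y (φ y) → h + (E z y ∧ K z β y (φ y) ▸ 1) < tol₂ y (φ y)
        old y h Vy y≢z q with E z y in zy
        ... | true = subst (λ e → h + (e ∧ K z β y (φ y) ▸ 1) < tol₂ y (φ y)) zy (near y h y≢z (only y Vy zy) q)
        ... | false = +-▸-false h refl (≤-trans q (weak y (φ y) λ y≡x → true≢false (trans (Esym g z x) xz) (trans (cong (E z) (sym y≡x)) zy)))
        hits : ∀ u → (V u ∧ E u z) ∧ K u ((φ [ z ↦ β ]) u) z β ≡ true → (u ≡ x ⊎ u ≡ far) × K z β u (φ u) ≡ true
        hits u p = only u (∧-elimˡ (∧-elimˡ {V u ∧ E u z} p)) zu ,
          trans (Ksym z β u (φ u)) (subst (λ b → K u (if b then β else φ u) z β ≡ true) (==-≢ (E⇒≢ g zu ∘ sym)) (∧-elimʳ {V u ∧ E u z} p))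
          where zu = trans (Esym g z u) (∧-elimʳ {V u} (∧-elimˡ p))
        few : K z β x (φ x) ≡ false ⊎ K z β far (φ far) ≡ false → hit E V (φ [ z ↦ β ]) z β ≤ 1
        few (inj₁ ok) = count≤1 {p = λ u → (V u ∧ E u z) ∧ K u ((φ [ z ↦ β ]) u) z β} far λ u p → case hits u p of λ
          { (inj₁ refl , q) → true≢false q ok ; (inj₂ r , q) → r }
        few (inj₂ ok) = count≤1 {p = λ u → (V u ∧ E u z) ∧ K u ((φ [ z ↦ β ]) u) z β} x λ u p → case hits u p of λ
          { (inj₁ r , q) → r ; (inj₂ refl , q) → true≢false q ok }

      pushTol : Tol
      pushTol = lowerAt far (λ a → K z (avoid z x c) far a) tol

      hub-two : ∀ {b} a → 2 ≤ hubTol tol x c b z a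
      hub-two {b} a = subst (2 ≤_) (sym (hubTol-≢ tol c b a z≢x)) (tolerant a)

      push : ∀ {b} → Colourable E (V ∖ ｛ z ｝) (hubTol pushTol x c b) → Colourable E V (hubTol tol x c b)
      push {b} (φ , col) = φ [ z ↦ β ] , extend-φ {hubTol pushTol x c b} {hubTol tol x c b} β col near
          (λ y a y≢x → subst₂ _≤_ (sym (hubTol-≢ pushTol c b a y≢x)) (sym (hubTol-≢ tol c b a y≢x)) (lowerAt-≤ far βf tol y a))
          (hub-two {b}) (inj₁ free)
        where
        β = avoid z x c
        βf = λ a → K z β far a
        φx : φ x ≡ c
        φx = hubTol-colour {pushTol} {x} {c} {b} (col x (∈del {V} Vx (z≢x ∘ sym)))
        free : K z β x (φ x) ≡ false
        free = subst (λ a → K z β x a ≡ false) (sym φx) (avoids z x c)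
        near : ∀ y h → y ≢ z → y ≡ x ⊎ y ≡ far → h < hubTol pushTol x c b y (φ y) → h + (E z y ∧ K z β y (φ y) ▸ 1) < hubTol tol x c b y (φ y)
        near y h y≢z (inj₁ refl) q = +-▸-false h (trans (cong (E z x ∧_) free) (∧-zeroʳ (E z x)))
          (subst (h <_) (trans (cong (hubTol pushTol x c b x) φx) (trans (trans (hubTol-x pushTol x c b) (sym (hubTol-x tol x c b))) (cong (hubTol tol x c b x) (sym φx)))) q)
        near y h y≢z (inj₂ refl) q = subst₂ (λ e t → h + (e ▸ 1) < t)
          (cong₂ _∧_ (trans (==-refl far) (sym far-adj)) refl) (sym (hubTol-≢ tol c b (φ far) far≢))
          (lowerAt-hit far βf tol far (φ far) h (subst (h <_) (hubTol-≢ pushTol c b (φ far) far≢) q))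

      absorb : ∀ {b} → Colourable E (V ∖ ｛ z ｝) (hubTol tol x c b) → Colourable E V (hubTol tol x c (suc b))
      absorb {b} (φ , col) = φ [ z ↦ β ] , extend-φ {hubTol tol x c b} {hubTol tol x c (suc b)} β col near
          (λ y a y≢x → ≤-reflexive (trans (hubTol-≢ tol c b a y≢x) (sym (hubTol-≢ tol c (suc b) a y≢x))))
          (hub-two {suc b}) (inj₂ free)
        where
        β = avoid z far (φ far)
        φx : φ x ≡ c
        φx = hubTol-colour {tol} {x} {c} {b} (col x (∈del {V} Vx (z≢x ∘ sym)))
        free : K z β far (φ far) ≡ false
        free = avoids z far (φ far)
        near : ∀ y h → y ≢ z → y ≡ x ⊎ y ≡ far → h < hubTol tol x c b y (φ y) → h + (E z y ∧ K z β y (φ y) ▸ 1) < hubTol tol x c (suc b) y (φ y)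
        near y h y≢z (inj₁ refl) q = subst (h + (E z x ∧ K z β x (φ x) ▸ 1) <_)
          (sym (trans (cong (hubTol tol x c (suc b) x) φx) (hubTol-x tol x c (suc b))))
          (+-▸-≤ h _ (subst (h <_) (trans (cong (hubTol tol x c b x) φx) (hubTol-x tol x c b)) q))
        near y h y≢z (inj₂ refl) q = +-▸-false h (trans (cong (E z far ∧_) free) (∧-zeroʳ (E z far)))
          (subst (h <_) (trans (hubTol-≢ tol c b (φ far) far≢) (sym (hubTol-≢ tol c (suc b) (φ far) far≢))) q)

      shrink : ∀ {tol′} → (∀ v a → v ≢ far → tol′ v a ≡ tol v a) → (∀ w → V w ≡ true → E x w ≡ true → Link E V tol x w) →
        ∀ w → (V ∖ ｛ z ｝) w ≡ true → E x w ≡ true → Link E (V ∖ ｛ z ｝) tol′ x w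
      shrink same links w Ww xw = let open Link (links w (∧-elimˡ Ww) xw) renaming (far to far′; far∈ to far∈′; far-adj to far-adj′; far≢ to far≢′; far-off to far-off′; only to only′; tolerant to tolerant′) in record
        { tolerant = λ a → subst (2 ≤_) (sym (same w a λ q → true≢false xw (subst (λ v → E x v ≡ false) (sym q) far-off))) (tolerant′ a)
        ; far = far′ ; far∈ = ∈del {V} far∈′ (λ q → true≢false xz (subst (λ v → E x v ≡ false) q far-off′)) ; far-adj = far-adj′ ; far≢ = far≢′ ; far-off = far-off′
        ; only = λ y Wy → only′ y (∧-elimˡ Wy) }

      module Weights {b : ℕ} (bounded : Bounded tol) (slack : ∀ Y → Y ⊆ V → Slack E (hubWt tol x b) Y 1) where

        w = hubWt tol x b

        -- Adding z to such a set costs at least one unit, as z weighs at most `μ + 2k` against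
        -- `m + 2k` for itself and its two edges. So these sets can pay for either way of deleting
        -- z.
        slack-both : ∀ Y → Y ⊆ V ∖ ｛ z ｝ → Y x ≡ true → Y far ≡ true → Slack E w Y 2
        slack-both Y Y⊆ Yx Yf = ≤-cert _ (wsum w Y + m) 0
          (+-mono-≤ (slack-insert {E} {w} g {Y} z Yz (slack (｛ z ｝ ∪ Y) sub)) (+-mono-≤ (*-monoʳ-≤ k two) wz))
          (eq (cost E Y) μ k (deg E Y z) (w z) (wsum w Y))
          where
          Yz : Y z ≡ false
          Yz = ¬true⇒false λ p → ∈del⇒≢ {V} (Y⊆ z p) refl
          sub : ｛ z ｝ ∪ Y ⊆ V
          sub v p with ∨-elim {v == z} p
          ... | inj₁ q = subst (λ u → V u ≡ true) (sym (==-≡ v z q)) Vz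
          ... | inj₂ q = ∧-elimˡ (Y⊆ v q)
          two : 2 ≤ deg E Y z
          two = 2≤deg {E} {Y} {z} {x} {far} (far≢ ∘ sym) Yx Yf (trans (Esym g z x) xz) far-adj
          wz : w z ≤ k + (μ + k)
          wz = ≤-trans (≤-reflexive (hubWt-≢ tol b z≢x)) (+-mono-≤ (proj₁ (bounded z)) (proj₂ (bounded z)))
          eq : ∀ c μ k d wz wY → (c + 2) + (((wz + wY) + suc μ) + (k * d + (k + (μ + k)))) + 0 ≡ (wY + suc μ) + ((c + (suc μ + k * d) + 1) + (k * 2 + wz))
          eq = solve-∀

        PushFails : VSet n → Set
        PushFails Y = Y ⊆ V ∖ ｛ z ｝ × Y far ≡ true × Y x ≡ false × AtMost E w Y 1

        push-wt : ∀ v → w v ≤ hubWt pushTol x b v + ((v == far) ▸ 1)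
        push-wt v with v ≟F x
        ... | yes refl = m≤m+n (m + b) _
        ... | no v≢x = lowerAt-wt far {λ a → K z (avoid z x c) far a} one tol v
          where
          one : AtMostOne (λ a → K z (avoid z x c) far a)
          one p q = case Kmatch z (avoid z x c) far false true p q of λ ()

        push-slack : ¬ ∃ PushFails → ∀ Y → Y ⊆ V ∖ ｛ z ｝ → Slack E (hubWt pushTol x b) Y 1
        push-slack ok Y Y⊆ = slack-lower {E} {w} far {Y} push-wt lowered (λ _ → slack Y (λ v p → ∧-elimˡ (Y⊆ v p)))
          where
          lowered : Y far ≡ true → Slack E w Y 2
          lowered Yf with Y x in Yx
          ... | true = slack-both Y Y⊆ Yx Yf
          ... | false = ¬AtMost⇒Slack {E} {w} {Y} λ a → ok (Y , Y⊆ , Yf , Yx , a)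

      module Absorb {b : ℕ} (bounded : Bounded tol) (slack : ∀ Y → Y ⊆ V → Slack E (hubWt tol x b) Y 1)
        (Y₀ : VSet n) (fails : Weights.PushFails bounded slack Y₀) where
        open Weights bounded slack
        Y₀⊆ = proj₁ fails
        Y₀far = proj₁ (proj₂ fails)
        Y₀x = proj₁ (proj₂ (proj₂ fails))
        atMost = proj₂ (proj₂ (proj₂ fails))

        -- The set that obstructs pushing has slack at most one and contains `far`. With the hub
        -- added it has slack at least two by `slack-both`, although the hub contributes at most b.
        1≤b : 1 ≤ b
        1≤b = ≤-cert 1 b (k * deg E Y₀ x)
          (+-mono-≤ (slack-insert {E} {w} g {Y₀} x Y₀x (slack-both (｛ x ｝ ∪ Y₀) sub (∨-introˡ (==-refl x)) (∨-introʳ {far == x} Y₀far)))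
            (+-mono-≤ atMost (≤-reflexive (hubWt-x tol x b))))
          (eq (cost E Y₀) m k (deg E Y₀ x) (w x) (wsum w Y₀) b)
          where
          sub : ｛ x ｝ ∪ Y₀ ⊆ V ∖ ｛ z ｝
          sub v p with ∨-elim {v == x} p
          ... | inj₁ q = subst (λ u → (V ∖ ｛ z ｝) u ≡ true) (sym (==-≡ v x q)) (∈del {V} Vx (z≢x ∘ sym))
          ... | inj₂ q = Y₀⊆ v q
          eq : ∀ c m k d wx w₀ b → 1 + (((wx + w₀) + m) + ((c + 1) + (m + b))) + k * d ≡ b + ((c + (m + k * d) + 2) + ((w₀ + m) + wx))
          eq = solve-∀

        absorb-slack : ∀ {b′} → b ≡ suc b′ → ∀ Y → Y ⊆ V ∖ ｛ z ｝ → Slack E (hubWt tol x b′) Y 1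
        absorb-slack {b′} refl Y Y⊆ = slack-lower {E} {w} x {Y} lower lowered (λ _ → slack Y (λ v p → ∧-elimˡ (Y⊆ v p)))
          where
          lower : ∀ v → w v ≤ hubWt tol x b′ v + ((v == x) ▸ 1)
          lower v with v == x
          ... | true = ≤-reflexive (trans (+-suc m b′) (+-comm 1 (m + b′)))
          ... | false = m≤m+n _ 0
          lowered : Y x ≡ true → Slack E w Y 2
          lowered Yx with Y far in Yf
          ... | true = slack-both Y Y⊆ Yx Yf
          -- Submodularity against the obstruction: the union contains both x and `far` and has
          -- slack at least two, the intersection has at least one, and `Y₀` has at most one, which
          -- leaves at least two for Y.
          ... | false = ≤-cert _ (wsum w Y + m) 0
            (+-mono-≤ (+-mono-≤ (slack-both (Y ∪ Y₀) sub (∨-introˡ Yx) (∨-introʳ {Y far} Y₀far)) (slack (Y ∩ Y₀) (λ v p → ∧-elimˡ (Y⊆ v (∧-elimˡ p)))))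
              (+-mono-≤ (+-mono-≤ atMost (≤-reflexive (sym (wsum-modular w Y Y₀)))) (+-mono-≤ (≤-reflexive (cong (m *_) (wsum-modular (λ _ → 1) Y Y₀))) (*-monoʳ-≤ k (edges-supermodular E Y Y₀)))))
            (eq m k (size Y) (size Y₀) (size (Y ∪ Y₀)) (size (Y ∩ Y₀)) (edges E Y) (edges E Y₀) (edges E (Y ∪ Y₀)) (edges E (Y ∩ Y₀))
              (wsum w Y) (wsum w Y₀) (wsum w (Y ∪ Y₀)) (wsum w (Y ∩ Y₀)))
            where
            sub : Y ∪ Y₀ ⊆ V ∖ ｛ z ｝
            sub v p with ∨-elim {Y v} p
            ... | inj₁ q = Y⊆ v q
            ... | inj₂ q = Y₀⊆ v q
            eq : ∀ m k s s₀ s₁ s₂ e e₀ e₁ e₂ w w₀ w₁ w₂ →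
              ((m * s + k * e) + 2) + (((w₁ + m) + (w₂ + m)) + ((((m * s₀ + k * e₀) + 1) + (w + w₀)) + (m * (s₁ + s₂) + k * (e₁ + e₂)))) + 0
              ≡ (w + m) + ((((m * s₁ + k * e₁) + 2) + ((m * s₂ + k * e₂) + 1)) + (((w₀ + m) + (w₁ + w₂)) + (m * (s + s₀) + k * (e + e₀))))
            eq = solve-∀

    -- Each link is deleted by charging `far` if every set can afford it. A set that cannot is
    -- itself the evidence that the hub can absorb the conflict instead. After the last link the hub
    -- is isolated, and the remaining vertices are fewer than M.
    hub-colourable : ∀ M → Colours-smaller E M → ∀ N {V tol b} → Bounded tol → V x ≡ true → size V ≤ M → size V < N →
      (∀ Y → Y ⊆ V → Slack E (hubWt tol x b) Y 1) → (∀ z → V z ≡ true → E x z ≡ true → Link E V tol x z) →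
      Colourable E V (hubTol tol x c b)
    hub-colourable M smaller (suc N) {V} {tol} {b} bounded Vx ≤M (s≤s small) slack links
      with any? (λ z → (V z ≟B true) ×-dec (E x z ≟B true))
    ... | no none = isolated-hub {tol = tol} (smaller (V ∖ ｛ x ｝) tol bounded (≤-trans (size-del {V} x Vx) ≤M)
            λ Y Y⊆ → Slack-mono {E} {hubWt tol x b} {wt tol} {Y} (λ v Yv → ≤-reflexive (hubWt-≢ tol b (∈del⇒≢ {V} (Y⊆ v Yv)))) (slack Y λ v p → ∧-elimˡ (Y⊆ v p)))
          (λ z Vz → ¬true⇒false λ xz → none (z , Vz , xz))
    ... | yes (z , Vz , xz) = colourable-stable {tol = hubTol tol x c b} λ bad → ¬¬-em λ where
        (inj₂ ok) → bad (push (hub-colourable M smaller N {tol = pushTol} (lowerAt-bounded far (λ a → K z (avoid z x c) far a) {tol} bounded) Wx ≤M′ small′ (push-slack ok)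
          (shrink (λ v a v≢f → cong (λ e → if e ∧ K z (avoid z x c) far a then pred (tol v a) else tol v a) (==-≢ v≢f)) links)))
        (inj₁ (Y₀ , fails)) → bad (absorbing b refl (Absorb.1≤b bounded slack Y₀ fails) (Absorb.absorb-slack bounded slack Y₀ fails))
      where
      open Step {V} {tol} {z} Vx Vz xz (links z Vz xz)
      open Link (links z Vz xz) using (far)
      open Weights bounded slack
      Wx = ∈del {V} Vx (z≢x ∘ sym)
      ≤M′ = ≤-trans (size-mono (del-⊆ {V} z)) ≤M
      small′ = ≤-trans (size-del {V} z Vz) small
      absorbing : ∀ b₀ → b ≡ b₀ → 1 ≤ b₀ → (∀ {b′} → b ≡ suc b′ → ∀ Y → Y ⊆ V ∖ ｛ z ｝ → Slack E (hubWt tol x b′) Y 1) → Colourable E V (hubTol tol x c b)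
      absorbing (suc b′) refl _ sl = absorb (hub-colourable M smaller N bounded Wx ≤M′ small′ (sl refl) (shrink (λ _ _ _ → refl) links))

-- Minimal counterexamples

module Extension {n : ℕ} (K : Fin n → Bool → Fin n → Bool → Bool)
  (Ksym : ∀ u a v b → K u a v b ≡ K v b u a)
  (Kmatch : ∀ u a v b b′ → K u a v b ≡ true → K u a v b′ ≡ true → b ≡ b′)
  (k μ : ℕ) (4≤k : 4 ≤ k) (k≤μ : k ≤ μ) where

  open Hub K Ksym Kmatch k μ 4≤k k≤μ public

  poor rich : Tol → Fin n → ℕ
  poor tol v = tol v false
  rich tol v = tol v true ∸ μ

  rich≤k : ∀ {tol} → Bounded tol → ∀ v → rich tol v ≤ k
  rich≤k bounded v = m≤n+o⇒m∸n≤o _ μ (proj₂ (bounded v))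

  richTol-≤ : ∀ p r → p ≤ k → richTol p (r ∸ μ) ≤ r
  richTol-≤ p r p≤k with r ∸ μ in eq
  ... | zero = z≤n
  ... | suc d = ≤-trans (+-monoˡ-≤ (suc d) (≤-trans p≤k k≤μ))
    (≤-reflexive (trans (cong (μ +_) (sym eq)) (m+[n∸m]≡n (<⇒≤ (μ<r eq)))))
    where
    μ<r : ∀ {d} → r ∸ μ ≡ suc d → μ < r
    μ<r {d} e = ≰⇒> λ r≤μ → case trans (sym (m≤n⇒m∸n≡0 r≤μ)) e of λ ()

  budgetTol-≤ : ∀ {tol} → Bounded tol → ∀ v c → budgetTol (poor tol) (rich tol) v c ≤ tol v c
  budgetTol-≤ bounded v false = ≤-refl
  budgetTol-≤ {tol} bounded v true = richTol-≤ (tol v false) (tol v true) (proj₁ (bounded v))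

  -- Truncated subtraction in `rich` errs in the favourable direction: a rich tolerance below μ gets
  -- budget zero and not a negative one.
  wt≤budget : ∀ tol Y → wsum (wt tol) Y ≤ wsum (λ v → poor tol v + rich tol v) Y + μ * size Y
  wt≤budget tol Y = begin
    wsum (wt tol) Y
      ≤⟨ wsum-mono Y (λ v _ → ≤-trans (+-monoʳ-≤ (tol v false) (m≤n+m∸n (tol v true) μ)) (≤-reflexive (eq (tol v false) μ (rich tol v)))) ⟩
    wsum (λ v → (poor tol v + rich tol v) + μ) Y
      ≡⟨ wsum-+ (λ v → poor tol v + rich tol v) (λ _ → μ) Y ⟩
    wsum (λ v → poor tol v + rich tol v) Y + wsum (λ _ → μ) Y
      ≡⟨ cong (wsum (λ v → poor tol v + rich tol v) Y +_) (wsum-const μ Y) ⟩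
    wsum (λ v → poor tol v + rich tol v) Y + μ * size Y ∎
    where
    open ≤-Reasoning
    eq : ∀ p μ d → p + (μ + d) ≡ (p + d) + μ
    eq = solve-∀

  -- Passing to budgets removes μ per vertex from both sides. Of `m = suc μ` one unit per vertex is
  -- left, which is the `size Y` of `Sparse`.
  to-budget : ∀ tol Y {c p q} → m * size Y + c + p ≤ wsum (wt tol) Y + q →
    size Y + c + p ≤ wsum (λ v → poor tol v + rich tol v) Y + q
  to-budget tol Y {c} {p} {q} h = ≤-cert _ (wsum (λ v → poor tol v + rich tol v) Y + q) 0 (+-mono-≤ h (wt≤budget tol Y))
    (eq μ (size Y) c p q (wsum (wt tol) Y) (wsum (λ v → poor tol v + rich tol v) Y))
    where
    eq : ∀ μ s c p q w b → (s + c + p) + ((w + q) + (b + μ * s)) + 0 ≡ (b + q) + ((suc μ * s + c + p) + w)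
    eq = solve-∀

  extend-sparse : ∀ {E} → IsGraph E → ∀ {V X tol φ P D} → Col E X tol φ → (∀ v → P v ≤ k) → (∀ v → D v ≤ k) →
    (∀ Y → Y ⊆ V ∖ X → size Y + k * edges E Y + k * wsum (deg E X) Y ≤ wsum (λ v → P v + D v) Y) →
    ∃ λ ψ → Col E V (glueTol X tol (budgetTol P D)) ψ × (∀ v → X v ≡ true → ψ v ≡ φ v)
  extend-sparse {E} g {V} {X} {tol} {φ} {P} {D} col P≤k D≤k sparse = extend g {k} {V} {X} {tol} {φ} {P} {D} col P≤k D≤k sparse
    (λ P′ D′ → sparse-colourable _ g (V ∖ X) P′ D′ ≤-refl)

  -- The number p says that Y ∪ X has at least the slack of X.
  extend-colouring : ∀ {E} → IsGraph E → ∀ {V X tol} → Bounded tol → Colourable E X tol →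
    (∀ Y → Y ⊆ V ∖ X → (∃ λ y → Y y ≡ true) → ∃ λ p → Slack E (wt tol) (Y ∪ X) p × AtMost E (wt tol) X p) → Colourable E V tol
  extend-colouring {E} g {V} {X} {tol} bounded (φ , col) slack =
    let ψ , col′ , _ = extend-sparse g {V} {X} {tol} {φ} {poor tol} {rich tol} col (λ v → proj₁ (bounded v)) (rich≤k {tol} bounded) sparse
    in ψ , glueTol-idem {X = X} {tol} (Col-weaken {tol = glueTol X tol (budgetTol (poor tol) (rich tol))} {glueTol X tol tol} weaker col′)
    where
    weaker : ∀ v c → V v ≡ true → glueTol X tol (budgetTol (poor tol) (rich tol)) v c ≤ glueTol X tol tol v c
    weaker v c _ with X v
    ... | true = ≤-refl
    ... | false = budgetTol-≤ {tol} bounded v c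
    sparse : ∀ Y → Y ⊆ V ∖ X → size Y + k * edges E Y + k * wsum (deg E X) Y ≤ wsum (λ v → poor tol v + rich tol v) Y
    sparse Y Y⊆ with any? (λ y → Y y ≟B true)
    ... | yes inhabited = let p , s , a = slack Y Y⊆ inhabited in +-cancelʳ-≤ p _ _
      (subst (λ t → t + p ≤ wsum (λ v → poor tol v + rich tol v) Y + p) (sym (+-assoc (size Y) _ _))
        (to-budget tol Y (subst (λ t → t + p ≤ wsum (wt tol) Y + p) (+-assoc (m * size Y) _ _) (outer {E} {wt tol} g (∖-disjoint {V} Y⊆) s a))))
    ... | no empty = ≤-trans (≤-reflexive (trans (cong₂ _+_ (cong₂ (λ s e → s + k * e) (wsum-∅ (λ _ → 1)) (sumF-zero λ u → sumF-zero λ v → cong (λ b → (b ∧ Y v) ∧ (E u v ∧ (toℕ u <ᵇ toℕ v)) ▸ 1) (off u)))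
          (cong (k *_) (wsum-∅ (deg E X)))) (trans (cong₂ _+_ (*-zeroʳ k) (*-zeroʳ k)) refl))) z≤n
      where
      off : ∀ v → Y v ≡ false
      off v = ¬true⇒false λ p → empty (v , p)
      wsum-∅ : ∀ f → wsum f Y ≡ 0
      wsum-∅ f = sumF-zero λ v → cong (_▸ f v) (off v)

  proper-or-all : ∀ (V Z : VSet n) → (∃ λ y → (V ∖ Z) y ≡ true) ⊎ V ⊆ Z
  proper-or-all V Z with any? (λ y → (V ∖ Z) y ≟B true)
  ... | yes p = inj₁ p
  ... | no none = inj₂ λ v Vv → sub v Vv (Z v) refl
    where
    sub : ∀ v → V v ≡ true → ∀ b → Z v ≡ b → b ≡ true
    sub v Vv true _ = refl
    sub v Vv false q = ⊥-elim (none (v , ∧-intro Vv (cong not q)))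

  ⊆-antisym : ∀ {X Y : VSet n} → X ⊆ Y → Y ⊆ X → X ≐ Y
  ⊆-antisym {X} {Y} h₁ h₂ v with X v in p | Y v in q
  ... | true | true = refl
  ... | false | false = refl
  ... | true | false = trans (sym (h₁ v p)) q
  ... | false | true = trans (sym p) (h₂ v q)

  cost-remove : ∀ {E} → IsGraph E → ∀ {a b} → E a b ≡ true → ∀ Y → cost (remove E a b) Y + k * (Y a ∧ Y b ▸ 1) ≤ cost E Y
  cost-remove {E} g {a} {b} ab Y = ≤-trans (≤-reflexive (eq (m * size Y) k (edges (remove E a b) Y) (Y a ∧ Y b ▸ 1)))
    (+-monoʳ-≤ (m * size Y) (*-monoʳ-≤ k (edges-remove g ab Y)))
    where
    eq : ∀ s k e c → (s + k * e) + k * c ≡ s + k * (e + c)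
    eq = solve-∀

  AtMost-insert : ∀ {E w} → IsGraph E → ∀ {X} z {q} → X z ≡ false → AtMost E w (｛ z ｝ ∪ X) q →
    (w z + wsum w X) + m ≤ cost E X + (m + k * deg E X z) + q
  AtMost-insert {E} {w} g {X} z {q} Xz = subst₂ _≤_ (cong (_+ m) (wsum-insert w {X} z Xz)) (cong (_+ q) (cost-insert g {X} z Xz))

  AtMost-≐ : ∀ {E w X Y q} → X ≐ Y → AtMost E w X q → AtMost E w Y q
  AtMost-≐ {E} {w} {q = q} h = subst₂ _≤_ (cong (_+ m) (wsum-≐ w h)) (cong (_+ q) (cost-≐ E h))

  module Minimal {E : Edges n} (g : IsGraph E) (V : VSet n) (tol : Tol) (bounded : Bounded tol)
    (smaller : ∀ {E′} → IsGraph E′ → ∀ V′ tol′ → Bounded tol′ → size V′ + edges E′ full < size V + edges E full →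
      (∀ Y → Y ⊆ V′ → Slack E′ (wt tol′) Y 1) → Colourable E′ V′ tol′)
    (slack : ∀ Y → Y ⊆ V → Slack E (wt tol) Y 1) (none : ¬ Colourable E V tol) where

    w : Fin n → ℕ
    w = wt tol

    smaller-V : ∀ V′ tol′ → Bounded tol′ → size V′ < size V → (∀ Y → Y ⊆ V′ → Slack E (wt tol′) Y 1) → Colourable E V′ tol′
    smaller-V V′ tol′ b lt = smaller g V′ tol′ b (+-monoˡ-≤ (edges E full) lt)

    proper-size : ∀ {X y} → X ⊆ V → (V ∖ X) y ≡ true → size X < size V
    proper-size {X} {y} X⊆V Wy = size-strict y X⊆V (not-true (∧-elimʳ {V y} Wy)) (∧-elimˡ Wy)

    -- A set of slack one has the least slack possible. No set containing it has less, so its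
    -- colouring, supplied by minimality, would extend to V.
    proper-slack : ∀ {X x y} → X ⊆ V → X x ≡ true → (V ∖ X) y ≡ true → Slack E w X 2
    proper-slack {X} {x} {y} X⊆V Xx Wy = ¬AtMost⇒Slack {E} {w} {X} λ a → none
      (extend-colouring g {V} {X} {tol} bounded (smaller-V X tol bounded (proper-size X⊆V Wy) (λ Y Y⊆ → slack Y (λ v p → X⊆V v (Y⊆ v p))))
        (λ Y Y⊆ _ → 1 , slack (Y ∪ X) (∪-⊆ {V} {X} Y⊆ X⊆V) , a))

    -- By `proper-slack` the value two is now least among proper nonempty sets, so only V itself can
    -- obstruct the extension of a colouring of X.
    whole : ∀ {X x y} → X ⊆ V → X x ≡ true → (V ∖ X) y ≡ true → AtMost E w X 2 → AtMost E w V 1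
    whole {X} {x} {y} X⊆V Xx Wy a = ¬Slack⇒AtMost {E} {w} {V} λ s → none
      (extend-colouring g {V} {X} {tol} bounded (smaller-V X tol bounded (proper-size X⊆V Wy) (λ Y Y⊆ → slack Y (λ v p → X⊆V v (Y⊆ v p))))
        (λ Y Y⊆ _ → 2 , larger s Y Y⊆ , a))
      where
      larger : Slack E w V 2 → ∀ Y → Y ⊆ V ∖ X → Slack E w (Y ∪ X) 2
      larger s Y Y⊆ with proper-or-all V (Y ∪ X)
      ... | inj₁ (y , Wy) = proper-slack {Y ∪ X} {x} {y} (∪-⊆ {V} {X} Y⊆ X⊆V) (∨-introʳ {Y x} Xx) Wy
      ... | inj₂ V⊆ = Slack-≐ {E} {w} (⊆-antisym V⊆ (∪-⊆ {V} {X} Y⊆ X⊆V)) s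

    -- Vertices whose removal leaves slack at most two

    -- Not to be confused with criticality of graphs. Since V has slack at least one, such a vertex
    -- together with its edges contributes at least -1, so it is heavy for its degree.
    Critical-vertex : Fin n → Set
    Critical-vertex z = V z ≡ true × AtMost E w (V ∖ ｛ z ｝) 2

    critical? : ∀ z → Dec (Critical-vertex z)
    critical? z = (V z ≟B true) ×-dec (_ ≤? _)

    critical-deg : ∀ {z} → Critical-vertex z → m + k * deg E (V ∖ ｛ z ｝) z ≤ w z + 1
    critical-deg {z} (Vz , a) = ≤-cert _ (w z + 1) 0
      (+-mono-≤ (slack-insert {E} {w} g {V ∖ ｛ z ｝} z (∉del V z) (Slack-≐ {E} {w} (λ v → sym (del-insert {V} z Vz v)) (slack V (λ _ p → p)))) a)
      (eq (cost E (V ∖ ｛ z ｝)) m k (deg E (V ∖ ｛ z ｝) z) (w z) (wsum w (V ∖ ｛ z ｝)))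
      where
      eq : ∀ c m k d wz wX → (m + k * d) + (((wz + wX) + m) + (c + 2)) + 0 ≡ (wz + 1) + ((c + (m + k * d) + 1) + (wX + m))
      eq = solve-∀

    -- With all its edges z′ contributes at least -1, hence at least k - 1 after the edge to z is
    -- gone. Then V without z would have slack at least 1 + (k - 1) = k ≥ 4, more than two.
    critical-independent : ∀ {z z′} → Critical-vertex z → Critical-vertex z′ → E z z′ ≡ true → ⊥
    critical-independent {z} {z′} (Vz , a) c′@(Vz′ , _) zz′ = <⇒≱ 4≤k (≤-trans (≤-cert k 2 0
      (+-mono-≤ (AtMost-insert {E} {w} g {U} z′ (∉del (V ∖ ｛ z ｝) z′) (AtMost-≐ {E} {w} (λ v → sym (del-insert {V ∖ ｛ z ｝} z′ V∖z∋z′ v)) a))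
        (+-mono-≤ (slack U (λ v p → ∧-elimˡ (∧-elimˡ p))) (+-mono-≤ (critical-deg c′) (*-monoʳ-≤ k one-more))))
      (eq (cost E U) m k (deg E U z′) (deg E (V ∖ ｛ z′ ｝) z′) (w z′) (wsum w U))) (s≤s (s≤s z≤n)))
      where
      U = V ∖ ｛ z ｝ ∖ ｛ z′ ｝
      V∖z∋z′ = ∈del {V} Vz′ (E⇒≢ g zz′ ∘ sym)
      z′z = trans (Esym g z′ z) zz′
      one-more : suc (deg E U z′) ≤ deg E (V ∖ ｛ z′ ｝) z′
      one-more = size-strict {X = λ v → U v ∧ E z′ v} {λ v → (V ∖ ｛ z′ ｝) v ∧ E z′ v} z
        (λ v p → ∧-intro (∈del {V} (∧-elimˡ (∧-elimˡ (∧-elimˡ {U v} p))) (∈del⇒≢ {V ∖ ｛ z ｝} (∧-elimˡ {U v} p))) (∧-elimʳ {U v} p))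
        (cong (_∧ E z′ z) (cong (_∧ not (z == z′)) (∉del V z)))
        (∧-intro (∈del {V} Vz (E⇒≢ g zz′)) z′z)
      eq : ∀ c m k d d′ wz wU → k + ((c + (m + k * d) + 2) + ((wU + m) + ((wz + 1) + k * d′))) + 0
        ≡ 2 + (((wz + wU) + m) + ((c + 1) + ((m + k * d′) + k * suc d)))
      eq = solve-∀

    -- The weight of z forces its rich tolerance to be at least `μ ≥ 2`, so rich survives the one
    -- conflict that z can receive. Then z can be deleted, with x lowered in the colour that
    -- conflicts with rich z; `proper-slack` pays for this.
    critical-leaf : ∀ {x z} → Critical-vertex z → V x ≡ true → E x z ≡ true → (∀ y → V y ≡ true → E z y ≡ true → y ≡ x) → ⊥
    critical-leaf {x} {z} crit@(Vz , _) Vx xz only =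
      finish (smaller-V (V ∖ ｛ z ｝) tol′ (lowerAt-bounded x β {tol} bounded) (size-del {V} z Vz) slack′)
      where
      x≢z = E⇒≢ g xz
      zx = trans (Esym g z x) xz
      β = λ c → K x c z true
      tol′ = lowerAt x β tol
      slack′ : ∀ Y → Y ⊆ V ∖ ｛ z ｝ → Slack E (wt tol′) Y 1
      slack′ Y Y⊆ = slack-lower {E} {w} {wt tol′} x {Y} (lowerAt-wt x {β} (atMostOne x z true) tol)
        (λ Yx → proper-slack {Y} {x} {z} Y⊆V Yx (∧-intro Vz (cong not (¬true⇒false λ p → ∈del⇒≢ {V} (Y⊆ z p) refl))))
        (λ _ → slack Y Y⊆V)
        where Y⊆V = λ v p → ∧-elimˡ (Y⊆ v p)
      2≤rich : 2 ≤ tol z true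
      2≤rich = ≤-trans (s≤s (s≤s z≤n)) (≤-trans 4≤k (≤-trans k≤μ (≤-cert μ (tol z true) 0
        (+-mono-≤ (critical-deg crit) (+-mono-≤ (proj₁ (bounded z)) (*-monoʳ-≤ k (count-pos {p = λ v → (V ∖ ｛ z ｝) v ∧ E z v} x (∧-intro (∈del {V} Vx x≢z) zx)))))
        (eq μ k (deg E (V ∖ ｛ z ｝) z) (tol z false) (tol z true)))))
        where
        eq : ∀ μ k d p r → μ + (((p + r) + 1) + (k + k * d)) + 0 ≡ r + ((suc μ + k * d) + (p + k * 1))
        eq = solve-∀
      finish : ¬ Colourable E (V ∖ ｛ z ｝) tol′
      finish (φ , col) = none (φ [ z ↦ true ] , add-vertex {tol = tol} {tol′} z true col old
        (≤-trans (s≤s (count≤1 {p = λ u → (V u ∧ E u z) ∧ K u ((φ [ z ↦ true ]) u) z true} x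
          λ u p → only u (∧-elimˡ (∧-elimˡ {V u ∧ E u z} p)) (trans (Esym g z u) (∧-elimʳ {V u} (∧-elimˡ p))))) 2≤rich))
        where
        old : ∀ y h → V y ≡ true → y ≢ z → h < tol′ y (φ y) → h + (E z y ∧ K z true y (φ y) ▸ 1) < tol y (φ y)
        old y h Vy y≢z q with E z y in zy
        ... | false = +-▸-false h refl (≤-trans q (lowerAt-≤ x β tol y (φ y)))
        ... | true with only y Vy zy
        ...   | refl = subst (λ b → h + (b ▸ 1) < tol x (φ x)) (cong₂ _∧_ (==-refl x) (Ksym x (φ x) z true)) (lowerAt-hit x β tol x (φ x) h q)

    -- A critical vertex weighs at most `μ + 2k`, which `critical-deg` turns into degree at most
    -- two. At degree two almost the whole weight is required, so both tolerances are at least k.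
    -- Degree one is excluded by `critical-leaf`, and independence of critical vertices gives
    -- `far-off`.
    critical-link : ∀ {x} → V x ≡ true → (∀ y → V y ≡ true → E x y ≡ true → Critical-vertex y) →
      ∀ z → V z ≡ true → E x z ≡ true → Link E V tol x z
    critical-link {x} Vx allCritical z Vz xz with any? (λ v → (V v ≟B true) ×-dec ((E z v ≟B true) ×-dec ¬? (v ≟F x)))
    ... | no nofar = ⊥-elim (critical-leaf crit Vx xz only)
      where
      crit = allCritical z Vz xz
      only : ∀ y → V y ≡ true → E z y ≡ true → y ≡ x
      only y Vy zy with y ≟F x
      ... | yes p = p
      ... | no y≢x = ⊥-elim (nofar (y , Vy , zy , y≢x))
    ... | yes (v , Vv , zv , v≢x) = record
      { tolerant = tolerant ; far = v ; far∈ = Vv ; far-adj = zv ; far≢ = v≢x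
      ; far-off = ¬true⇒false (λ xv → critical-independent crit (allCritical v Vv xv) zv) ; only = only }
      where
      crit = allCritical z Vz xz
      zx = trans (Esym g z x) xz
      d = deg E (V ∖ ｛ z ｝) z
      x∈ = ∈del {V} Vx (E⇒≢ g xz)
      v∈ = ∈del {V} Vv (E⇒≢ g zv ∘ sym)
      2≤d : 2 ≤ d
      2≤d = 2≤deg {E} {V ∖ ｛ z ｝} {z} (v≢x ∘ sym) x∈ v∈ zx zv
      2≤k′ : ∀ {a} → k ≤ a → 2 ≤ a
      2≤k′ = ≤-trans 2≤k
      tolerant : ∀ c → 2 ≤ tol z c
      tolerant false = 2≤k′ (≤-cert k (tol z false) 0 (+-mono-≤ (critical-deg crit) (+-mono-≤ (proj₂ (bounded z)) (*-monoʳ-≤ k 2≤d)))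
        (eq μ k d (tol z false) (tol z true)))
        where
        eq : ∀ μ k d p r → k + (((p + r) + 1) + ((μ + k) + k * d)) + 0 ≡ p + ((suc μ + k * d) + (r + k * 2))
        eq = solve-∀
      tolerant true = 2≤k′ (≤-cert k (tol z true) μ (+-mono-≤ (critical-deg crit) (+-mono-≤ (proj₁ (bounded z)) (*-monoʳ-≤ k 2≤d)))
        (eq μ k d (tol z false) (tol z true)))
        where
        eq : ∀ μ k d p r → k + (((p + r) + 1) + (k + k * d)) + μ ≡ r + ((suc μ + k * d) + (p + k * 2))
        eq = solve-∀
      only : ∀ y → V y ≡ true → E z y ≡ true → y ≡ x ⊎ y ≡ v
      only y Vy zy with y ≟F x | y ≟F v
      ... | yes p | _ = inj₁ p
      ... | no _ | yes p = inj₂ p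
      ... | no y≢x | no y≢v = ⊥-elim (<⇒≱ 4≤k (≤-trans (≤-cert k 0 0
        (+-mono-≤ (critical-deg crit) (+-mono-≤ (+-mono-≤ (proj₁ (bounded z)) (proj₂ (bounded z))) (*-monoʳ-≤ k 3≤d)))
        (eq μ k d (tol z false) (tol z true))) z≤n))
        where
        3≤d : 3 ≤ d
        3≤d = ≤-trans (≤-reflexive (sym (cong₂ (λ a b → (a ▸ 1) + b) (∧-intro x∈ zx)
            (cong₂ (λ a b → (a ▸ 1) + (b ▸ 1)) (∧-intro v∈ zv) (∧-intro (∈del {V} Vy (E⇒≢ g zy ∘ sym)) zy)))))
          (three-terms≤sumF (λ u → (V ∖ ｛ z ｝) u ∧ E z u ▸ 1) (v≢x ∘ sym) (y≢x ∘ sym) (y≢v ∘ sym))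
        eq : ∀ μ k d p r → k + (((p + r) + 1) + ((k + (μ + k)) + k * d)) + 0 ≡ 0 + ((suc μ + k * d) + ((p + r) + k * 3))
        eq = solve-∀

    singleton : ∀ {x} → V x ≡ true → 1 ≤ w x
    singleton {x} Vx = ≤-cert 1 (w x) 0 (subst₂ _≤_ (cong₂ (λ s e → m * s + k * e + 1) (wsum-｛｝ (λ _ → 1) x) (edges-｛｝ g x)) (cong (_+ m) (wsum-｛｝ w x))
      (slack ｛ x ｝ λ u p → subst (λ z → V z ≡ true) (sym (==-≡ u x p)) Vx)) (eq m k (w x))
      where
      eq : ∀ m k wx → 1 + (wx + m) + 0 ≡ wx + (m * 1 + k * 0 + 1)
      eq = solve-∀

    -- The vertex x is committed to rich if rich is permitted and to poor otherwise. The tolerance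
    -- given up is at most `k ≤ μ` in the one case and zero in the other, so `hubWt` is no smaller
    -- than the weight of x and no slack is lost.
    no-hub : ∀ {x} → V x ≡ true → (∀ y → V y ≡ true → E x y ≡ true → Critical-vertex y) → ⊥
    no-hub {x} Vx allCritical = choose (tol x true) (tol x false) refl refl
      where
      commit : ∀ c b → tol x c ≡ suc b → tol x (not c) ≤ μ → ⊥
      commit c b c≡ other = none (weaker (hub-colourable g x c (size V) (λ V′ tol′ bd lt → smaller-V V′ tol′ bd lt) (suc (size V)) {V} {tol} {b}
          bounded Vx ≤-refl ≤-refl (λ Y Y⊆ → Slack-mono {E} {w} {hubWt tol x b} {Y} (λ v _ → heavier v) (slack Y Y⊆)) (critical-link Vx allCritical)))
        where
        two-colours : ∀ c → tol x c ≡ suc b → tol x (not c) ≤ μ → w x ≤ m + b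
        two-colours true c≡ o = ≤-trans (+-mono-≤ o (≤-reflexive c≡)) (≤-reflexive (+-suc μ b))
        two-colours false c≡ o = ≤-trans (+-mono-≤ (≤-reflexive c≡) o) (≤-reflexive (cong suc (+-comm b μ)))
        heavier : ∀ v → w v ≤ hubWt tol x b v
        heavier v with v ≟F x
        ... | no _ = ≤-refl
        ... | yes refl = two-colours c c≡ other
        hubTol-≤ : ∀ v a → V v ≡ true → hubTol tol x c b v a ≤ tol v a
        hubTol-≤ v a _ with v ≟F x | a ≟B c
        ... | no _ | _ = ≤-refl
        ... | yes refl | yes refl = ≤-reflexive (sym c≡)
        ... | yes refl | no _ = z≤n
        weaker : Colourable E V (hubTol tol x c b) → Colourable E V tol
        weaker (φ , col) = φ , Col-weaken {tol = hubTol tol x c b} {tol} hubTol-≤ col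
      choose : ∀ r p → tol x true ≡ r → tol x false ≡ p → ⊥
      choose (suc b) p r≡ p≡ = commit true b r≡ (≤-trans (proj₁ (bounded x)) k≤μ)
      choose zero (suc b) r≡ p≡ = commit false b p≡ (subst (_≤ μ) (sym r≡) z≤n)
      choose zero zero r≡ p≡ = <⇒≢ (singleton Vx) (sym (cong₂ _+_ p≡ r≡))

    -- Sets of slack two

    -- Two vertices must be missing, so that the set remains proper after any one vertex is added.
    -- Sets missing a single vertex are treated through critical vertices.
    Good : VSet n → Set
    Good X = X ⊆ V × (∃ λ x → X x ≡ true) × AtMost E w X 2 ×
      ∃ λ a → ∃ λ b → a ≢ b × (V ∖ X) a ≡ true × (V ∖ X) b ≡ true

    -- If the slack were at most two, Y would miss either another vertex besides y, and be good, or
    -- y alone, and y would be critical.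
    slack-unless-good : ∀ {Y x y} → Y ⊆ V → Y x ≡ true → (V ∖ Y) y ≡ true → ¬ Critical-vertex y → ¬ Good Y → Slack E w Y 3
    slack-unless-good {Y} {x} {y} Y⊆V Yx Wy ¬cy ¬good = ¬AtMost⇒Slack {E} {w} {Y} absurd
      where
      absurd : ¬ AtMost E w Y 2
      absurd a with any? (λ b → ((V ∖ Y) b ≟B true) ×-dec ¬? (b ≟F y))
      ... | yes (b , Wb , b≢y) = ¬good (Y⊆V , (x , Yx) , a , b , y , b≢y , Wb , Wy)
      ... | no only = ¬cy (∧-elimˡ Wy , AtMost-≐ {E} {w} (⊆-antisym inside outside) a)
        where
        inside : Y ⊆ V ∖ ｛ y ｝
        inside v p = ∈del {V} (Y⊆V v p) λ { refl → true≢false p (not-true (∧-elimʳ {V y} Wy)) }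
        outside : V ∖ ｛ y ｝ ⊆ Y
        outside v p with Y v in q
        ... | true = refl
        ... | false = ⊥-elim (only (v , ∧-intro (∧-elimˡ p) (cong not q) , ∈del⇒≢ {V} p))

    module Outside (X : VSet n) (good : Good X)
      (maximal : ∀ X′ → Good X′ → X ⊆ X′ → ∀ u → X′ u ≡ true → X u ≡ false → ⊥) where

      X⊆V = proj₁ good
      x₀ = proj₁ (proj₁ (proj₂ good))
      Xx₀ = proj₂ (proj₁ (proj₂ good))
      low = proj₁ (proj₂ (proj₂ good))
      y₁ = proj₁ (proj₂ (proj₂ (proj₂ good)))
      y₂ = proj₁ (proj₂ (proj₂ (proj₂ (proj₂ good))))
      y₁≢y₂ = proj₁ (proj₂ (proj₂ (proj₂ (proj₂ (proj₂ good)))))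
      Wy₁ = proj₁ (proj₂ (proj₂ (proj₂ (proj₂ (proj₂ (proj₂ good))))))
      Wy₂ = proj₂ (proj₂ (proj₂ (proj₂ (proj₂ (proj₂ (proj₂ good))))))

      W : VSet n
      W = V ∖ X

      W⇒∉X : ∀ {v} → W v ≡ true → X v ≡ false
      W⇒∉X {v} p = not-true (∧-elimʳ {V v} p)

      W⇒V : ∀ {v} → W v ≡ true → V v ≡ true
      W⇒V p = ∧-elimˡ p

      X≢W : ∀ {u v} → X u ≡ true → W v ≡ true → u ≢ v
      X≢W Xu Wv refl = true≢false Xu (W⇒∉X Wv)

      missing : ∀ {Y y} → W y ≡ true → Y y ≡ false → (V ∖ (Y ∪ X)) y ≡ true
      missing {Y} {y} Wy Yy = ∧-intro (W⇒V Wy) (cong not (cong₂ _∨_ Yy (W⇒∉X Wy)))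

      slack₂ : ∀ {Y y} → Y ⊆ W → W y ≡ true → Y y ≡ false → Slack E w (Y ∪ X) 2
      slack₂ {Y} {y} Y⊆ Wy Yy = proper-slack {Y ∪ X} {x₀} {y} (∪-⊆ {V} {X} Y⊆ X⊆V) (∨-introʳ {Y x₀} Xx₀) (missing {Y} Wy Yy)

      slack₃ : ∀ {Y u y} → Y ⊆ W → Y u ≡ true → W y ≡ true → Y y ≡ false → ¬ Critical-vertex y → Slack E w (Y ∪ X) 3
      slack₃ {Y} {u} {y} Y⊆ Yu Wy Yy ¬cy = slack-unless-good {Y ∪ X} {x₀} sub (∨-introʳ {Y x₀} Xx₀) (missing {Y} Wy Yy) ¬cy
        λ good′ → maximal (Y ∪ X) good′ (λ v p → ∨-introʳ {Y v} p) u (∨-introˡ Yu) (W⇒∉X (Y⊆ u Yu))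
        where sub = ∪-⊆ {V} {X} Y⊆ X⊆V

      -- If all neighbours of v lay in X, then v would contribute equally to X and to V without v.
      -- The first contribution is not negative, taking slack at most two to at least two; the
      -- second is negative, taking at least two to at most one by `whole`.
      neighbour : ∀ v → W v ≡ true → ∃ λ y → W y ≡ true × E v y ≡ true
      neighbour v Wv with any? (λ y → (W y ≟B true) ×-dec (E v y ≟B true))
      ... | yes p = p
      ... | no alone = ⊥-elim (≰-cert 0 (+-mono-≤
          (+-mono-≤ (slack-insert {E} {w} g {X} v (W⇒∉X Wv) (slack₂ {｛ v ｝} {proj₁ other} (λ u p → subst (λ z → W z ≡ true) (sym (==-≡ u v p)) Wv) (proj₁ (proj₂ other)) (==-≢ (proj₂ (proj₂ other))))) low)
          (+-mono-≤ (+-mono-≤ (AtMost-insert {E} {w} g {V ∖ ｛ v ｝} v (∉del V v) (AtMost-≐ {E} {w} (λ u → sym (del-insert {V} v (W⇒V Wv) u)) (whole X⊆V Xx₀ Wy₁ low)))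
              (proper-slack {V ∖ ｛ v ｝} {x₀} {v} (del-⊆ {V} v) (∈del {V} (X⊆V x₀ Xx₀) (X≢W Xx₀ Wv)) (∧-intro (W⇒V Wv) (cong not (∉del V v)))))
            (*-monoʳ-≤ k fewer)))
          (eq (cost E X) (cost E (V ∖ ｛ v ｝)) m k (deg E X v) (deg E (V ∖ ｛ v ｝) v) (w v) (wsum w X) (wsum w (V ∖ ｛ v ｝))))
        where
        other : ∃ λ y → W y ≡ true × y ≢ v
        other with y₁ ≟F v
        ... | no p = y₁ , Wy₁ , p
        ... | yes refl = y₂ , Wy₂ , y₁≢y₂ ∘ sym
        fewer : deg E (V ∖ ｛ v ｝) v ≤ deg E X v
        fewer = count-mono {p = λ u → (V ∖ ｛ v ｝) u ∧ E v u} {λ u → X u ∧ E v u} imp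
          where
          imp : ∀ u → (V ∖ ｛ v ｝) u ∧ E v u ≡ true → X u ∧ E v u ≡ true
          imp u p with X u in Xu
          ... | true = ∧-elimʳ {(V ∖ ｛ v ｝) u} p
          ... | false = ⊥-elim (alone (u , ∧-intro (∧-elimˡ (∧-elimˡ {(V ∖ ｛ v ｝) u} p)) (cong not Xu) , ∧-elimʳ {(V ∖ ｛ v ｝) u} p))
        eq : ∀ c c′ m k d d′ wv wX wV →
          (((c + (m + k * d)) + 2) + (wX + m)) + ((((wv + wV) + m) + (c′ + 2)) + k * d′)
          ≡ ((((wv + wX) + m) + (c + 2)) + (((c′ + (m + k * d′) + 1) + (wV + m)) + k * d)) + suc 0
        eq = solve-∀

      boundary : Edges n → VSet n → ℕ
      boundary E′ Y = edges E′ Y + wsum (deg E′ X) Y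

      P₀ D₀ : Fin n → ℕ
      P₀ = poor tol
      D₀ = rich tol

      -- The account of a set Y outside X: p is a slack of `Y ∪ X`, c counts deleted edges inside Y
      -- or between Y and X, and l bounds the budget given up in Y. The constant 2 is the bound on
      -- the slack of X.
      Extends : Edges n → (Fin n → ℕ) → (Fin n → ℕ) → VSet n → Set
      Extends E′ P D Y = ∃ λ p → ∃ λ c → ∃ λ l → Slack E w (Y ∪ X) p × boundary E′ Y + c ≤ boundary E Y ×
        wsum (λ v → P₀ v + D₀ v) Y ≤ wsum (λ v → P v + D v) Y + l × l + 2 ≤ k * c + p

      extend-budgets : ∀ {E′} → IsGraph E′ → ∀ {tol′ φ P D} → Col E′ X tol′ φ → (∀ v → P v ≤ k) → (∀ v → D v ≤ k) →
        (∀ Y → Y ⊆ W → Extends E′ P D Y) → ∃ λ ψ → Col E′ V (glueTol X tol′ (budgetTol P D)) ψ × (∀ v → X v ≡ true → ψ v ≡ φ v)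
      extend-budgets {E′} g′ {tol′} {φ} {P} {D} col P≤k D≤k ext = extend-sparse g′ {V} {X} {tol′} {φ} {P} {D} col P≤k D≤k sparse
        where
        sparse : ∀ Y → Y ⊆ W → size Y + k * edges E′ Y + k * wsum (deg E′ X) Y ≤ wsum (λ v → P v + D v) Y
        sparse Y Y⊆ with ext Y Y⊆
        ... | p , c , l , s , δ , t , enough = ≤-cert _ (wsum (λ v → P v + D v) Y) 0
          (+-mono-≤ (to-budget tol Y {k * boundary E Y} {p} {2} (subst (λ t → t + p ≤ wsum w Y + 2) (reorder (m * size Y) k (edges E Y) (wsum (deg E X) Y))
              (outer {E} {w} g {X} {Y} (∖-disjoint {V} Y⊆) s low)))
            (+-mono-≤ (*-monoʳ-≤ k δ) (+-mono-≤ t enough)))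
          (eq (size Y) k (boundary E Y) (edges E′ Y) (wsum (deg E′ X) Y) c l p (wsum (λ v → P₀ v + D₀ v) Y) (wsum (λ v → P v + D v) Y))
          where
          reorder : ∀ s k e d → s + k * e + k * d ≡ s + k * (e + d)
          reorder = solve-∀
          eq : ∀ s k b e d c l p w w′ → (s + k * e + k * d) + ((w + 2) + (k * b + ((w′ + l) + (k * c + p)))) + 0
            ≡ w′ + ((s + k * b + p) + (k * ((e + d) + c) + (w + (l + 2))))
          eq = solve-∀

      Col-remove : ∀ {E′ tol′ φ a b} → Col E′ X tol′ φ → Col (remove E′ a b) X tol′ φ
      Col-remove {E′} {φ = φ} {a} {b} col v Xv = ≤-<-trans (count-mono {p = λ u → (X u ∧ remove E′ a b u v) ∧ K u (φ u) v (φ v)} {λ u → (X u ∧ E′ u v) ∧ K u (φ u) v (φ v)}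
        λ u p → ∧-intro (∧-intro (∧-elimˡ {X u} (∧-elimˡ p)) (∧-elimˡ (∧-elimʳ {X u} (∧-elimˡ p)))) (∧-elimʳ {X u ∧ remove E′ a b u v} p)) (col v Xv)

      deg-remove : ∀ E′ a b u → deg (remove E′ a b) X u ≤ deg E′ X u
      deg-remove E′ a b u = count-mono {p = λ v → X v ∧ remove E′ a b u v} {λ v → X v ∧ E′ u v} λ v p → ∧-intro {X v} {E′ u v} (∧-elimˡ {X v} p) (∧-elimˡ {E′ u v} (∧-elimʳ {X v} p))

      boundary-inside : ∀ {E′} → IsGraph E′ → ∀ {a b} → E′ a b ≡ true → ∀ Y → boundary (remove E′ a b) Y + (Y a ∧ Y b ▸ 1) ≤ boundary E′ Y
      boundary-inside {E′} g′ {a} {b} ab Y = ≤-trans (≤-reflexive (eq (edges (remove E′ a b) Y) _ _))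
        (+-mono-≤ (edges-remove g′ ab Y) (wsum-mono Y (λ u _ → deg-remove E′ a b u)))
        where
        eq : ∀ a b c → (a + b) + c ≡ (a + c) + b
        eq = solve-∀

      boundary-cross : ∀ {E′} → IsGraph E′ → ∀ {x v} → X x ≡ true → E′ x v ≡ true → ∀ Y → boundary (remove E′ x v) Y + (Y v ▸ 1) ≤ boundary E′ Y
      boundary-cross {E′} g′ {x} {v} Xx xv Y = begin
        (edges (remove E′ x v) Y + wsum (deg (remove E′ x v) X) Y) + (Y v ▸ 1)
          ≡⟨ +-assoc (edges (remove E′ x v) Y) _ _ ⟩
        edges (remove E′ x v) Y + (wsum (deg (remove E′ x v) X) Y + (Y v ▸ 1))
          ≡⟨ cong (λ t → edges (remove E′ x v) Y + (wsum (deg (remove E′ x v) X) Y + t)) (wsum-point v Y) ⟨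
        edges (remove E′ x v) Y + (wsum (deg (remove E′ x v) X) Y + wsum (λ u → (u == v) ▸ 1) Y)
          ≡⟨ cong (edges (remove E′ x v) Y +_) (wsum-+ (deg (remove E′ x v) X) (λ u → (u == v) ▸ 1) Y) ⟨
        edges (remove E′ x v) Y + wsum (λ u → deg (remove E′ x v) X u + ((u == v) ▸ 1)) Y
          ≤⟨ +-mono-≤ (≤-trans (m≤m+n _ _) (edges-remove g′ xv Y)) (wsum-mono Y (λ u _ → pw u)) ⟩
        boundary E′ Y ∎
        where
        open ≤-Reasoning
        gone : X x ∧ remove E′ x v v x ≡ false
        gone rewrite ==-refl v | ==-refl x | ∨-comm ((v == x) ∧ (x == v)) true | ∧-zeroʳ (E′ v x) = ∧-zeroʳ (X x)
        pw : ∀ u → deg (remove E′ x v) X u + ((u == v) ▸ 1) ≤ deg E′ X u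
        pw u = by (u == v) refl
          where
          by : ∀ b → (u == v) ≡ b → deg (remove E′ x v) X u + (b ▸ 1) ≤ deg E′ X u
          by false _ = ≤-trans (≤-reflexive (+-identityʳ _)) (deg-remove E′ x v u)
          by true q = subst (λ z → deg (remove E′ x v) X z + 1 ≤ deg E′ X z) (sym (==-≡ u v q))
            (≤-trans (≤-reflexive (+-comm _ 1)) (size-strict {X = λ t → X t ∧ remove E′ x v v t} {λ t → X t ∧ E′ v t} x
              (λ t p → ∧-intro {X t} {E′ v t} (∧-elimˡ {X t} p) (∧-elimˡ {E′ v t} (∧-elimʳ {X t} p)))
              gone (∧-intro Xx (trans (Esym g′ v x) xv))))

      -- The edge is deleted and each end gives up one unit of budget. A set with one end misses a
      -- noncritical vertex and has slack three by maximality of X; a set with both ends regains k.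
      inside-edge : ∀ {v y} → W v ≡ true → W y ≡ true → E v y ≡ true → ¬ Critical-vertex v → ¬ Critical-vertex y → ⊥
      inside-edge {v} {y} Wv Wy vy ¬cv ¬cy = finish (smaller-V X tol bounded (proper-size X⊆V Wy₁) (λ Y Y⊆ → slack Y (λ v p → X⊆V v (Y⊆ v p))))
        where
        L = ends v y
        P = lowerP L P₀
        D = lowerD L P₀ D₀
        v≢y = E⇒≢ g vy
        ext : ∀ Y → Y ⊆ W → Extends (remove E v y) P D Y
        ext Y Y⊆ = let p , s , enough = choose (Y v) (Y y) refl refl in
          p , _ , _ , s , boundary-inside g vy Y , ≤-trans (lower-total L P₀ D₀ Y) (+-monoʳ-≤ (wsum (λ v → P v + D v) Y) (pair-sum v y Y)) , enough
          where
          choose : ∀ a b → Y v ≡ a → Y y ≡ b → ∃ λ p → Slack E w (Y ∪ X) p × ((Y v ▸ 1) + (Y y ▸ 1)) + 2 ≤ k * (Y v ∧ Y y ▸ 1) + p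
          choose a b p q rewrite p | q = by a b p q
            where
            by : ∀ a b → Y v ≡ a → Y y ≡ b → ∃ λ p → Slack E w (Y ∪ X) p × ((a ▸ 1) + (b ▸ 1)) + 2 ≤ k * (a ∧ b ▸ 1) + p
            by true true p q = 1 , slack (Y ∪ X) (∪-⊆ {V} {X} Y⊆ X⊆V) , ≤-trans 4≤k (≤-trans (≤-reflexive (sym (*-identityʳ k))) (m≤m+n _ 1))
            by true false p q = 3 , slack₃ Y⊆ p Wy q ¬cy , m≤n+m 3 _
            by false true p q = 3 , slack₃ Y⊆ q Wv p ¬cv , m≤n+m 3 _
            by false false p q = 2 , slack₂ {Y} Y⊆ Wv p , m≤n+m 2 _
        conclude : ∀ {φ} → ∃ (λ ψ → Col (remove E v y) V (glueTol X tol (budgetTol P D)) ψ × (∀ u → X u ≡ true → ψ u ≡ φ u)) → ⊥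
        conclude (ψ , colψ , _) = none (ψ , restore {tol = tol} {glueTol X tol (budgetTol P D)} v≢y colψ paid)
          where
          paid : ∀ u h → V u ≡ true → h < glueTol X tol (budgetTol P D) u (ψ u) → h + ((u == v) ∨ (u == y) ▸ 1) < tol u (ψ u)
          paid u h Vu q with X u in Xu
          ... | true = +-▸-false h (cong₂ _∨_ (==-≢ (X≢W Xu Wv)) (==-≢ (X≢W Xu Wy))) q
          ... | false = ≤-trans (lower-tol L P₀ D₀ u (ψ u) h q) (budgetTol-≤ {tol} bounded u (ψ u))
        finish : ¬ Colourable E X tol
        finish (φ , col) = conclude {φ} (extend-budgets (remove-isGraph g v y) {tol} {φ} {P} {D} (Col-remove {E} {tol} col)
          (λ u → ≤-trans (lowerP-≤ L P₀ u) (proj₁ (bounded u))) (λ u → ≤-trans (lowerD-≤ L P₀ D₀ u) (rich≤k {tol} bounded u)) ext)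

      -- Before X is coloured, x is lowered in the colour that conflicts with rich v. If x receives
      -- that colour, it can survive v, and the edge to v is deleted at the price of one unit at v.
      -- Otherwise rich v is safe from x, and v is made rich.
      cross-edge : ∀ {x v y} → X x ≡ true → W v ≡ true → W y ≡ true → E x v ≡ true → E v y ≡ true → ¬ Critical-vertex v → ⊥
      cross-edge {x} {v} {y} Xx Wv Wy xv vy ¬cv = finish (smaller-V X tol₁ (lowerAt-bounded x β {tol} bounded) (proper-size X⊆V Wy₁) slack′)
        where
        β = λ c → K x c v true
        tol₁ = lowerAt x β tol
        v≢y = E⇒≢ g vy
        x≢v = E⇒≢ g xv
        x≢y = X≢W Xx Wy
        slack′ : ∀ Y → Y ⊆ X → Slack E (wt tol₁) Y 1
        slack′ Y Y⊆ = slack-lower {E} {w} {wt tol₁} x {Y} (lowerAt-wt x {β} (atMostOne x v true) tol)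
          (λ Yx → proper-slack {Y} {x} {y} Y⊆V Yx (∧-intro (W⇒V Wy) (cong not (¬true⇒false λ p → X≢W (Y⊆ y p) Wy refl))))
          (λ _ → slack Y Y⊆V)
          where Y⊆V = λ u p → X⊆V u (Y⊆ u p)

        module Spared where
          L = ｛ v ｝
          P = lowerP L P₀
          D = lowerD L P₀ D₀
          ext : ∀ Y → Y ⊆ W → Extends (remove E x v) P D Y
          ext Y Y⊆ = let p , s , enough = by (Y v) refl in
            p , _ , _ , s , boundary-cross g Xx xv Y , ≤-trans (lower-total L P₀ D₀ Y) (≤-reflexive (cong (wsum (λ u → P u + D u) Y +_) (wsum-point v Y))) , enough
            where
            by : ∀ b → Y v ≡ b → ∃ λ p → Slack E w (Y ∪ X) p × (Y v ▸ 1) + 2 ≤ k * (Y v ▸ 1) + p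
            by true q = 1 , slack (Y ∪ X) (∪-⊆ {V} {X} Y⊆ X⊆V) , subst (λ b → (b ▸ 1) + 2 ≤ k * (b ▸ 1) + 1) (sym q)
              (≤-trans (≤-trans (n≤1+n 3) 4≤k) (≤-trans (≤-reflexive (sym (*-identityʳ k))) (m≤m+n _ 1)))
            by false q = 2 , slack₂ {Y} Y⊆ Wv q , subst (λ b → (b ▸ 1) + 2 ≤ k * (b ▸ 1) + 2) (sym q) (m≤n+m 2 _)
          conclude : ∀ {φ} → K x (φ x) v true ≡ true →
            ∃ (λ ψ → Col (remove E x v) V (glueTol X tol₁ (budgetTol P D)) ψ × (∀ u → X u ≡ true → ψ u ≡ φ u)) → ⊥
          conclude {φ} hitting (ψ , colψ , same) = none (ψ , restore {tol = tol} {glueTol X tol₁ (budgetTol P D)} x≢v colψ paid)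
            where
            βψ : β (ψ x) ≡ true
            βψ = trans (cong β (same x Xx)) hitting
            at-x : ∀ u h → (u == x) ≡ true → h < tol₁ u (ψ u) → h + 1 < tol u (ψ u)
            at-x u h e q rewrite ==-≡ u x e = subst (λ b → h + (b ▸ 1) < tol x (ψ x)) (cong₂ _∧_ (==-refl x) βψ) (lowerAt-hit x β tol x (ψ x) h q)
            in-X : ∀ u h → X u ≡ true → h < tol₁ u (ψ u) → ∀ e → (u == x) ≡ e → h + (e ∨ (u == v) ▸ 1) < tol u (ψ u)
            in-X u h Xu q true e = at-x u h e q
            in-X u h Xu q false e = +-▸-false h (==-≢ (X≢W Xu Wv)) (≤-trans q (lowerAt-≤ x β tol u (ψ u)))
            paid : ∀ u h → V u ≡ true → h < glueTol X tol₁ (budgetTol P D) u (ψ u) → h + ((u == x) ∨ (u == v) ▸ 1) < tol u (ψ u)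
            paid u h Vu q = by (X u) refl q
              where
              by : ∀ b → X u ≡ b → h < (if b then tol₁ u (ψ u) else budgetTol P D u (ψ u)) → h + ((u == x) ∨ (u == v) ▸ 1) < tol u (ψ u)
              by true Xu q = in-X u h Xu q (u == x) refl
              by false Xu q = subst (λ e → h + (e ∨ (u == v) ▸ 1) < tol u (ψ u)) (sym (==-≢ {u = u} {x} λ { refl → true≢false Xx Xu }))
                (≤-trans (lower-tol L P₀ D₀ u (ψ u) h q) (budgetTol-≤ {tol} bounded u (ψ u)))

        -- Here x leaves the rich colour of v free. Making v rich costs its whole poor budget, which the
        -- edge x v pays, and leaves v a spare conflict for the edge v y.
        module Forced where
          P₁ P D : Fin n → ℕ
          P₁ u = if u == v then 0 else P₀ u
          P = lowerP ｛ y ｝ P₁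
          D = lowerD ｛ y ｝ P₁ D₀
          E₁ = remove E v y
          E₂ = remove E₁ x v
          g₁ = remove-isGraph g v y
          P₁≤ : ∀ u → P₁ u ≤ P₀ u
          P₁≤ u with u == v
          ... | true = z≤n
          ... | false = ≤-refl
          xv₁ : E₁ x v ≡ true
          xv₁ = cong₂ (λ e f → e ∧ not f) xv (cong₂ (λ a b → (a ∧ (v == y)) ∨ (b ∧ (v == v))) (==-≢ x≢v) (==-≢ x≢y))
          total : ∀ Y → wsum (λ u → P₀ u + D₀ u) Y ≤ wsum (λ u → P u + D u) Y + ((Y y ▸ 1) + k * (Y v ▸ 1))
          total Y = begin
            wsum (λ u → P₀ u + D₀ u) Y
              ≤⟨ wsum-mono Y (λ u _ → pw u) ⟩
            wsum (λ u → (P₁ u + D₀ u) + k * ((u == v) ▸ 1)) Y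
              ≡⟨ wsum-+ (λ u → P₁ u + D₀ u) (λ u → k * ((u == v) ▸ 1)) Y ⟩
            wsum (λ u → P₁ u + D₀ u) Y + wsum (λ u → k * ((u == v) ▸ 1)) Y
              ≡⟨ cong (wsum (λ u → P₁ u + D₀ u) Y +_) (trans (wsum-* k (λ u → (u == v) ▸ 1) Y) (cong (k *_) (wsum-point v Y))) ⟩
            wsum (λ u → P₁ u + D₀ u) Y + k * (Y v ▸ 1)
              ≤⟨ +-monoˡ-≤ (k * (Y v ▸ 1)) (lower-total ｛ y ｝ P₁ D₀ Y) ⟩
            (wsum (λ u → P u + D u) Y + wsum (λ u → (u == y) ▸ 1) Y) + k * (Y v ▸ 1)
              ≡⟨ cong (λ t → (wsum (λ u → P u + D u) Y + t) + k * (Y v ▸ 1)) (wsum-point y Y) ⟩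
            (wsum (λ u → P u + D u) Y + (Y y ▸ 1)) + k * (Y v ▸ 1)
              ≡⟨ +-assoc (wsum (λ u → P u + D u) Y) _ _ ⟩
            wsum (λ u → P u + D u) Y + ((Y y ▸ 1) + k * (Y v ▸ 1)) ∎
            where
            open ≤-Reasoning
            pw : ∀ u → P₀ u + D₀ u ≤ (P₁ u + D₀ u) + k * ((u == v) ▸ 1)
            pw u with u == v
            ... | true = ≤-trans (+-monoˡ-≤ (D₀ u) (proj₁ (bounded u))) (≤-reflexive (trans (+-comm k (D₀ u)) (cong (D₀ u +_) (sym (*-identityʳ k)))))
            ... | false = m≤m+n _ _
          ext : ∀ Y → Y ⊆ W → Extends E₂ P D Y
          ext Y Y⊆ = let p , s , enough = by (Y v) (Y y) refl refl in
            p , _ , _ , s , both , total Y , enough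
            where
            both : boundary E₂ Y + ((Y v ▸ 1) + (Y v ∧ Y y ▸ 1)) ≤ boundary E Y
            both = ≤-trans (≤-reflexive (sym (+-assoc (boundary E₂ Y) _ _)))
              (≤-trans (+-monoˡ-≤ (Y v ∧ Y y ▸ 1) (boundary-cross g₁ Xx xv₁ Y)) (boundary-inside g vy Y))
            Enough : Bool → Bool → ℕ → Set
            Enough a b p = ((b ▸ 1) + k * (a ▸ 1)) + 2 ≤ k * ((a ▸ 1) + (a ∧ b ▸ 1)) + p
            by : ∀ a b → Y v ≡ a → Y y ≡ b → ∃ λ p → Slack E w (Y ∪ X) p × Enough (Y v) (Y y) p
            by true true p q = 1 , slack (Y ∪ X) (∪-⊆ {V} {X} Y⊆ X⊆V) , subst₂ (λ a b → Enough a b 1) (sym p) (sym q) (≤-cert _ _ 2 4≤k (eq k))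
              where
              eq : ∀ k → ((1 + k * 1) + 2) + k + 2 ≡ (k * 2 + 1) + 4
              eq = solve-∀
            by true false p q = 2 , slack₂ {Y} Y⊆ Wy q , subst₂ (λ a b → Enough a b 2) (sym p) (sym q) ≤-refl
            -- No deleted edge is available to this set, which pays for the unit at y. The extra
            -- slack comes from its missing the noncritical vertex v, so y may be critical.
            by false true p q = 3 , slack₃ Y⊆ q Wv p ¬cv , subst₂ (λ a b → Enough a b 3) (sym p) (sym q) (≤-reflexive (eq k))
              where
              eq : ∀ k → (1 + k * 0) + 2 ≡ k * 0 + 3
              eq = solve-∀
            by false false p q = 2 , slack₂ {Y} Y⊆ Wv p , subst₂ (λ a b → Enough a b 2) (sym p) (sym q) ≤-refl
          Pv≡0 : P v ≡ 0
          Pv≡0 = trans (cong (λ e → if e then pred (P₁ v) else P₁ v) (==-≢ v≢y)) (cong (λ e → if e then 0 else P₀ v) (==-refl v))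
          Dv≡ : D v ≡ D₀ v
          Dv≡ = cong (λ e → if e then lowRich (P₁ v) (D₀ v) else D₀ v) (==-≢ v≢y)
          -- With poor budget zero the rich tolerance has been reduced by all of μ. One unit of
          -- that, available as `μ ≥ 1`, pays at v for the edge to y.
          spare : ∀ r h → h < richTol 0 (r ∸ μ) → h + 1 < r
          spare zero h q rewrite 0∸n≡0 μ = case q of λ ()
          spare (suc r) h q = s≤s (≤-trans (≤-reflexive (+-comm h 1)) (≤-trans q (≤-trans (richTol-0 (suc r ∸ μ)) (∸-monoʳ-≤ (suc r) (≤-trans (≤-trans (s≤s z≤n) 4≤k) k≤μ)))))
            where
            richTol-0 : ∀ d → richTol 0 d ≤ d
            richTol-0 zero = ≤-refl
            richTol-0 (suc d) = ≤-refl
          conclude : ∀ {φ} → K x (φ x) v true ≡ false →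
            ∃ (λ ψ → Col E₂ V (glueTol X tol₁ (budgetTol P D)) ψ × (∀ u → X u ≡ true → ψ u ≡ φ u)) → ⊥
          conclude {φ} clear (ψ , colψ , same) = none (ψ , restore {tol = tol} {glueTol X tol₁ (budgetTol P D)} v≢y
              (restore-harmless {tol = glueTol X tol₁ (budgetTol P D)} colψ (trans (cong₂ (λ a b → K x a v b) (same x Xx) ψv) clear)) paid)
            where
            ψv : ψ v ≡ true
            ψv = forced (ψ v) (subst (λ b → hit E₂ V ψ v (ψ v) < (if b then tol₁ v (ψ v) else budgetTol P D v (ψ v))) (W⇒∉X Wv) (colψ v (W⇒V Wv)))
              where
              forced : ∀ c {h} → h < budgetTol P D v c → c ≡ true
              forced true _ = refl
              forced false q = case subst (_ <_) Pv≡0 q of λ ()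
            at-v : ∀ u h → (u == v) ≡ true → h < budgetTol P D u (ψ u) → h + 1 < tol u (ψ u)
            at-v u h e q rewrite ==-≡ u v e | ψv = spare (tol v true) h (subst (h <_) (cong₂ richTol Pv≡0 Dv≡) q)
            outside : ∀ u h → h < budgetTol P D u (ψ u) → ∀ e → (u == v) ≡ e → h + (e ∨ (u == y) ▸ 1) < tol u (ψ u)
            outside u h q true e = at-v u h e q
            outside u h q false e = ≤-trans (lower-tol ｛ y ｝ P₁ D₀ u (ψ u) h q) (≤-trans (raise (ψ u)) (budgetTol-≤ {tol} bounded u (ψ u)))
              where
              raise : ∀ c → budgetTol P₁ D₀ u c ≤ budgetTol P₀ D₀ u c
              raise false = P₁≤ u
              raise true = richTol-mono {d = D₀ u} (P₁≤ u) ≤-refl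
            paid : ∀ u h → V u ≡ true → h < glueTol X tol₁ (budgetTol P D) u (ψ u) → h + ((u == v) ∨ (u == y) ▸ 1) < tol u (ψ u)
            paid u h Vu q = by (X u) refl q
              where
              by : ∀ b → X u ≡ b → h < (if b then tol₁ u (ψ u) else budgetTol P D u (ψ u)) → h + ((u == v) ∨ (u == y) ▸ 1) < tol u (ψ u)
              by true Xu q = +-▸-false h (cong₂ _∨_ (==-≢ (X≢W Xu Wv)) (==-≢ (X≢W Xu Wy))) (≤-trans q (lowerAt-≤ x β tol u (ψ u)))
              by false Xu q = outside u h q (u == v) refl

        finish : ¬ Colourable E X tol₁
        finish (φ , col) = by (K x (φ x) v true) refl
          where
          by : ∀ b → K x (φ x) v true ≡ b → ⊥
          by true e = Spared.conclude {φ} e (extend-budgets (remove-isGraph g x v) {tol₁} {φ} {Spared.P} {Spared.D} (Col-remove {E} {tol₁} col)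
            (λ u → ≤-trans (lowerP-≤ ｛ v ｝ P₀ u) (proj₁ (bounded u))) (λ u → ≤-trans (lowerD-≤ ｛ v ｝ P₀ D₀ u) (rich≤k {tol} bounded u)) Spared.ext)
          by false e = Forced.conclude {φ} e (extend-budgets (remove-isGraph Forced.g₁ x v) {tol₁} {φ} {Forced.P} {Forced.D} (Col-remove {Forced.E₁} {tol₁} (Col-remove {E} {tol₁} col))
            (λ u → ≤-trans (lowerP-≤ ｛ y ｝ Forced.P₁ u) (≤-trans (Forced.P₁≤ u) (proj₁ (bounded u)))) (λ u → ≤-trans (lowerD-≤ ｛ y ｝ Forced.P₁ D₀ u) (rich≤k {tol} bounded u)) Forced.ext)

      -- If v has no neighbour in X and no noncritical neighbour outside X, then all its neighbours
      -- are critical and `no-hub` applies to v.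
      absurd-at : ∀ {v y} → W v ≡ true → W y ≡ true → E v y ≡ true → ¬ Critical-vertex v → ⊥
      absurd-at {v} {y} Wv Wy vy ¬cv with any? (λ x → (X x ≟B true) ×-dec (E x v ≟B true))
      ... | yes (x , Xx , xv) = cross-edge Xx Wv Wy xv vy ¬cv
      ... | no apart with any? (λ y → (W y ≟B true) ×-dec ((E v y ≟B true) ×-dec ¬? (critical? y)))
      ...   | yes (y′ , Wy′ , vy′ , ¬cy′) = inside-edge Wv Wy′ vy′ ¬cv ¬cy′
      ...   | no allCritical = no-hub (W⇒V Wv) λ u Vu vu → critical u Vu vu (X u) refl
        where
        critical : ∀ u → V u ≡ true → E v u ≡ true → ∀ b → X u ≡ b → Critical-vertex u
        critical u Vu vu true Xu = ⊥-elim (apart (u , Xu , trans (Esym g u v) vu))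
        critical u Vu vu false Xu = decidable-stable (critical? u) λ ¬cu → allCritical (u , ∧-intro Vu (cong not Xu) , vu , ¬cu)

      absurd : ⊥
      absurd with neighbour y₁ Wy₁
      ... | y , Wy , y₁y with critical? y₁ | critical? y
      ...   | no ¬c | _ = absurd-at Wy₁ Wy y₁y ¬c
      ...   | yes _ | no ¬c = absurd-at Wy Wy₁ (trans (Esym g y y₁) y₁y) ¬c
      ...   | yes c | yes c′ = critical-independent c c′ y₁y

    -- Deleting a b and lowering both tolerances at both ends costs 4 ≤ k when both ends are in the set, and
    -- at most 2 otherwise.
    critical-ends : ¬ ∃ Good → ∀ {a b} → V a ≡ true → V b ≡ true → E a b ≡ true → ¬ Critical-vertex a → ¬ Critical-vertex b → ⊥
    critical-ends noGood {a} {b} Va Vb ab ¬ca ¬cb = none (φ , restore {tol = tol} {tol′} (E⇒≢ g ab) col λ v h _ → paid (ends a b v) (tol v (φ v)))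
      where
      tol′ : Tol
      tol′ v c = if ends a b v then pred (tol v c) else tol v c
      tol′≤ : ∀ v c → tol′ v c ≤ tol v c
      tol′≤ v c with ends a b v
      ... | true = pred[n]≤n
      ... | false = ≤-refl
      paid : ∀ e t {h} → h < (if e then pred t else t) → h + (e ▸ 1) < t
      paid true (suc t) {h} q = s≤s (≤-trans (≤-reflexive (+-comm h 1)) q)
      paid false t {h} q = subst (_< t) (sym (+-identityʳ h)) q
      total : ∀ Y → wsum w Y ≤ wsum (wt tol′) Y + 2 * ((Y a ▸ 1) + (Y b ▸ 1))
      total Y = begin
        wsum w Y                                                       ≤⟨ wsum-mono Y (λ v _ → pw v) ⟩
        wsum (λ v → wt tol′ v + 2 * (ends a b v ▸ 1)) Y                ≡⟨ wsum-+ (wt tol′) (λ v → 2 * (ends a b v ▸ 1)) Y ⟩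
        wsum (wt tol′) Y + wsum (λ v → 2 * (ends a b v ▸ 1)) Y         ≡⟨ cong (wsum (wt tol′) Y +_) (wsum-* 2 (λ v → ends a b v ▸ 1) Y) ⟩
        wsum (wt tol′) Y + 2 * wsum (λ v → ends a b v ▸ 1) Y           ≤⟨ +-monoʳ-≤ (wsum (wt tol′) Y) (*-monoʳ-≤ 2 (pair-sum a b Y)) ⟩
        wsum (wt tol′) Y + 2 * ((Y a ▸ 1) + (Y b ▸ 1)) ∎
        where
        open ≤-Reasoning
        pred+1 : ∀ x → x ≤ pred x + 1
        pred+1 zero = z≤n
        pred+1 (suc x) = ≤-reflexive (+-comm 1 x)
        pw : ∀ v → w v ≤ wt tol′ v + 2 * (ends a b v ▸ 1)
        pw v with ends a b v
        ... | true = ≤-trans (+-mono-≤ (pred+1 (tol v false)) (pred+1 (tol v true))) (≤-reflexive (+-interchange (pred (tol v false)) 1 _ 1))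
        ... | false = m≤m+n _ _
      slack′ : ∀ Y → Y ⊆ V → Slack (remove E a b) (wt tol′) Y 1
      slack′ Y Y⊆ = by (Y a) (Y b) refl refl
        where
        Enough : ℕ → Bool → Bool → Set
        Enough p x y = 2 * ((x ▸ 1) + (y ▸ 1)) + 1 ≤ k * (x ∧ y ▸ 1) + p
        conclude : ∀ p x y → Y a ≡ x → Y b ≡ y → Slack E w Y p → Enough p x y → Slack (remove E a b) (wt tol′) Y 1
        conclude p x y ya yb s e = ≤-cert _ (wsum (wt tol′) Y + m) 0
          (+-mono-≤ (+-mono-≤ s (cost-remove g ab Y)) (+-mono-≤ (total Y) (subst₂ (Enough p) (sym ya) (sym yb) e)))
          (eq (cost (remove E a b) Y) (cost E Y) (wsum w Y) (wsum (wt tol′) Y) m p (k * (Y a ∧ Y b ▸ 1)) (2 * ((Y a ▸ 1) + (Y b ▸ 1))))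
          where
          eq : ∀ c′ c w w′ m p kc l → (c′ + 1) + (((w + m) + c) + ((w′ + l) + (kc + p))) + 0 ≡ (w′ + m) + (((c + p) + (c′ + kc)) + (w + (l + 1)))
          eq = solve-∀
        by : ∀ x y → Y a ≡ x → Y b ≡ y → Slack (remove E a b) (wt tol′) Y 1
        by true true p q = conclude 1 true true p q (slack Y Y⊆) (+-monoˡ-≤ 1 (≤-trans 4≤k (≤-reflexive (sym (*-identityʳ k)))))
        by true false p q = conclude 3 true false p q (slack-unless-good {Y} {a} {b} Y⊆ p (∧-intro Vb (cong not q)) ¬cb (λ good → noGood (Y , good))) (m≤n+m 3 _)
        by false true p q = conclude 3 false true p q (slack-unless-good {Y} {b} {a} Y⊆ q (∧-intro Va (cong not p)) ¬ca (λ good → noGood (Y , good))) (m≤n+m 3 _)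
        by false false p q = conclude 1 false false p q (slack Y Y⊆) (m≤n+m 1 _)
      coloured = smaller (remove-isGraph g a b) V tol′ (λ v → ≤-trans (tol′≤ v false) (proj₁ (bounded v)) , ≤-trans (tol′≤ v true) (proj₂ (bounded v)))
        (+-monoʳ-< (size V) (≤-trans (≤-reflexive (+-comm 1 _)) (edges-remove g ab full))) slack′
      φ = proj₁ coloured
      col = proj₂ coloured

    -- An edge has a noncritical end because critical vertices are independent. By `critical-ends`
    -- all neighbours of that end are critical, so it is a hub.
    no-good : ¬ ∃ Good → ⊥
    no-good noGood = ¬¬-em λ where
        (inj₂ noEdge) → none (φ , λ v Vv → subst (_< tol v (φ v)) (sym (no-edges⇒unhit noEdge φ v (φ v) Vv)) (allowed v (singleton Vv)))
        (inj₁ (a , b , Va , Vb , ab)) → at-edge Va Vb ab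
      where
      φ : Fin n → Bool
      φ v = tol v false ≡ᵇ 0
      allowed : ∀ v → 1 ≤ w v → 0 < tol v (φ v)
      allowed v q with tol v false in p
      ... | zero = q
      ... | suc t = ≤-trans (s≤s z≤n) (≤-reflexive (sym p))
      hub : ∀ {a} → V a ≡ true → ¬ Critical-vertex a → ⊥
      hub Va ¬ca = no-hub Va λ y Vy ay → decidable-stable (critical? y) λ ¬cy → critical-ends noGood Va Vy ay ¬ca ¬cy
      at-edge : ∀ {a b} → V a ≡ true → V b ≡ true → E a b ≡ true → ⊥
      at-edge {a} {b} Va Vb ab with critical? a | critical? b
      ... | no ¬ca | _ = hub Va ¬ca
      ... | yes _ | no ¬cb = hub Vb ¬cb
      ... | yes ca | yes cb = critical-independent ca cb ab

    no-good-chain : ∀ N X → Good X → size V < size X + N → ⊥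
    no-good-chain zero X (X⊆V , _) q = <⇒≱ q (≤-trans (≤-reflexive (+-identityʳ (size X))) (size-mono X⊆V))
    no-good-chain (suc N) X good q = ¬¬-em {∃ λ X′ → Good X′ × X ⊆ X′ × ∃ λ u → X′ u ≡ true × X u ≡ false} λ where
      (inj₁ (X′ , good′ , X⊆X′ , u , X′u , Xu)) → no-good-chain N X′ good′
        (≤-trans q (≤-trans (≤-reflexive (+-suc (size X) N)) (+-monoˡ-≤ N (size-strict u X⊆X′ Xu X′u))))
      (inj₂ top) → Outside.absurd X good λ X′ good′ X⊆X′ u X′u Xu → top (X′ , good′ , X⊆X′ , u , X′u , Xu)

    impossible : ⊥
    impossible = ¬¬-em {∃ Good} λ where
      (inj₁ (X , good)) → no-good-chain (suc (size V)) X good (m≤n+m (suc (size V)) (size X))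
      (inj₂ noGood) → no-good noGood

  slack⇒colourable : ∀ N {E} → IsGraph E → ∀ V tol → Bounded tol → size V + edges E full < N →
    (∀ Y → Y ⊆ V → Slack E (wt tol) Y 1) → Colourable E V tol
  slack⇒colourable (suc N) g V tol bounded (s≤s small) slack = colourable-stable {tol = tol} λ none →
    Minimal.impossible g V tol bounded (λ g′ V′ tol′ b lt → slack⇒colourable N g′ V′ tol′ b (≤-trans lt small)) slack none

sumF-punchIn : ∀ {n} (f : Fin (suc n) → ℕ) y → sumF f ≡ f y + sumF (λ u → f (punchIn y u))
sumF-punchIn f zero = sumF-suc f
sumF-punchIn {suc n} f (suc y) = begin
  sumF f                                                               ≡⟨ sumF-suc f ⟩
  f zero + sumF (f ∘ suc)                                              ≡⟨ cong (f zero +_) (sumF-punchIn (f ∘ suc) y) ⟩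
  f zero + (f (suc y) + sumF (λ u → f (suc (punchIn y u))))            ≡⟨ swap (f zero) (f (suc y)) _ ⟩
  f (suc y) + (f zero + sumF (λ u → f (suc (punchIn y u))))            ≡⟨ cong (f (suc y) +_) (sumF-suc (λ u → f (punchIn (suc y) u))) ⟨
  f (suc y) + sumF (λ u → f (punchIn (suc y) u)) ∎
  where
  open ≡-Reasoning
  swap : ∀ a b c → a + (b + c) ≡ b + (a + c)
  swap = solve-∀

size-full : ∀ n → size (full {n}) ≡ n
size-full zero = refl
size-full (suc n) = trans (sumF-suc {n} (λ _ → 1)) (cong suc (size-full n))

-- The lower bound

deleteVertex : ∀ {n} → Graph (suc n) → Fin (suc n) → Graph n
deleteVertex G y = record
  { adj = λ u v → adj G (punchIn y u) (punchIn y v)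
  ; sym = λ u v → adj-sym G (punchIn y u) (punchIn y v)
  ; irrefl = λ u → irrefl G (punchIn y u) }

deleteVertex-cover : ∀ {n} {G : Graph (suc n)} → Cover G → ∀ y → Cover (deleteVertex G y)
deleteVertex-cover C y = record
  { hadj = λ { (u , a) (v , b) → hadj C (punchIn y u , a) (punchIn y v , b) }
  ; hsym = λ _ _ → hsym C _ _
  ; hirrefl = λ _ → hirrefl C _
  ; hcomplete = λ _ → hcomplete C _
  ; hedge = λ u v a b u≢v → hedge C _ _ a b (u≢v ∘ punchIn-injective y u v)
  ; hmatch₁ = λ u v a b b′ u≢v → hmatch₁ C _ _ a b b′ (u≢v ∘ punchIn-injective y u v)
  ; hmatch₂ = λ u v a a′ b u≢v → hmatch₂ C _ _ a a′ b (u≢v ∘ punchIn-injective y u v) }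

graph : ∀ {n} (G : Graph n) → IsGraph (adj G)
graph G = record { Esym = adj-sym G ; Eirr = irrefl G }

module Conflicts {n} {G : Graph n} (C : Cover G) where

  -- The conjunct `adj G u v` discards the edge of the cover inside each `L(u)`, so `Kmatch` holds
  -- without a condition `u ≢ v`.
  K : Fin n → Bool → Fin n → Bool → Bool
  K u a v b = hadj C (u , a) (v , b) ∧ adj G u v

  Ksym : ∀ u a v b → K u a v b ≡ K v b u a
  Ksym u a v b = cong₂ _∧_ (hsym C (u , a) (v , b)) (adj-sym G u v)

  Kmatch : ∀ u a v b b′ → K u a v b ≡ true → K u a v b′ ≡ true → b ≡ b′
  Kmatch u a v b b′ p q = hmatch₁ C u v a b b′ (E⇒≢ (graph G) (∧-elimʳ {hadj C (u , a) (v , b)} p))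
    (∧-elimˡ p) (∧-elimˡ q)

module Theorem (i μ : ℕ) (3≤i : 3 ≤ i) (i<μ : suc i ≤ μ) where

  j k : ℕ
  j = μ + i
  k = suc i

  tolerance : ∀ {n} → Fin n → Bool → ℕ
  tolerance _ c = suc (capacity i j c)

  weight : ℕ
  weight = suc i + suc j

  GSlack : ∀ {n} → Graph n → VSet n → ℕ → Set
  GSlack G Y q = suc μ * size Y + k * edges (adj G) Y + q ≤ wsum (λ _ → weight) Y + suc μ

  module On {n} {G : Graph n} (C : Cover G) where
    open Conflicts C public
    open Extension K Ksym Kmatch k μ (s≤s 3≤i) i<μ public

    tolerance-bounded : Bounded tolerance
    tolerance-bounded v = ≤-refl , ≤-reflexive (sym (+-suc μ i))

    defective : Colourable (adj G) full tolerance → ∃ (IsDefectiveColoring i j C)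
    defective (φ , col) = φ , λ v → ≤-trans (count-mono {p = λ u → hadj C (u , φ u) (v , φ v)} (real v)) (≤-pred (col v refl))
      where
      real : ∀ v u → hadj C (u , φ u) (v , φ v) ≡ true → (true ∧ adj G u v) ∧ K u (φ u) v (φ v) ≡ true
      real v u p with u ≟F v
      ... | yes refl = true≢false p (hirrefl C (u , φ u))
      ... | no u≢v = let uv = hedge C u v (φ u) (φ v) u≢v p in ∧-intro uv (∧-intro p uv)

  slack⇒colorable : ∀ {n} (G : Graph n) → (∀ Y → GSlack G Y 1) → Colorable i j G
  slack⇒colorable G slack C = defective (slack⇒colourable _ (graph G) full tolerance tolerance-bounded ≤-refl λ Y _ → slack Y)
    where open On C

  proper-colourable : ∀ {n} {G : Graph n} (C : Cover G) → Critical i j G → ∀ Y y → Y y ≡ false → On.Colourable C (adj G) Y tolerance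
  proper-colourable {suc n} {G} C (_ , proper) Y y Yy = from (proper n (deleteVertex G y) (punchIn y)
      ((λ u v → punchIn-injective y u v) , λ u v p → p) (λ { (onto , _) → let u , p = onto y in punchInᵢ≢i y u p })
      (deleteVertex-cover C y))
    where
    open On C
    from : ∃ (IsDefectiveColoring i j (deleteVertex-cover C y)) → Colourable (adj G) Y tolerance
    from (ψ , ok) = φ , λ v Yv → s≤s (at v Yv)
      where
      -- The colour given to y is a dummy: y lies outside Y, so it is never counted.
      φ = insertAt ψ y false
      at′ : ∀ v → hit (adj G) Y φ (punchIn y v) (φ (punchIn y v)) ≤ capacity i j (φ (punchIn y v))
      at′ v rewrite insertAt-punchIn ψ y false v = ≤-trans (≤-reflexive (sumF-punchIn (λ u → (Y u ∧ adj G u (punchIn y v)) ∧ K u (φ u) (punchIn y v) (ψ v) ▸ 1) y))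
        (≤-trans (+-mono-≤ (≤-reflexive (cong (λ b → (b ∧ adj G y (punchIn y v)) ∧ K y (φ y) (punchIn y v) (ψ v) ▸ 1) Yy))
            (count-mono {p = λ u → (Y (punchIn y u) ∧ adj G (punchIn y u) (punchIn y v)) ∧ K (punchIn y u) (φ (punchIn y u)) (punchIn y v) (ψ v)}
              {λ u → hadj C (punchIn y u , ψ u) (punchIn y v , ψ v)} imp))
          (ok v))
        where
        imp : ∀ u → (Y (punchIn y u) ∧ adj G (punchIn y u) (punchIn y v)) ∧ K (punchIn y u) (φ (punchIn y u)) (punchIn y v) (ψ v) ≡ true →
          hadj C (punchIn y u , ψ u) (punchIn y v , ψ v) ≡ true
        imp u p = subst (λ a → hadj C (punchIn y u , a) (punchIn y v , ψ v) ≡ true) (insertAt-punchIn ψ y false u)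
          (∧-elimˡ (∧-elimʳ {Y (punchIn y u) ∧ adj G (punchIn y u) (punchIn y v)} p))
      at : ∀ v → Y v ≡ true → hit (adj G) Y φ v (φ v) ≤ capacity i j (φ v)
      at v Yv = subst (λ v → hit (adj G) Y φ v (φ v) ≤ capacity i j (φ v)) (punchIn-punchOut y≢v) (at′ (punchOut y≢v))
        where
        y≢v : y ≢ v
        y≢v refl = true≢false Yv Yy

  -- Were the bound violated, a largest set of nonpositive slack would be proper, and its colouring would extend.
  critical⇒no-slack : ∀ {n} {G : Graph n} → Critical i j G → ¬ GSlack G full 1
  critical⇒no-slack {n} {G} crit slack-full = proj₁ crit λ C → On.defective C (On.colourable-stable C {adj G} {full} {tolerance} (uncolourable C))
    where
    module _ (C : Cover G) (none : ¬ On.Colourable C (adj G) full tolerance) where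
      open On C
      Dense : VSet n → Set
      Dense Y = AtMost (adj G) (wt tolerance) Y 0
      largest : ∀ Y → Dense Y → (∀ Y′ → Dense Y′ → Y ⊆ Y′ → ∀ u → Y′ u ≡ true → Y u ≡ false → ⊥) → ⊥
      largest Y dense top with proper-or-all full Y
      ... | inj₂ all = ≰-cert 0 (+-mono-≤ (Slack-≐ {adj G} {wt tolerance} {full} {Y} (⊆-antisym all λ _ _ → refl) slack-full) dense)
        (eq (cost (adj G) Y) (wsum (wt tolerance) Y + m))
        where
        eq : ∀ c w → (c + 1) + w ≡ (w + (c + 0)) + suc 0
        eq = solve-∀
      ... | inj₁ (y , Wy) = none (extend-colouring (graph G) {full} {Y} {tolerance} tolerance-bounded (proper-colourable C crit Y y (not-true Wy))
        λ { Z Z⊆ (u , Zu) → 1 , ¬AtMost⇒Slack {adj G} {wt tolerance} {Z ∪ Y} (λ a → top (Z ∪ Y) a (λ v p → ∨-introʳ {Z v} p) u (∨-introˡ Zu) (not-true (Z⊆ u Zu)))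
            , ≤-trans dense (+-monoʳ-≤ (cost (adj G) Y) z≤n) })
      climb : ∀ N Y → Dense Y → n < size Y + N → ⊥
      climb zero Y _ q = <⇒≱ q (≤-trans (≤-reflexive (+-identityʳ (size Y))) (≤-trans (size-mono {X = Y} {full} (λ _ _ → refl)) (≤-reflexive (size-full n))))
      climb (suc N) Y dense q = ¬¬-em {∃ λ Y′ → Dense Y′ × Y ⊆ Y′ × ∃ λ u → Y′ u ≡ true × Y u ≡ false} λ where
        (inj₁ (Y′ , dense′ , sub , u , Y′u , Yu)) → climb N Y′ dense′ (≤-trans q (≤-trans (≤-reflexive (+-suc (size Y) N)) (+-monoˡ-≤ N (size-strict u sub Yu Y′u))))
        (inj₂ top) → largest Y dense λ Y′ dense′ sub u Y′u Yu → top (Y′ , dense′ , sub , u , Y′u , Yu)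
      uncolourable : ⊥
      uncolourable = ¬¬-em {∃ Dense} λ where
        (inj₁ (Y , dense)) → climb (suc n) Y dense (m≤n+m (suc n) (size Y))
        (inj₂ sparse) → none (slack⇒colourable _ (graph G) full tolerance tolerance-bounded ≤-refl
          λ Y _ → ¬AtMost⇒Slack {adj G} {wt tolerance} {Y} λ a → sparse (Y , a))

  -- This is slack at most zero for the whole vertex set. The coefficient of n is `weight` minus
  -- `suc μ`, that is (i + 1) + (j + 1) - (j - i + 1).
  lower-bound : ∀ {n} {G : Graph n} → Critical i j G → (2 * i + 1) * n + suc μ ≤ (i + 1) * edgeCount G
  lower-bound {n} {G} crit = conclude (size (full {n})) (edgeCount G) (wsum {n} (λ _ → weight) full) (size-full n)
    (trans (wsum-const {n} weight full) (cong (weight *_) (size-full n))) (≰⇒> (critical⇒no-slack {n} {G} crit))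
    where
    conclude : ∀ s e w → s ≡ n → w ≡ weight * n → w + suc μ < suc μ * s + k * e + 1 → (2 * i + 1) * n + suc μ ≤ (i + 1) * e
    conclude s e w refl refl dense = ≤-cert _ _ 0 dense (eq i μ n e)
      where
      eq : ∀ i μ n e → (2 * i + 1) * n + suc μ + (suc μ * n + suc i * e + 1) + 0 ≡ (i + 1) * e + suc ((suc i + suc (μ + i)) * n + suc μ)
      eq = solve-∀

-- Subgraphs of a tight graph

module Subgraph {m′ n : ℕ} {G′ : Graph m′} {G : Graph n} {f : Fin m′ → Fin n} (sub : IsSubgraphVia G′ G f) where

  image : VSet m′ → VSet n
  image Y v = does (any? (λ u → (Y u ≟B true) ×-dec (f u ≟F v)))

  image-intro : ∀ Y {u} → Y u ≡ true → image Y (f u) ≡ true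
  image-intro Y {u} Yu = dec-true (any? (λ u′ → (Y u′ ≟B true) ×-dec (f u′ ≟F f u))) (u , Yu , refl)

  image-elim : ∀ Y {v} → image Y v ≡ true → ∃ λ u → Y u ≡ true × f u ≡ v
  image-elim Y {v} p with any? (λ u′ → (Y u′ ≟B true) ×-dec (f u′ ≟F v))
  ... | yes found = found

  wsum-image : ∀ g Y → wsum g (image Y) ≡ wsum (λ u → g (f u)) Y
  wsum-image g Y = sym (begin
    wsum (λ u → g (f u)) Y                                          ≡⟨ sumF-cong (λ u → sym (row u)) ⟩
    sumF (λ u → sumF (λ v → Y u ∧ (f u == v) ▸ g v))                ≡⟨ sumF-swap (λ u v → Y u ∧ (f u == v) ▸ g v) ⟩
    sumF (λ v → sumF (λ u → Y u ∧ (f u == v) ▸ g v))                ≡⟨ sumF-cong (λ v → column v (image Y v) refl) ⟩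
    wsum g (image Y) ∎)
    where
    open ≡-Reasoning
    row : ∀ u → sumF (λ v → Y u ∧ (f u == v) ▸ g v) ≡ (Y u ▸ g (f u))
    row u = trans (sumF-single (λ v → Y u ∧ (f u == v) ▸ g v) (f u)
        (λ v v≢ → cong (_▸ g v) (trans (cong (Y u ∧_) (==-≢ (v≢ ∘ sym))) (∧-zeroʳ (Y u)))))
      (cong (_▸ g (f u)) (trans (cong (Y u ∧_) (==-refl (f u))) (∧-identityʳ (Y u))))
    column : ∀ v b → image Y v ≡ b → sumF (λ u → Y u ∧ (f u == v) ▸ g v) ≡ (b ▸ g v)
    column v false p = sumF-zero λ u → cong (_▸ g v) (¬true⇒false λ q →
      true≢false (subst (λ v → image Y v ≡ true) (==-≡ (f u) v (∧-elimʳ {Y u} q)) (image-intro Y (∧-elimˡ q))) p)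
    column v true p with image-elim Y p
    ... | u₀ , Yu₀ , refl = trans (sumF-single (λ u → Y u ∧ (f u == f u₀) ▸ g (f u₀)) u₀
        (λ u u≢ → cong (_▸ g (f u₀)) (trans (cong (Y u ∧_) (==-≢ (u≢ ∘ proj₁ sub u u₀))) (∧-zeroʳ (Y u)))))
      (cong (_▸ g (f u₀)) (∧-intro Yu₀ (==-refl (f u₀))))

  deg-image : ∀ Y u → deg (adj G) (image Y) (f u) ≡ count (λ u′ → Y u′ ∧ adj G (f u) (f u′))
  deg-image Y u = trans (sumF-cong λ v → split (image Y v) (adj G (f u) v))
    (trans (wsum-image (λ v → adj G (f u) v ▸ 1) Y) (sumF-cong λ u′ → sym (split (Y u′) (adj G (f u) (f u′)))))
    where
    split : ∀ a b → (a ∧ b ▸ 1) ≡ (a ▸ (b ▸ 1))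
    split true b = refl
    split false b = refl

  deg-≤ : ∀ Y u → deg (adj G′) Y u ≤ deg (adj G) (image Y) (f u)
  deg-≤ Y u = ≤-trans (count-mono {p = λ u′ → Y u′ ∧ adj G′ u u′} {λ u′ → Y u′ ∧ adj G (f u) (f u′)}
      λ u′ p → ∧-intro (∧-elimˡ {Y u′} p) (proj₂ sub u u′ (∧-elimʳ {Y u′} p)))
    (≤-reflexive (sym (deg-image Y u)))

  deg-sum : ∀ Y → wsum (λ u → deg (adj G) (image Y) (f u)) Y ≡ edges (adj G) (image Y) + edges (adj G) (image Y)
  deg-sum Y = trans (sym (wsum-image (deg (adj G) (image Y)) Y)) (sym (handshake (graph G) (image Y)))

  -- `edges` depends on the order of the indices, which f need not preserve. Degrees do not, so the
  -- comparison is made through the handshake identity.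
  edges-image : ∀ Y → edges (adj G′) Y ≤ edges (adj G) (image Y)
  edges-image Y = ≮⇒≥ λ lt → <⇒≱ (+-mono-< lt lt)
    (subst₂ _≤_ (sym (handshake (graph G′) Y)) (deg-sum Y) (wsum-mono Y (λ u _ → deg-≤ Y u)))

  edges-image-< : ∀ Y {a b} → Y a ≡ true → Y b ≡ true → adj G (f a) (f b) ≡ true → adj G′ a b ≡ false →
    edges (adj G′) Y < edges (adj G) (image Y)
  edges-image-< Y {a} {b} Ya Yb ab a∤b = ≰⇒> λ ge → <⇒≱ strict (+-mono-≤ ge ge)
    where
    at : ∀ u e → (u == a) ≡ e → deg (adj G′) Y u + (e ▸ 1) ≤ deg (adj G) (image Y) (f u)
    at u false _ = ≤-trans (≤-reflexive (+-identityʳ _)) (deg-≤ Y u)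
    at u true e = subst (λ u → deg (adj G′) Y u + 1 ≤ deg (adj G) (image Y) (f u)) (sym (==-≡ u a e))
      (≤-trans (≤-reflexive (+-comm _ 1)) (≤-trans (size-strict {X = λ u′ → Y u′ ∧ adj G′ a u′} {λ u′ → Y u′ ∧ adj G (f a) (f u′)} b
          (λ u′ p → ∧-intro (∧-elimˡ {Y u′} p) (proj₂ sub a u′ (∧-elimʳ {Y u′} p)))
          (trans (cong (Y b ∧_) a∤b) (∧-zeroʳ (Y b))) (∧-intro Yb ab))
        (≤-reflexive (sym (deg-image Y a)))))
    strict : edges (adj G′) Y + edges (adj G′) Y < edges (adj G) (image Y) + edges (adj G) (image Y)
    strict = begin
      suc (edges (adj G′) Y + edges (adj G′) Y)                            ≡⟨ cong suc (handshake (graph G′) Y) ⟩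
      suc (wsum (deg (adj G′) Y) Y)                                        ≡⟨ +-comm 1 _ ⟩
      wsum (deg (adj G′) Y) Y + 1                                          ≡⟨ cong (λ b → wsum (deg (adj G′) Y) Y + (b ▸ 1)) Ya ⟨
      wsum (deg (adj G′) Y) Y + (Y a ▸ 1)                                  ≡⟨ cong (wsum (deg (adj G′) Y) Y +_) (wsum-point a Y) ⟨
      wsum (deg (adj G′) Y) Y + wsum (λ u → (u == a) ▸ 1) Y                ≡⟨ wsum-+ (deg (adj G′) Y) (λ u → (u == a) ▸ 1) Y ⟨
      wsum (λ u → deg (adj G′) Y u + ((u == a) ▸ 1)) Y                     ≤⟨ wsum-mono Y (λ u _ → at u (u == a) refl) ⟩
      wsum (λ u → deg (adj G) (image Y) (f u)) Y                           ≡⟨ deg-sum Y ⟩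
      edges (adj G) (image Y) + edges (adj G) (image Y) ∎
      where open ≤-Reasoning

module Sharpness (i μ : ℕ) (3≤i : 3 ≤ i) (i<μ : suc i ≤ μ) where
  open Theorem i μ 3≤i i<μ

  -- A vertex set of the subgraph whose image misses a vertex inherits positive slack. If its image
  -- is everything, then an edge of G is absent from the subgraph, and this edge gains k.
  proper⇒colorable : ∀ {m′ n} {G′ : Graph m′} {G : Graph n} {f : Fin m′ → Fin n} →
    GSlack G full 0 → (∀ Y y → Y y ≡ false → GSlack G Y 1) → IsSubgraphVia G′ G f → ¬ IsWholeVia G′ G f → Colorable i j G′
  proper⇒colorable {m′} {n} {G′} {G} {f} whole proper sub ¬whole = slack⇒colorable G′ slack
    where
    open Subgraph {m′} {n} {G′} {G} {f} sub
    pull : ∀ Y {e q q′} → edges (adj G′) Y + e ≤ edges (adj G) (image Y) → q′ ≤ q + k * e → GSlack G (image Y) q → GSlack G′ Y q′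
    pull Y {e} {q} {q′} h hq s = ≤-cert _ _ 0 (+-mono-≤ (subst₂ (λ a b → suc μ * a + k * edges (adj G) (image Y) + q ≤ b + suc μ)
        (wsum-image (λ _ → 1) Y) (wsum-image (λ _ → weight) Y) s) (+-mono-≤ (*-monoʳ-≤ k h) hq))
      (eq (suc μ * size Y) (suc μ) k (edges (adj G′) Y) (edges (adj G) (image Y)) e q q′ (wsum (λ _ → weight) Y))
      where
      eq : ∀ s m k e′ e d q q′ w → (s + k * e′ + q′) + ((w + m) + (k * e + (q + k * d))) + 0 ≡ (w + m) + ((s + k * e + q) + (k * (e′ + d) + q′))
      eq = solve-∀
    slack : ∀ Y → GSlack G′ Y 1
    slack Y with any? (λ y → image Y y ≟B false)
    ... | yes (y , p) = pull Y {0} {1} (≤-trans (≤-reflexive (+-identityʳ _)) (edges-image Y)) (m≤m+n 1 _) (proper (image Y) y p)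
    ... | no everything with any? (λ a → any? (λ b → (adj G (f a) (f b) ≟B true) ×-dec (adj G′ a b ≟B false)))
    ...   | no same = ⊥-elim (¬whole ((λ y → let u , _ , p = image-elim Y (onto y) in u , p) ,
              λ u v p → ¬false⇒true λ q → same (u , v , p , q)))
      where
      onto : ∀ y → image Y y ≡ true
      onto y = ¬false⇒true λ q → everything (y , q)
    ...   | yes (a , b , p , q) = pull Y {1} {0} (≤-trans (≤-reflexive (+-comm _ 1)) (edges-image-< Y (member a) (member b) p q))
            (≤-trans (s≤s z≤n) (≤-reflexive (sym (*-identityʳ k))))
            (subst (λ s → s) (cong₂ _≤_ (cong₂ (λ s e → suc μ * s + k * e + 0) (wsum-≐ (λ _ → 1) all) (edges-≐ (adj G) all)) (cong (_+ suc μ) (wsum-≐ (λ _ → weight) all))) whole)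
      where
      all : full ≐ image Y
      all y = sym (¬false⇒true λ q → everything (y , q))
      member : ∀ u → Y u ≡ true
      member u with image-elim Y (sym (all (f u)))
      ... | u′ , Yu′ , p = subst (λ u → Y u ≡ true) (proj₁ sub u′ u p) Yu′

isColour : Bool → Bool → Bool
isColour γ c = does (γ ≟B c)

isColour-≡ : ∀ {γ c} → isColour γ c ≡ true → γ ≡ c
isColour-≡ {γ} {c} p with γ ≟B c
... | yes q = q

isColour-refl : ∀ c → isColour c c ≡ true
isColour-refl c = dec-true (c ≟B c) refl

-- The tight examples

module Grow {n : ℕ} (G : Graph n) (C : Cover G) (a : Fin n) (c : Bool) (t : Bool) (b : Fin n) (a≢b : t ≡ true → a ≢ b) where

  joined : VSet n
  joined v = (v == a) ∨ (t ∧ (v == b))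

  -- The rich colour of the new vertex conflicts with colour c of a, the poor one with poor b if b
  -- is joined. So with both neighbours present and in those colours, the new vertex must hit one of
  -- them.
  clash : Bool → Fin n → Bool → Bool
  clash true v γ = (v == a) ∧ isColour γ c
  clash false v γ = (t ∧ (v == b)) ∧ not γ

  G⁺ : Graph (suc n)
  G⁺ = record { adj = adj⁺ ; sym = sym⁺ ; irrefl = irrefl⁺ }
    where
    adj⁺ : Fin (suc n) → Fin (suc n) → Bool
    adj⁺ zero zero = false
    adj⁺ zero (suc v) = joined v
    adj⁺ (suc u) zero = joined u
    adj⁺ (suc u) (suc v) = adj G u v
    sym⁺ : ∀ u v → adj⁺ u v ≡ adj⁺ v u
    sym⁺ zero zero = refl
    sym⁺ zero (suc v) = refl
    sym⁺ (suc u) zero = refl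
    sym⁺ (suc u) (suc v) = adj-sym G u v
    irrefl⁺ : ∀ u → adj⁺ u u ≡ false
    irrefl⁺ zero = refl
    irrefl⁺ (suc u) = irrefl G u

  clash⇒joined : ∀ β v γ → clash β v γ ≡ true → joined v ≡ true
  clash⇒joined true v γ p = ∨-introˡ {v == a} (∧-elimˡ {v == a} p)
  clash⇒joined false v γ p = ∨-introʳ {v == a} (∧-elimˡ {t ∧ (v == b)} p)

  clash-old : ∀ β v {γ γ′} → clash β v γ ≡ true → clash β v γ′ ≡ true → γ ≡ γ′
  clash-old true v p q = trans (isColour-≡ (∧-elimʳ {v == a} p)) (sym (isColour-≡ (∧-elimʳ {v == a} q)))
  clash-old false v p q = trans (not-true (∧-elimʳ {t ∧ (v == b)} p)) (sym (not-true (∧-elimʳ {t ∧ (v == b)} q)))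

  clash-apart : ∀ v {γ γ′} → clash true v γ ≡ true → clash false v γ′ ≡ true → ⊥
  clash-apart v {γ} {γ′} p q = a≢b (∧-elimˡ {t} tb) (trans (sym (==-≡ v a (∧-elimˡ p))) (==-≡ v b (∧-elimʳ {t} tb)))
    where
    tb : t ∧ (v == b) ≡ true
    tb = ∧-elimˡ {t ∧ (v == b)} {not γ′} q

  clash-new : ∀ {β β′} v γ → clash β v γ ≡ true → clash β′ v γ ≡ true → β ≡ β′
  clash-new {true} {true} v γ p q = refl
  clash-new {false} {false} v γ p q = refl
  clash-new {true} {false} v γ p q = ⊥-elim (clash-apart v {γ} {γ} p q)
  clash-new {false} {true} v γ p q = ⊥-elim (clash-apart v {γ} {γ} q p)

  C⁺ : Cover G⁺
  C⁺ = record { hadj = hadj⁺ ; hsym = hsym⁺ ; hirrefl = hirrefl⁺ ; hcomplete = hcomplete⁺ ; hedge = hedge⁺ ; hmatch₁ = match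
    ; hmatch₂ = λ u v α α′ β u≢v p q → match v u β α α′ (u≢v ∘ sym) (trans (hsym⁺ (v , β) (u , α)) p) (trans (hsym⁺ (v , β) (u , α′)) q) }
    where
    hadj⁺ : Fin (suc n) × Bool → Fin (suc n) × Bool → Bool
    hadj⁺ (zero , α) (zero , β) = α xor β
    hadj⁺ (zero , α) (suc v , β) = clash α v β
    hadj⁺ (suc u , α) (zero , β) = clash β u α
    hadj⁺ (suc u , α) (suc v , β) = hadj C (u , α) (v , β)
    hsym⁺ : ∀ x y → hadj⁺ x y ≡ hadj⁺ y x
    hsym⁺ (zero , true) (zero , true) = refl
    hsym⁺ (zero , true) (zero , false) = refl
    hsym⁺ (zero , false) (zero , true) = refl
    hsym⁺ (zero , false) (zero , false) = refl
    hsym⁺ (zero , α) (suc v , β) = refl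
    hsym⁺ (suc u , α) (zero , β) = refl
    hsym⁺ (suc u , α) (suc v , β) = hsym C (u , α) (v , β)
    hirrefl⁺ : ∀ x → hadj⁺ x x ≡ false
    hirrefl⁺ (zero , true) = refl
    hirrefl⁺ (zero , false) = refl
    hirrefl⁺ (suc u , α) = hirrefl C (u , α)
    hcomplete⁺ : ∀ u → hadj⁺ (u , false) (u , true) ≡ true
    hcomplete⁺ zero = refl
    hcomplete⁺ (suc u) = hcomplete C u
    hedge⁺ : ∀ u v α β → u ≢ v → hadj⁺ (u , α) (v , β) ≡ true → adj G⁺ u v ≡ true
    hedge⁺ zero zero α β u≢v p = ⊥-elim (u≢v refl)
    hedge⁺ zero (suc v) α β u≢v p = clash⇒joined α v β p
    hedge⁺ (suc u) zero α β u≢v p = clash⇒joined β u α p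
    hedge⁺ (suc u) (suc v) α β u≢v p = hedge C u v α β (u≢v ∘ cong suc) p
    match : ∀ u v α β β′ → u ≢ v → hadj⁺ (u , α) (v , β) ≡ true → hadj⁺ (u , α) (v , β′) ≡ true → β ≡ β′
    match zero zero α β β′ u≢v p q = ⊥-elim (u≢v refl)
    match zero (suc v) α β β′ u≢v p q = clash-old α v p q
    match (suc u) zero α β β′ u≢v p q = clash-new u α p q
    match (suc u) (suc v) α β β′ u≢v p q = hmatch₁ C u v α β β′ (u≢v ∘ cong suc) p q

  degφ-grow : ∀ φ v → degφ C⁺ φ (suc v) ≡ (clash (φ zero) v (φ (suc v)) ▸ 1) + degφ C (φ ∘ suc) v
  degφ-grow φ v = sumF-suc (λ u → hadj C⁺ (u , φ u) (suc v , φ (suc v)) ▸ 1)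

  degφ-mono : ∀ φ v → degφ C (φ ∘ suc) v ≤ degφ C⁺ φ (suc v)
  degφ-mono φ v = ≤-trans (m≤n+m _ _) (≤-reflexive (sym (degφ-grow φ v)))

  degφ-clash : ∀ φ v → clash (φ zero) v (φ (suc v)) ≡ true → degφ C⁺ φ (suc v) ≡ suc (degφ C (φ ∘ suc) v)
  degφ-clash φ v p = trans (degφ-grow φ v) (cong (λ b → (b ▸ 1) + degφ C (φ ∘ suc) v) p)

  touch : VSet n → ℕ
  touch Y = count (λ v → Y v ∧ joined v)

  touch-≤ : ∀ Y → touch Y ≤ (Y a ▸ 1) + (t ∧ Y b ▸ 1)
  touch-≤ Y = ≤-trans (sumF-mono λ v → pw (Y v) (v == a) (v == b) t)
    (≤-trans (≤-reflexive (sumF-+ (λ v → (v == a) ▸ (Y v ▸ 1)) (λ v → (v == b) ▸ (t ∧ Y v ▸ 1))))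
      (≤-reflexive (cong₂ _+_ (wsum-｛｝ (λ v → Y v ▸ 1) a) (wsum-｛｝ (λ v → t ∧ Y v ▸ 1) b))))
    where
    pw : ∀ y p q t → (y ∧ (p ∨ (t ∧ q)) ▸ 1) ≤ (p ▸ (y ▸ 1)) + (q ▸ (t ∧ y ▸ 1))
    pw = toWitness {a? = allB? λ y → allB? λ p → allB? λ q → allB? λ t → _ ≤? _} tt

  touch-full : touch full ≡ 1 + (t ▸ 1)
  touch-full = ≤-antisym (≤-trans (touch-≤ full) (≤-reflexive (cong (λ s → 1 + (s ▸ 1)) (∧-identityʳ t)))) (lower t refl)
    where
    lower : ∀ s → t ≡ s → 1 + (s ▸ 1) ≤ touch full
    lower false _ = count-pos {p = joined} a (∨-introˡ (==-refl a))
    lower true p = ≤-trans (≤-reflexive (sym (cong₂ (λ x y → (x ▸ 1) + (y ▸ 1)) (∨-introˡ {a == a} (==-refl a)) (∨-introʳ {b == a} (∧-intro p (==-refl b))))))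
      (two-terms≤sumF (λ v → joined v ▸ 1) (a≢b p))

  edges-grow : ∀ Y → edges (adj G⁺) Y ≡ (Y zero ▸ touch (Y ∘ suc)) + edges (adj G) (Y ∘ suc)
  edges-grow Y = trans (sumF-suc (λ u → count (λ v → (Y u ∧ Y v) ∧ (adj G⁺ u v ∧ (toℕ u <ᵇ toℕ v)))))
    (cong₂ _+_ (trans (sumF-suc (λ v → (Y zero ∧ Y v) ∧ (adj G⁺ zero v ∧ (0 <ᵇ toℕ v)) ▸ 1)) (first (Y zero)))
      (sumF-cong λ u → trans (sumF-suc (λ v → (Y (suc u) ∧ Y v) ∧ (adj G⁺ (suc u) v ∧ (suc (toℕ u) <ᵇ toℕ v)) ▸ 1))
        (cong (_+ count (λ v → (Y (suc u) ∧ Y (suc v)) ∧ (adj G u v ∧ (toℕ u <ᵇ toℕ v)))) (last (Y (suc u) ∧ Y zero) (joined u)))))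
    where
    last : ∀ p q → (p ∧ (q ∧ false) ▸ 1) ≡ 0
    last p q rewrite ∧-zeroʳ q | ∧-zeroʳ p = refl
    first : ∀ y → ((y ∧ Y zero) ∧ false ▸ 1) + sumF (λ v → (y ∧ Y (suc v)) ∧ (joined v ∧ true) ▸ 1) ≡ (y ▸ touch (Y ∘ suc))
    first true = cong₂ _+_ (last (Y zero) true) (sumF-cong λ v → cong (λ s → Y (suc v) ∧ s ▸ 1) (∧-identityʳ (joined v)))
    first false = sumF-0 n

-- Gadgets around a hub

module Construction (i μ : ℕ) (3≤i : 3 ≤ i) (i<μ : suc i ≤ μ) where
  open Theorem i μ 3≤i i<μ
  open Sharpness i μ 3≤i i<μ

  Exact : ∀ {n} → Graph n → ℕ → Set
  Exact {n} G q = suc μ * size (full {n}) + k * edges (adj G) full + q ≡ wsum {n} (λ _ → weight) full + suc μ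

  -- The gadgets force conflicts through the bound on poor vertices; the bound on rich vertices
  -- comes in at the hub.
  PoorOK : ∀ {n} {G : Graph n} → Cover G → HMap n → Set
  PoorOK C φ = ∀ v → φ v ≡ false → degφ C φ v ≤ i

  module Step {n} (G : Graph n) (C : Cover G) (a : Fin n) (c : Bool) (t : Bool) (b : Fin n) (a≢b : t ≡ true → a ≢ b) where
    open Grow G C a c t b a≢b public

    PoorOK-old : ∀ {φ} → PoorOK C⁺ φ → PoorOK C (φ ∘ suc)
    PoorOK-old ok v p = ≤-trans (degφ-mono _ v) (ok (suc v) p)

    slack-without : ∀ Y q → Y zero ≡ false → GSlack G (Y ∘ suc) q → GSlack G⁺ Y q
    slack-without Y q Y0 = subst₂ _≤_
      (sym (cong (_+ q) (cong₂ (λ s e → suc μ * s + k * e) (trans (sumF-suc (λ v → Y v ▸ 1)) (cong (λ y → (y ▸ 1) + size (Y ∘ suc)) Y0))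
        (trans (edges-grow Y) (cong (λ y → (y ▸ touch (Y ∘ suc)) + edges (adj G) (Y ∘ suc)) Y0)))))
      (sym (cong (_+ suc μ) (trans (sumF-suc (λ v → Y v ▸ weight)) (cong (λ y → (y ▸ weight) + wsum (λ _ → weight) (Y ∘ suc)) Y0))))

    -- As `weight` exceeds `suc μ` by 2k - 1, a new vertex with d edges into the set changes its
    -- slack by 2k - 1 - kd.
    slack-with : ∀ Y q d {q₀} → Y zero ≡ true → touch (Y ∘ suc) ≤ d → GSlack G (Y ∘ suc) q₀ → k * d + suc q ≤ q₀ + 2 * k → GSlack G⁺ Y q
    slack-with Y q d {q₀} Y0 h s enough = subst₂ _≤_
      (sym (cong (_+ q) (cong₂ (λ s e → suc μ * s + k * e) (trans (sumF-suc (λ v → Y v ▸ 1)) (cong (λ y → (y ▸ 1) + size (Y ∘ suc)) Y0))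
        (trans (edges-grow Y) (cong (λ y → (y ▸ touch (Y ∘ suc)) + edges (adj G) (Y ∘ suc)) Y0)))))
      (sym (cong (_+ suc μ) (trans (sumF-suc (λ v → Y v ▸ weight)) (cong (λ y → (y ▸ weight) + wsum (λ _ → weight) (Y ∘ suc)) Y0))))
      (≤-cert _ _ 0 (+-mono-≤ s (+-mono-≤ (*-monoʳ-≤ k h) enough))
        (eq i μ (size (Y ∘ suc)) (touch (Y ∘ suc)) (edges (adj G) (Y ∘ suc)) q q₀ d (wsum (λ _ → weight) (Y ∘ suc))))
      where
      eq : ∀ i μ s h e q q₀ d w → (suc μ * (1 + s) + suc i * (h + e) + q) + ((w + suc μ) + (suc i * d + (q₀ + 2 * suc i))) + 0
        ≡ (((suc i + suc (μ + i)) + w) + suc μ) + ((suc μ * s + suc i * e + q₀) + (suc i * h + (suc i * d + suc q)))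
      eq = solve-∀

    exact-grow : ∀ {q q₀} → Exact G q₀ → k * (1 + (t ▸ 1)) + suc q ≡ q₀ + 2 * k → Exact G⁺ q
    exact-grow {q} {q₀} ex enough = subst₂ _≡_
      (sym (cong (_+ q) (cong₂ (λ s e → suc μ * s + k * e) (sumF-suc {n} (λ v → 1)) (trans (edges-grow full) (cong (_+ edges (adj G) full) touch-full)))))
      (sym (cong (_+ suc μ) (sumF-suc {n} (λ v → weight))))
      (conclude (size {n} full) (edges (adj G) full) (wsum {n} (λ _ → weight) full) (1 + (t ▸ 1)) ex enough)
      where
      conclude : ∀ s e w h → suc μ * s + k * e + q₀ ≡ w + suc μ → k * h + suc q ≡ q₀ + 2 * k →
        suc μ * (1 + s) + k * (h + e) + q ≡ (weight + w) + suc μ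
      conclude s e w h ex enough = +-cancelʳ-≡ (q₀ + 2 * k) _ _
        (trans (eq₁ i μ s e h q q₀) (trans (cong₂ (λ x y → x + y + weight) ex enough) (eq₂ weight w (suc μ) (q₀ + 2 * k))))
        where
        eq₁ : ∀ i μ s e h q q₀ → suc μ * (1 + s) + suc i * (h + e) + q + (q₀ + 2 * suc i)
          ≡ (suc μ * s + suc i * e + q₀) + (suc i * h + suc q) + (suc i + suc (μ + i))
        eq₁ = solve-∀
        eq₂ : ∀ c w m z → (w + m) + z + c ≡ ((c + w) + m) + z
        eq₂ = solve-∀

  -- Here x is the hub and `A c` the number of conflicts forced on it in colour c. The bound `suc μ`
  -- in `outside` is the slack of the empty set: away from the hub each new vertex sends at most one
  -- edge back, so slack never drops.
  record Closed (A : Bool → ℕ) (g L : ℕ) : Set where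
    field
      {n}     : ℕ
      G       : Graph n
      C       : Cover G
      x       : Fin n
      exact   : Exact G g
      inside  : ∀ Y → Y x ≡ true → GSlack G Y g
      missing : ∀ Y y → Y x ≡ true → Y y ≡ false → GSlack G Y (suc g)
      outside : ∀ Y → Y x ≡ false → GSlack G Y (suc μ)
      forced  : ∀ φ → PoorOK C φ → ∀ c → φ x ≡ c → A c ≤ degφ C φ x
      large   : L ≤ n

  -- A gadget under construction at u. When x has colour c and is not hit by the gadget, u is poor and
  -- r further conflicts at u exceed its tolerance.
  record Open (c : Bool) (A : Bool → ℕ) (g r L : ℕ) : Set where
    field
      {n}     : ℕ
      G       : Graph n
      C       : Cover G
      x u     : Fin n
      x≢u     : x ≢ u
      exact   : Exact G (g + r)
      both    : ∀ Y → Y x ≡ true → Y u ≡ true → GSlack G Y (g + r)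
      missing : ∀ Y y → Y x ≡ true → Y u ≡ true → Y y ≡ false → GSlack G Y (suc (g + r))
      only-x  : ∀ Y → Y x ≡ true → Y u ≡ false → GSlack G Y (suc g)
      outside : ∀ Y → Y x ≡ false → GSlack G Y (suc μ)
      gadget  : ∀ φ → PoorOK C φ → φ x ≡ c → suc (A c) ≤ degφ C φ x ⊎ (A c ≤ degφ C φ x × φ u ≡ false × k ≤ degφ C φ u + r)
      forced  : ∀ φ → PoorOK C φ → ∀ c′ → φ x ≡ c′ → A c′ ≤ degφ C φ x
      large   : L ≤ n

  weaken : ∀ {n} {G : Graph n} {Y} q → GSlack G Y (suc q) → GSlack G Y q
  weaken {G = G} {Y} q s = ≤-trans (+-monoʳ-≤ (suc μ * size Y + k * edges (adj G) Y) (n≤1+n q)) s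

  touch-none : ∀ {p} → p ≡ false → ∀ q → (p ▸ 1) + (false ∧ q ▸ 1) ≤ 0
  touch-none refl q = z≤n

  touch-one : ∀ p q → (p ▸ 1) + (false ∧ q ▸ 1) ≤ 1
  touch-one true q = ≤-refl
  touch-one false q = z≤n

  touch-two : ∀ p q → (p ▸ 1) + (true ∧ q ▸ 1) ≤ 2
  touch-two true true = ≤-refl
  touch-two true false = s≤s z≤n
  touch-two false true = s≤s z≤n
  touch-two false false = z≤n

  touch-first : ∀ p {q} → q ≡ false → (p ▸ 1) + (true ∧ q ▸ 1) ≤ 1
  touch-first true refl = ≤-refl
  touch-first false refl = z≤n

  touch-second : ∀ {p} → p ≡ false → ∀ q → (p ▸ 1) + (true ∧ q ▸ 1) ≤ 1
  touch-second refl true = ≤-refl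
  touch-second refl false = z≤n

  one-touch : ∀ q₀ → k * 1 + suc q₀ ≤ q₀ + 2 * k
  one-touch q₀ = ≤-cert _ _ 0 (s≤s (z≤n {i})) (eq i q₀)
    where
    eq : ∀ i q → (suc i * 1 + suc q) + suc i + 0 ≡ (q + 2 * suc i) + 1
    eq = solve-∀

  -- The new vertex u hits the hub in colour c unless it is poor. Its single edge raises the slack
  -- by k - 1, and the k attachments to follow lower it by one each, so that a gadget costs one unit
  -- in all.
  open-gadget : ∀ {A g L} c → Closed A (suc g) L → Open c A g k L
  open-gadget {A} {g} {L} c S = record
    { G = G⁺ ; C = C⁺ ; x = suc x ; u = zero ; x≢u = λ () ; exact = exact-grow exact (eq k g)
    ; both = λ Y Yx Yu → slack-with Y (g + k) 1 Yu (≤-trans (touch-≤ (Y ∘ suc)) (touch-one (Y (suc x)) (Y (suc x)))) (inside (Y ∘ suc) Yx) (≤-reflexive (eq k g))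
    ; missing = missing⁺
    ; only-x = λ Y Yx Yu → slack-without Y (suc g) Yu (inside (Y ∘ suc) Yx)
    ; outside = λ Y Yx → outside⁺ Y Yx (Y zero) refl
    ; gadget = gadget⁺
    ; forced = λ φ ok c′ p → ≤-trans (forced (φ ∘ suc) (PoorOK-old {φ} ok) c′ p) (degφ-mono φ x)
    ; large = ≤-trans large (n≤1+n _) }
    where
    open Closed S
    open Step G C x c false x (λ ())
    eq : ∀ k g → k * 1 + suc (g + k) ≡ suc g + 2 * k
    eq = solve-∀
    missing⁺ : ∀ Y y → Y (suc x) ≡ true → Y zero ≡ true → Y y ≡ false → GSlack G⁺ Y (suc (g + k))
    missing⁺ Y zero Yx Yu Yy = true≢false Yu Yy
    missing⁺ Y (suc y) Yx Yu Yy = slack-with Y (suc (g + k)) 1 Yu (≤-trans (touch-≤ (Y ∘ suc)) (touch-one (Y (suc x)) (Y (suc x)))) (missing (Y ∘ suc) y Yx Yy)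
      (≤-reflexive (eq k (suc g)))
    outside⁺ : ∀ Y → Y (suc x) ≡ false → ∀ b → Y zero ≡ b → GSlack G⁺ Y (suc μ)
    outside⁺ Y Yx false p = slack-without Y (suc μ) p (outside (Y ∘ suc) Yx)
    outside⁺ Y Yx true p = slack-with Y (suc μ) 1 p (≤-trans (touch-≤ (Y ∘ suc)) (touch-one (Y (suc x)) (Y (suc x)))) (outside (Y ∘ suc) Yx) (one-touch (suc μ))
    gadget⁺ : ∀ φ → PoorOK C⁺ φ → φ (suc x) ≡ c → suc (A c) ≤ degφ C⁺ φ (suc x) ⊎ (A c ≤ degφ C⁺ φ (suc x) × φ zero ≡ false × k ≤ degφ C⁺ φ zero + k)
    gadget⁺ φ ok p = by (φ zero) refl
      where
      old = forced (φ ∘ suc) (PoorOK-old {φ} ok) c p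
      by : ∀ b → φ zero ≡ b → suc (A c) ≤ degφ C⁺ φ (suc x) ⊎ (A c ≤ degφ C⁺ φ (suc x) × φ zero ≡ false × k ≤ degφ C⁺ φ zero + k)
      by true q = inj₁ (≤-trans (s≤s old) (≤-reflexive (sym (degφ-clash φ x
        (subst (λ b → clash b x (φ (suc x)) ≡ true) (sym q) (∧-intro (==-refl x) (subst (λ γ → isColour γ c ≡ true) (sym p) (isColour-refl c))))))))
      by false q = inj₂ (≤-trans old (degφ-mono φ x) , q , m≤n+m k _)

  -- Joined to both x and u, the new vertex hits the hub in colour c if it is rich, and poor u if it
  -- is poor. Either the gadget has done its work or u is one conflict closer to its limit.
  attach : ∀ {c A g r L} → Open c A g (suc r) L → Open c A g r L
  attach {c} {A} {g} {r} {L} S = record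
    { G = G⁺ ; C = C⁺ ; x = suc x ; u = suc u ; x≢u = λ { refl → x≢u refl } ; exact = exact-grow exact (eq k g r)
    ; both = both⁺ ; missing = missing⁺ ; only-x = only-x⁺ ; outside = outside⁺ ; gadget = gadget⁺
    ; forced = λ φ ok c′ p → ≤-trans (forced (φ ∘ suc) (PoorOK-old {φ} ok) c′ p) (degφ-mono φ x)
    ; large = ≤-trans large (n≤1+n _) }
    where
    open Open S
    open Step G C x c true u (λ _ → x≢u)
    eq : ∀ k g r → k * 2 + suc (g + r) ≡ g + suc r + 2 * k
    eq = solve-∀
    both⁺ : ∀ Y → Y (suc x) ≡ true → Y (suc u) ≡ true → GSlack G⁺ Y (g + r)
    both⁺ Y Yx Yu = by (Y zero) refl
      where
      by : ∀ b → Y zero ≡ b → GSlack G⁺ Y (g + r)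
      by true p = slack-with Y (g + r) 2 p (≤-trans (touch-≤ (Y ∘ suc)) (touch-two (Y (suc x)) (Y (suc u)))) (both (Y ∘ suc) Yx Yu) (≤-reflexive (eq k g r))
      by false p = weaken {G = G⁺} {Y} (g + r) (slack-without Y (suc (g + r)) p (subst (GSlack G (Y ∘ suc)) (+-suc g r) (both (Y ∘ suc) Yx Yu)))
    missing⁺ : ∀ Y y → Y (suc x) ≡ true → Y (suc u) ≡ true → Y y ≡ false → GSlack G⁺ Y (suc (g + r))
    missing⁺ Y y Yx Yu Yy = by (Y zero) refl y Yy
      where
      by : ∀ b → Y zero ≡ b → ∀ y → Y y ≡ false → GSlack G⁺ Y (suc (g + r))
      by false p y Yy = slack-without Y (suc (g + r)) p (subst (GSlack G (Y ∘ suc)) (+-suc g r) (both (Y ∘ suc) Yx Yu))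
      by true p zero Yy = true≢false p Yy
      by true p (suc y) Yy = slack-with Y (suc (g + r)) 2 p (≤-trans (touch-≤ (Y ∘ suc)) (touch-two (Y (suc x)) (Y (suc u)))) (missing (Y ∘ suc) y Yx Yu Yy)
        (≤-reflexive (eq k (suc g) r))
    only-x⁺ : ∀ Y → Y (suc x) ≡ true → Y (suc u) ≡ false → GSlack G⁺ Y (suc g)
    only-x⁺ Y Yx Yu = by (Y zero) refl
      where
      by : ∀ b → Y zero ≡ b → GSlack G⁺ Y (suc g)
      by true p = slack-with Y (suc g) 1 p (≤-trans (touch-≤ (Y ∘ suc)) (touch-first (Y (suc x)) Yu)) (only-x (Y ∘ suc) Yx Yu) (one-touch (suc g))
      by false p = slack-without Y (suc g) p (only-x (Y ∘ suc) Yx Yu)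
    outside⁺ : ∀ Y → Y (suc x) ≡ false → GSlack G⁺ Y (suc μ)
    outside⁺ Y Yx = by (Y zero) refl
      where
      by : ∀ b → Y zero ≡ b → GSlack G⁺ Y (suc μ)
      by true p = slack-with Y (suc μ) 1 p (≤-trans (touch-≤ (Y ∘ suc)) (touch-second Yx (Y (suc u)))) (outside (Y ∘ suc) Yx) (one-touch (suc μ))
      by false p = slack-without Y (suc μ) p (outside (Y ∘ suc) Yx)
    gadget⁺ : ∀ φ → PoorOK C⁺ φ → φ (suc x) ≡ c → suc (A c) ≤ degφ C⁺ φ (suc x) ⊎ (A c ≤ degφ C⁺ φ (suc x) × φ (suc u) ≡ false × k ≤ degφ C⁺ φ (suc u) + r)
    gadget⁺ φ ok p with gadget (φ ∘ suc) (PoorOK-old {φ} ok) p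
    ... | inj₁ hit = inj₁ (≤-trans hit (degφ-mono φ x))
    ... | inj₂ (old , pu , many) = by (φ zero) refl
      where
      by : ∀ b → φ zero ≡ b → suc (A c) ≤ degφ C⁺ φ (suc x) ⊎ (A c ≤ degφ C⁺ φ (suc x) × φ (suc u) ≡ false × k ≤ degφ C⁺ φ (suc u) + r)
      by true q = inj₁ (≤-trans (s≤s old) (≤-reflexive (sym (degφ-clash φ x
        (subst (λ b → clash b x (φ (suc x)) ≡ true) (sym q) (∧-intro (==-refl x) (subst (λ γ → isColour γ c ≡ true) (sym p) (isColour-refl c))))))))
      by false q = inj₂ (≤-trans old (degφ-mono φ x) , pu , ≤-trans many (≤-reflexive (trans (+-suc _ r) (cong (_+ r) (sym (degφ-clash φ u
        (subst (λ b → clash b u (φ (suc u)) ≡ true) (sym q) (∧-intro (==-refl u) (cong not pu)))))))))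

  -- In place of the last attachment u gets a pendant vertex whose rich colour conflicts with poor
  -- u. Since u can take no further conflict, the pendant vertex is poor and assumes the role of u,
  -- with all k conflicts still to come. The slack rises again by k - 1.
  prolong : ∀ {c A g L} → Open c A g 1 L → Open c A g k (suc L)
  prolong {c} {A} {g} {L} S = record
    { G = G⁺ ; C = C⁺ ; x = suc x ; u = zero ; x≢u = λ () ; exact = exact-grow exact (eq k g)
    ; both = λ Y Yx Yv → both⁺ Y Yx Yv (Y (suc u)) refl
    ; missing = λ Y y Yx Yv Yy → missing⁺ Y y Yx Yv Yy (Y (suc u)) refl
    ; only-x = λ Y Yx Yv → slack-without Y (suc g) Yv (only-x⁺ (Y ∘ suc) Yx (Y (suc u)) refl)
    ; outside = outside⁺ ; gadget = gadget⁺
    ; forced = λ φ ok c′ p → ≤-trans (forced (φ ∘ suc) (PoorOK-old {φ} ok) c′ p) (degφ-mono φ x)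
    ; large = s≤s large }
    where
    open Open S
    open Step G C u false false u (λ ())
    eq : ∀ k g → k * 1 + suc (g + k) ≡ g + 1 + 2 * k
    eq = solve-∀
    touched : ∀ Y → touch (Y ∘ suc) ≤ 1
    touched Y = ≤-trans (touch-≤ (Y ∘ suc)) (touch-one (Y (suc u)) (Y (suc u)))
    apart : ∀ Y → Y zero ≡ true → Y (suc x) ≡ true → Y (suc u) ≡ false → GSlack G⁺ Y (suc (g + k))
    apart Y Yv Yx Yu = slack-with Y (suc (g + k)) 0 Yv (≤-trans (touch-≤ (Y ∘ suc)) (touch-none Yu (Y (suc u)))) (only-x (Y ∘ suc) Yx Yu)
      (≤-cert _ _ 0 (s≤s (z≤n {i})) (eq′ i g))
      where
      eq′ : ∀ i g → (suc i * 0 + suc (suc (g + suc i))) + suc i + 0 ≡ (suc g + 2 * suc i) + 1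
      eq′ = solve-∀
    both⁺ : ∀ Y → Y (suc x) ≡ true → Y zero ≡ true → ∀ b → Y (suc u) ≡ b → GSlack G⁺ Y (g + k)
    both⁺ Y Yx Yv true Yu = slack-with Y (g + k) 1 Yv (touched Y) (both (Y ∘ suc) Yx Yu) (≤-reflexive (eq k g))
    both⁺ Y Yx Yv false Yu = weaken {G = G⁺} {Y} (g + k) (apart Y Yv Yx Yu)
    missing⁺ : ∀ Y y → Y (suc x) ≡ true → Y zero ≡ true → Y y ≡ false → ∀ b → Y (suc u) ≡ b → GSlack G⁺ Y (suc (g + k))
    missing⁺ Y y Yx Yv Yy false Yu = apart Y Yv Yx Yu
    missing⁺ Y zero Yx Yv Yy true Yu = true≢false Yv Yy
    missing⁺ Y (suc y) Yx Yv Yy true Yu = slack-with Y (suc (g + k)) 1 Yv (touched Y) (missing (Y ∘ suc) y Yx Yu Yy) (≤-reflexive (eq k (suc g)))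
    only-x⁺ : ∀ Y → Y x ≡ true → ∀ b → Y u ≡ b → GSlack G Y (suc g)
    only-x⁺ Y Yx true Yu = subst (GSlack G Y) (+-comm g 1) (both Y Yx Yu)
    only-x⁺ Y Yx false Yu = only-x Y Yx Yu
    outside⁺ : ∀ Y → Y (suc x) ≡ false → GSlack G⁺ Y (suc μ)
    outside⁺ Y Yx = by (Y zero) refl
      where
      by : ∀ b → Y zero ≡ b → GSlack G⁺ Y (suc μ)
      by true p = slack-with Y (suc μ) 1 p (touched Y) (outside (Y ∘ suc) Yx) (one-touch (suc μ))
      by false p = slack-without Y (suc μ) p (outside (Y ∘ suc) Yx)
    gadget⁺ : ∀ φ → PoorOK C⁺ φ → φ (suc x) ≡ c → suc (A c) ≤ degφ C⁺ φ (suc x) ⊎ (A c ≤ degφ C⁺ φ (suc x) × φ zero ≡ false × k ≤ degφ C⁺ φ zero + k)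
    gadget⁺ φ ok p with gadget (φ ∘ suc) (PoorOK-old {φ} ok) p
    ... | inj₁ hit = inj₁ (≤-trans hit (degφ-mono φ x))
    ... | inj₂ (old , pu , many) = by (φ zero) refl
      where
      by : ∀ b → φ zero ≡ b → suc (A c) ≤ degφ C⁺ φ (suc x) ⊎ (A c ≤ degφ C⁺ φ (suc x) × φ zero ≡ false × k ≤ degφ C⁺ φ zero + k)
      by true q = ⊥-elim (<⇒≱ (s≤s (ok (suc u) pu)) (≤-trans many (≤-reflexive (trans (+-comm _ 1) (sym (degφ-clash φ u
        (subst (λ b → clash b u (φ (suc u)) ≡ true) (sym q) (∧-intro (==-refl u) (subst (λ γ → isColour γ false ≡ true) (sym pu) refl)))))))))
      by false q = inj₂ (≤-trans old (degφ-mono φ x) , q , m≤n+m k _)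

  bump : Bool → (Bool → ℕ) → Bool → ℕ
  bump c A c′ = if isColour c′ c then suc (A c′) else A c′

  close : ∀ {c A g L} → Open c A g 0 L → Closed (bump c A) g L
  close {c} {A} {g} {L} S = record
    { G = G ; C = C ; x = x ; exact = subst (Exact G) (+-identityʳ g) exact
    ; inside = λ Y Yx → inside⁺ Y Yx (Y u) refl ; missing = λ Y y Yx Yy → missing⁺ Y y Yx Yy (Y u) refl
    ; outside = outside ; forced = forced⁺ ; large = large }
    where
    open Open S
    inside⁺ : ∀ Y → Y x ≡ true → ∀ b → Y u ≡ b → GSlack G Y g
    inside⁺ Y Yx true Yu = subst (GSlack G Y) (+-identityʳ g) (both Y Yx Yu)
    inside⁺ Y Yx false Yu = weaken {G = G} {Y} g (only-x Y Yx Yu)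
    missing⁺ : ∀ Y y → Y x ≡ true → Y y ≡ false → ∀ b → Y u ≡ b → GSlack G Y (suc g)
    missing⁺ Y y Yx Yy true Yu = subst (GSlack G Y) (cong suc (+-identityʳ g)) (missing Y y Yx Yu Yy)
    missing⁺ Y y Yx Yy false Yu = only-x Y Yx Yu
    forced⁺ : ∀ φ → PoorOK C φ → ∀ c′ → φ x ≡ c′ → bump c A c′ ≤ degφ C φ x
    forced⁺ φ ok c′ p with c′ ≟B c
    ... | no _ = forced φ ok c′ p
    ... | yes refl with gadget φ ok p
    ...   | inj₁ hit = hit
    -- With no conflict outstanding, u would be poor with `k = suc i` conflicts; hence the hub has
    -- been hit.
    ...   | inj₂ (_ , pu , many) = ⊥-elim (<⇒≱ (s≤s (ok u pu)) (≤-trans many (≤-reflexive (+-identityʳ _))))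

  attach-many : ∀ {c A g L} r s → Open c A g (r + s) L → Open c A g s L
  attach-many zero s S = S
  attach-many (suc r) s S = attach-many r s (attach S)

  prolong-many : ∀ {c A g L} N → Open c A g 1 L → Open c A g 1 (N + L)
  prolong-many zero S = S
  prolong-many {c} {A} {g} {L} (suc N) S = subst (Open c A g 1) (+-suc N L)
    (prolong-many N (attach-many i 1 (subst (λ r → Open c A g r (suc L)) (+-comm 1 i) (prolong S))))

  -- The i attachments bring the count from k down to one, the only stage at which `prolong`
  -- applies. Each prolongation is again followed by i attachments, and one last attachment
  -- completes the gadget.
  add-gadget : ∀ {A g L} c N → Closed A (suc g) L → Closed (bump c A) g (N + L)
  add-gadget {A} {g} {L} c N S = close (attach (prolong-many N (attach-many i 1 (subst (λ r → Open c A g r L) (+-comm 1 i) (open-gadget c S)))))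

  bumps : ℕ → Bool → (Bool → ℕ) → Bool → ℕ
  bumps zero c A = A
  bumps (suc s) c A = bumps s c (bump c A)

  bumps-same : ∀ s c A → bumps s c A c ≡ s + A c
  bumps-same zero c A = refl
  bumps-same (suc s) c A = trans (bumps-same s c (bump c A)) (trans (cong (λ b → s + (if b then suc (A c) else A c)) (isColour-refl c)) (+-suc s (A c)))

  bumps-false : ∀ s A → bumps s true A false ≡ A false
  bumps-false zero A = refl
  bumps-false (suc s) A = bumps-false s (bump true A)

  add-gadgets : ∀ {A g L} s c → Closed A (s + g) L → Closed (bumps s c A) g L
  add-gadgets zero c S = S
  add-gadgets (suc s) c S = add-gadgets s c (add-gadget c 0 S)

  -- The hub alone has slack `weight`. This is exactly the number of gadgets needed to exclude both
  -- colours, `k = suc i` against poor and `suc j` against rich.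
  single : Closed (λ _ → 0) (k + suc j) 0
  single = record
    { G = point ; C = cover ; x = zero ; exact = eq i μ
    ; inside = λ Y Y0 → present Y Y0
    ; missing = λ { Y zero Y0 Yy → true≢false Y0 Yy }
    ; outside = λ Y Y0 → absent Y Y0
    ; forced = λ _ _ _ _ → z≤n ; large = z≤n }
    where
    point : Graph 1
    point = record { adj = λ _ _ → false ; sym = λ _ _ → refl ; irrefl = λ _ → refl }
    cover : Cover point
    cover = record
      { hadj = λ { (_ , α) (_ , β) → α xor β }
      ; hsym = λ { (_ , true) (_ , true) → refl ; (_ , true) (_ , false) → refl ; (_ , false) (_ , true) → refl ; (_ , false) (_ , false) → refl }
      ; hirrefl = λ { (_ , true) → refl ; (_ , false) → refl }
      ; hcomplete = λ _ → refl
      ; hedge = λ { zero zero _ _ u≢v → ⊥-elim (u≢v refl) }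
      ; hmatch₁ = λ { zero zero _ _ _ u≢v → ⊥-elim (u≢v refl) }
      ; hmatch₂ = λ { zero zero _ _ _ u≢v → ⊥-elim (u≢v refl) } }
    eq : ∀ i μ → suc μ * 1 + suc i * 0 + (suc i + suc (μ + i)) ≡ (suc i + suc (μ + i) + 0) + suc μ
    eq = solve-∀
    no-edges : ∀ Y → edges (adj point) Y ≡ 0
    no-edges Y = sumF-zero λ u → sumF-zero λ v → cong (_▸ 1) (∧-zeroʳ (Y u ∧ Y v))
    present : ∀ Y → Y zero ≡ true → GSlack point Y (k + suc j)
    present Y Y0 rewrite no-edges Y | Y0 = ≤-reflexive (eq i μ)
    absent : ∀ Y → Y zero ≡ false → GSlack point Y (suc μ)
    absent Y Y0 rewrite no-edges Y | Y0 = ≤-reflexive (eq′ i μ)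
      where
      eq′ : ∀ i μ → suc μ * 0 + suc i * 0 + suc μ ≡ suc μ
      eq′ = solve-∀

  bumps-true : ∀ s A → bumps s false A true ≡ A true
  bumps-true zero A = refl
  bumps-true (suc s) A = bumps-true s (bump false A)

  -- The hub has no possible colour, so the graph is not colourable. Slack zero of the whole gives
  -- the edge count, and slack at least one of every proper set makes the proper subgraphs
  -- colourable.
  saturated⇒sharp : ∀ {A N} → (∀ c → A c ≡ suc (capacity i j c)) → Closed A 0 N →
    ∃ λ n → N ≤ n × ∃ λ (G : Graph n) → Critical i j G × (i + 1) * edgeCount G ≡ (2 * i + 1) * n + μ + 1
  saturated⇒sharp {A} over S = n , large , G , (uncolorable , λ m′ G′ f sub ¬whole → proper⇒colorable {G′ = G′} {G} {f} (inside full refl) proper sub ¬whole) ,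
      count-edges (size (full {n})) (wsum {n} (λ _ → weight) full) (edgeCount G) (size-full n) (trans (wsum-const {n} weight full) (cong (weight *_) (size-full n))) exact
    where
    open Closed S
    uncolorable : ¬ Colorable i j G
    uncolorable col with col C
    ... | φ , ok = <⇒≱ (≤-refl {suc (capacity i j (φ x))}) (≤-trans (≤-trans (≤-reflexive (sym (over (φ x)))) (forced φ poorOK (φ x) refl)) (ok x))
      where
      poorOK : PoorOK C φ
      poorOK v p = subst (λ c → degφ C φ v ≤ capacity i j c) p (ok v)
    proper : ∀ Y y → Y y ≡ false → GSlack G Y 1
    proper Y y Yy = by (Y x) refl
      where
      by : ∀ b → Y x ≡ b → GSlack G Y 1
      by true Yx = missing Y y Yx Yy
      by false Yx = ≤-trans (+-monoʳ-≤ (suc μ * size Y + k * edges (adj G) Y) (s≤s (z≤n {μ}))) (outside Y Yx)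
    count-edges : ∀ s w e → s ≡ n → w ≡ weight * n → suc μ * s + k * e + 0 ≡ w + suc μ → (i + 1) * e ≡ (2 * i + 1) * n + μ + 1
    count-edges s w e refl refl ex = +-cancelˡ-≡ (suc μ * n) _ _ (trans (eq₁ μ i n e) (trans ex (eq₂ μ i n)))
      where
      eq₁ : ∀ μ i n e → suc μ * n + (i + 1) * e ≡ suc μ * n + suc i * e + 0
      eq₁ = solve-∀
      eq₂ : ∀ μ i n → (suc i + suc (μ + i)) * n + suc μ ≡ suc μ * n + ((2 * i + 1) * n + μ + 1)
      eq₂ = solve-∀

  sharp : ∀ N → ∃ λ n → N ≤ n × ∃ λ (G : Graph n) → Critical i j G × (i + 1) * edgeCount G ≡ (2 * i + 1) * n + μ + 1
  sharp N = from-poor (bumps k false (λ _ → 0)) (bumps-true k (λ _ → 0)) (trans (bumps-same k false (λ _ → 0)) (+-identityʳ k))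
      (add-gadgets k false single)
    where
    from-poor : ∀ A → A true ≡ 0 → A false ≡ k → Closed A (suc j) 0 →
      ∃ λ n → N ≤ n × ∃ λ (G : Graph n) → Critical i j G × (i + 1) * edgeCount G ≡ (2 * i + 1) * n + μ + 1
    from-poor A At Af S = saturated⇒sharp over
        -- One of the `suc j` rich gadgets is kept for the end and prolonged N times, which makes
        -- the graph as large as required at unchanged slack.
        (subst (Closed (bump true (bumps j true A)) 0) (+-identityʳ N) (add-gadget true N (add-gadgets j true (subst (λ g → Closed A g 0) (+-comm 1 j) S))))
      where
      over : ∀ c → bump true (bumps j true A) c ≡ suc (capacity i j c)
      over true = cong suc (trans (bumps-same j true A) (trans (cong (j +_) At) (+-identityʳ j)))
      over false = trans (bumps-false j A) Af

-- Return to the parameters i and j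

theorem-for : ∀ i μ → 3 ≤ i → suc i ≤ μ →
    ((n : ℕ) (G : Graph n) → Critical i (μ + i) G →
       (2 * i + 1) * n + μ + 1 ≤ (i + 1) * edgeCount G)
    ×
    ((N : ℕ) → ∃ λ (n : ℕ) → N ≤ n × ∃ λ (G : Graph n) →
       Critical i (μ + i) G × (i + 1) * edgeCount G ≡ (2 * i + 1) * n + μ + 1)
theorem-for i μ 3≤i i<μ =
  (λ n G crit → ≤-trans (≤-reflexive (trans (+-assoc _ μ 1) (cong ((2 * i + 1) * n +_) (+-comm μ 1)))) (lower-bound crit)) , sharp
  where
  open Theorem i μ 3≤i i<μ
  open Construction i μ 3≤i i<μ

theorem2p1 : (i j : ℕ) → 3 ≤ i → 2 * i + 1 ≤ j →
    ((n : ℕ) (G : Graph n) → Critical i j G →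
    (2 * i + 1) * n + (j ∸ i) + 1 ≤ (i + 1) * edgeCount G)
    ×
    ((N : ℕ) → ∃ λ (n : ℕ) → N ≤ n × ∃ λ (G : Graph n) →
    Critical i j G × (i + 1) * edgeCount G ≡ (2 * i + 1) * n + (j ∸ i) + 1)
-- With `μ = j ∸ i` the result speaks of `μ + i` in place of j. The inner transport adjusts only the
-- displayed difference, the outer one then replaces `j ∸ i + i` by j throughout.
theorem2p1 i j 3≤i h = subst Bounds (m∸n+n≡m (≤-trans (m≤m+n i (i + 1)) 2i<j))
  (subst Bounds′ (sym (m+n∸n≡m (j ∸ i) i)) (theorem-for i (j ∸ i) 3≤i (≤-trans (≤-reflexive (trans (+-comm 1 i) (sym (m+n∸m≡n i (i + 1))))) (∸-monoˡ-≤ i 2i<j))))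
  where
  2i<j : i + (i + 1) ≤ j
  2i<j = ≤-trans (≤-reflexive (eq i)) h
    where
    eq : ∀ i → i + (i + 1) ≡ 2 * i + 1
    eq = solve-∀
  Shape : ℕ → ℕ → Set
  Shape j d = ((n : ℕ) (G : Graph n) → Critical i j G → (2 * i + 1) * n + d + 1 ≤ (i + 1) * edgeCount G) ×
    ((N : ℕ) → ∃ λ (n : ℕ) → N ≤ n × ∃ λ (G : Graph n) → Critical i j G × (i + 1) * edgeCount G ≡ (2 * i + 1) * n + d + 1)
  Bounds Bounds′ : ℕ → Set
  Bounds j = Shape j (j ∸ i)
  Bounds′ = Shape (j ∸ i + i)
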